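{- Let $Z(1;q_0,q_1)=\sum_{\pi\in\mathcal{P}_1} q_0^{\#\{\text{dark bricks in }\pi\}}q_1^{\#\{\text{light bricks in }\pi\}}\in\mathbb{Z}[[q_0,q_1]]$ be the generating function of pyramid partitions of length $1$ (defined in the context). Then, with $q=q_0q_1$ and $M(x,q)=\prod_{m\ge1}(1-xq^m)^{ -m}$, \[ Z(1;q_0,q_1)=M(-q_1^{ -1},q_0q_1)^{ -1}\,Z(\infty;q_0,q_1),\qquad Z(\infty;q_0,q_1):=M(1,q_0q_1)^2\,M(-q_1,q_0q_1)^{ -1}. \] Equivalently, \[ Z(1;q_0,q_1)=M(1,q_0q_1)^2\prod_{k\ge1}(1+q_0^kq_1^{k-1})^{k}\prod_{k\ge1}(1+q_0^kq_1^{k+1})^{k}. \]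
   Context: MacMahon function: $M(x,q)=\prod_{m=1}^{\infty}(1-xq^m)^{ -m}$; note $M(-q_1^{ -1},q_0q_1)^{ -1}=\prod_{m\ge1}(1+q_0^mq_1^{m-1})^m$ and $M(-q_1,q_0q_1)^{ -1}=\prod_{m\ge1}(1+q_0^mq_1^{m+1})^m$ are power series in $q_0,q_1$. Empty room of length $n\ge1$: its bricks are pairs $(k,p)$ with $k\in\mathbb{Z}_{\ge0}$ (the layer, counted downward from the top) and $p\in\mathbb{Z}^2$. Let $e_k=(1,0)$ if $k$ is even and $e_k=(0,1)$ if $k$ is odd. The layer sets are $B_0=\{(0,2j):0\le j\le n-1\}$ and $B_{k+1}=\{p\pm e_k: p\in B_k\}$; the empty room $\varepsilon_n$ is the set of all bricks $(k,p)$ with $p\in B_k$. Bricks in even layers are dark, bricks in odd layers are light. The brick $(k,p)$ rests upon the (two or fewer) bricks $(k+1,p\pm e_k)$ of $\varepsilon_n$ (physically: each brick rests on two side-by-side bricks of the layer below, rotated by $90^\circ$). A pyramid partition of length $n$ is a finite subset $\pi\subseteq\varepsilon_n$ such that whenever $B\in\pi$, every brick of $\varepsilon_n$ resting upon $B$ also lies in $\pi$ (i.e. $\pi$ is a finite set of bricks removable from the top so that what remains is stable). $\mathcal{P}_n$ is the set of such partitions; the weight of $\pi$ is $q_0^{\#\text{dark bricks in }\pi}q_1^{\#\text{light bricks in }\pi}$. -}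

module Defs where

open import Data.Bool using (Bool; true; false; _∧_; _∨_; not; if_then_else_; T)
open import Data.Nat as ℕ using (ℕ; zero; suc; _+_; _*_; _∸_; _^_)
open import Data.Integer as ℤ using (ℤ; +_)
open import Data.Product using (Σ; _×_; _,_; proj₁; proj₂)
open import Data.List using (List; []; _∷_; upTo; length; filterᵇ)
open import Data.Bool.ListAction using (any; all)
open import Relation.Nullary using (does)

isEven : ℕ → Bool
isEven zero = true
isEven (suc zero) = false
isEven (suc (suc k)) = isEven k

Pt : Set
Pt = ℤ × ℤ

e : ℕ → Pt
e k = if isEven k then (+ 1 , + 0) else (+ 0 , + 1)

_+ᵖ_ _-ᵖ_ : Pt → Pt → Pt
(x , y) +ᵖ (u , v) = (x ℤ.+ u , y ℤ.+ v)
(x , y) -ᵖ (u , v) = (x ℤ.- u , y ℤ.- v)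

_==ᵖ_ : Pt → Pt → Bool
(x , y) ==ᵖ (u , v) = does (x ℤ.≟ u) ∧ does (y ℤ.≟ v)

inB0 : ℕ → Pt → Bool
inB0 n (x , y) = does (x ℤ.≟ + 0) ∧ any (λ j → does (y ℤ.≟ + (2 * j))) (upTo n)

-- membership in B_k, where B_{k+1} = { p ± e_k : p ∈ B_k },
-- i.e. p ∈ B_{k+1} iff p - e_k ∈ B_k or p + e_k ∈ B_k
inB : ℕ → ℕ → Pt → Bool
inB n zero p = inB0 n p
inB n (suc k) p = inB n k (p -ᵖ e k) ∨ inB n k (p +ᵖ e k)

-- a brick (k , p): layer k (counted downwards from the top), position p
Brick : Set
Brick = ℕ × Pt

inRoom : ℕ → Brick → Bool
inRoom n (k , p) = inB n k p

_==ᵇ_ : Brick → Brick → Bool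
(k , p) ==ᵇ (l , q) = does (k ℕ.≟ l) ∧ (p ==ᵖ q)

-- strict lexicographic order on bricks (used only to represent finite
-- sets of bricks canonically as strictly increasing lists)
_<ℤ_ : ℤ → ℤ → Bool
x <ℤ y = (x ℤ.≤ᵇ y) ∧ not (does (x ℤ.≟ y))

_<ᵇ_ : Brick → Brick → Bool
(k , (x , y)) <ᵇ (l , (u , v)) =
  (k ℕ.<ᵇ l) ∨ (does (k ℕ.≟ l) ∧ ((x <ℤ u) ∨ (does (x ℤ.≟ u) ∧ (y <ℤ v))))

strictlySorted : List Brick → Bool
strictlySorted [] = true
strictlySorted (b ∷ []) = true
strictlySorted (b ∷ c ∷ bs) = (b <ᵇ c) ∧ strictlySorted (c ∷ bs)

_∈ᵇ_ : Brick → List Brick → Bool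
b ∈ᵇ l = any (b ==ᵇ_) l

-- The bricks of ε_n resting upon the brick (k+1 , p) are the bricks
-- (k , q) of ε_n with p = q ± e_k, i.e. q = p ∓ e_k.  A set π is a
-- pyramid partition iff it contains all bricks of ε_n resting upon any of
-- its bricks.
restingOnIn : ℕ → List Brick → Brick → Bool
restingOnIn n π (zero , p) = true
restingOnIn n π (suc k , p) =
  (not (inB n k (p -ᵖ e k)) ∨ ((k , p -ᵖ e k) ∈ᵇ π)) ∧
  (not (inB n k (p +ᵖ e k)) ∨ ((k , p +ᵖ e k) ∈ᵇ π))

isPyramidPartition : ℕ → List Brick → Bool
isPyramidPartition n π = all (inRoom n) π ∧ all (restingOnIn n π) π

darkCount lightCount : List Brick → ℕ
darkCount π = length (filterᵇ (λ b → isEven (proj₁ b)) π)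
lightCount π = length (filterᵇ (λ b → not (isEven (proj₁ b))) π)

-- Pyramid partitions of length n with a dark and b light bricks.
-- A finite subset of ε_n is represented canonically by the strictly
-- increasing list of its elements; all conditions are Boolean, so the
-- proof component is proof-irrelevant and equality of elements is
-- equality of the underlying sets.
PP : ℕ → ℕ → ℕ → Set
PP n a b = Σ (List Brick) λ π →
  T (strictlySorted π ∧ isPyramidPartition n π ∧
     does (darkCount π ℕ.≟ a) ∧ does (lightCount π ℕ.≟ b))

-- Formal power series in q₀, q₁ with ℕ coefficients (all series below
-- have nonnegative coefficients), given by their coefficient functions:
-- s i j = coefficient of q₀^i q₁^j.

Series : Set
Series = ℕ → ℕ → ℕ

sumTo : ℕ → (ℕ → ℕ) → ℕ
sumTo zero f = 0
sumTo (suc n) f = sumTo n f + f n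

[_] : Bool → ℕ
[ true ] = 1
[ false ] = 0

infix 4 _==_
_==_ : ℕ → ℕ → Bool
m == n = does (m ℕ.≟ n)

oneS : Series
oneS i j = [ (i == 0) ∧ (j == 0) ]

_⊛_ : Series → Series → Series
(f ⊛ g) a b = sumTo (suc a) λ i → sumTo (suc b) λ j → f i j * g (a ∸ i) (b ∸ j)

powS : Series → ℕ → Series
powS f zero = oneS
powS f (suc k) = f ⊛ powS f k

onePlus : ℕ → ℕ → Series
onePlus c d i j = oneS i j + [ (i == c) ∧ (j == d) ]

-- (1 - q₀^c q₁^d)^{-1} = Σ_{t ≥ 0} q₀^{tc} q₁^{td}  (for c + d ≥ 1; the
-- monomials with t > i + j do not contribute to the coefficient of q₀^i q₁^j)
geomInv : ℕ → ℕ → Series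
geomInv c d i j = sumTo (suc (i + j)) λ t → [ (i == t * c) ∧ (j == t * d) ]

-- the m-th factor (m ≥ 1) of
--   M(1,q₀q₁)^2 ∏_k (1+q₀^k q₁^{k-1})^k ∏_k (1+q₀^k q₁^{k+1})^k,
-- namely (1-(q₀q₁)^m)^{-2m} (1+q₀^m q₁^{m-1})^m (1+q₀^m q₁^{m+1})^m
factor : ℕ → Series
factor m = powS (geomInv m m) (2 * m) ⊛
           (powS (onePlus m (m ∸ 1)) m ⊛ powS (onePlus m (suc m)) m)

prodTo : ℕ → Series
prodTo zero = oneS
prodTo (suc N) = prodTo N ⊛ factor (suc N)

-- coefficient of q₀^a q₁^b in the infinite product ∏_{m ≥ 1} factor m.
-- Every factor m is ≡ 1 modulo monomials of total degree ≥ m, so this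
-- coefficient equals that of the partial product up to m = a + b.
rhsCoeff : ℕ → ℕ → ℕ
rhsCoeff a b = prodTo (a + b) a b

{-# OPTIONS --safe #-}

-- Cutting the empty room along the planes x + y = t turns a pyramid partition into a sequence of
-- integer partitions, growing for t < 0 and shrinking for t > 0, whose consecutive members differ by
-- horizontal and vertical strips alternately; slice t contains the bricks of one colour only.  An
-- up-step followed by a down-step can be exchanged with the down-step followed by the up-step at the
-- price of a factor 1/(1 − w) (strips of the same kind) or 1 + w (strips of different kinds): this
-- is the local rule of the (dual) Robinson–Schensted–Knuth correspondence, and w is the product of
-- the weights of the slices in between.  Exchanging all pairs leaves only empty partitions, so the
-- generating function is the product of these factors over a quadrant, and the antidiagonals of the
-- quadrant give the factors of the theorem.  Since a partition with N bricks meets fewer than N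
-- slices on each side, a finite square of factors suffices for each coefficient.
module Submission where

-- A coefficient here is the size of a set, so every identity is a bijection preserving both colour
-- counts; even the laws of the product of series are read off from such bijections. Colours are
-- counted per step, not per slice: a step across which the slice size drops by d carries d times
-- the colours of all slices of its side from the centre out to it. The local rule satisfies |l| +
-- |r| = |k| + |m| + c for a peak l and a valley r between k and m, so an exchange releases c times
-- the sum of the two step weights and leaves every other weight alone. Horizontal and vertical
-- strips alternate because the bricks of successive layers point along alternate axes: a step out
-- of a slice followed by the step back raises the row index or the column index, according to which
-- axis comes first. The factor with index m takes its cells from the antidiagonals 2m - 2, 2m - 1
-- and 2m, so a partial product overshoots a triangle of cells by one power, which has too high a
-- degree to matter.

open import Defs
open import Algebra.Bundles using (AbelianGroup; CommutativeMonoid)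
import Algebra.Properties.CommutativeSemigroup
import Algebra.Properties.Group
open import Data.Bool as Bool using (Bool; true; false; if_then_else_; not; T; _∧_; _∨_)
import Data.Bool.ListAction
open import Data.Bool.Properties using (T-∧; T-∨; T-irrelevant; ¬-not; not-involutive)
open import Data.Empty using (⊥)
open import Data.Fin using (Fin; toℕ; fromℕ<)
open import Data.Fin.Permutation using (↔⇒≡)
open import Data.Fin.Properties using (toℕ<n; toℕ-fromℕ<; fromℕ<-toℕ)
import Data.Integer as ℤ
import Data.Integer.Properties as ℤ
open import Data.Integer.Tactic.RingSolver using (solve-∀)
open import Data.List using (List; []; _∷_; _++_; length; applyUpTo; filter; filterᵇ)
open import Data.List.Membership.Propositional using (_∈_)
open import Data.List.Membership.Propositional.Properties
  using (∈-++⁺ˡ; ∈-++⁺ʳ; ∈-++⁻; ∈-applyUpTo⁺; ∈-applyUpTo⁻; ∈-filter⁺)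
open import Data.List.Properties using (filter-notAll)
open import Data.List.Relation.Binary.Permutation.Propositional as ↭ using (_↭_; ↭-sym; ↭⇒↭ₛ)
open import Data.List.Relation.Binary.Permutation.Propositional.Properties using (∈-resp-↭)
import Data.List.Relation.Binary.Permutation.Setoid.Properties as SetoidPermutation
open import Data.List.Relation.Unary.All as All using (All; []; _∷_)
open import Data.List.Relation.Unary.All.Properties using (all⁺; all⁻)
open import Data.List.Relation.Unary.AllPairs using (AllPairs; []; _∷_)
open import Data.List.Relation.Unary.Any as Any using (Any; here; there)
open import Data.List.Relation.Unary.Any.Properties using (any⁺; any⁻)
open import Data.List.Relation.Unary.Linked using (Linked; []; [-]; _∷_)
open import Data.List.Relation.Unary.Linked.Properties using (Linked⇒AllPairs)
open import Data.List.Relation.Unary.Unique.Propositional using (Unique)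
open import Data.List.Relation.Unary.Unique.Propositional.Properties using (++⁺; applyUpTo⁺₁)
import Data.List.Sort
open import Data.Nat as ℕ hiding (_<ᵇ_)
open import Data.Nat.ListAction using (sum)
open import Data.Nat.Properties
open import Data.Nat.Solver using (module +-*-Solver)
open import Data.Product using (Σ; ∃; _×_; _,_; proj₁; proj₂)
open import Data.Product.Properties using (Σ-≡,≡→≡)
open import Data.Product.Relation.Binary.Lex.Strict using (×-strictTotalOrder)
open import Data.Sum using (_⊎_; inj₁; inj₂)
open import Data.Unit using (⊤; tt)
open import Function using (_∘_; id)
open import Function.Bundles using (_↔_; mk↔ₛ′; Equivalence)
open import Function.Properties.Inverse using (↔-sym; ↔-trans)
open import Level using (0ℓ)
open import Relation.Binary.Bundles using (StrictTotalOrder)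
import Relation.Binary.Properties.StrictTotalOrder
open import Relation.Binary.PropositionalEquality as ≡
  using (_≡_; _≢_; refl; sym; trans; cong; cong₂; subst; module ≡-Reasoning)
open import Relation.Nullary using (¬_; Dec; does; yes; no; Irrelevant; contradiction)
open import Relation.Nullary.Decidable using (¬?)

-- Weighted sets and their generating functions

-- Isomorphisms are functions on Raw that need to be inverse to each other on Ok only, so that Ok
-- need not be proof-irrelevant.  wt true counts dark bricks, wt false light ones.
record WSet : Set₁ where
  field
    Raw : Set
    Ok  : Raw → Set
    wt  : Bool → Raw → ℕ

open WSet

infix 3 _≅_
record _≅_ (X Y : WSet) : Set where
  field
    to      : Raw X → Raw Y
    from    : Raw Y → Raw X
    to-ok   : ∀ {x} → Ok X x → Ok Y (to x)
    from-ok : ∀ {y} → Ok Y y → Ok X (from y)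
    from-to : ∀ {x} → Ok X x → from (to x) ≡ x
    to-from : ∀ {y} → Ok Y y → to (from y) ≡ y
    to-wt   : ∀ {x} → Ok X x → ∀ c → wt Y c (to x) ≡ wt X c x

open _≅_

≅-refl : ∀ {X} → X ≅ X
≅-refl = record
  { to = id ; from = id ; to-ok = id ; from-ok = id
  ; from-to = λ _ → refl ; to-from = λ _ → refl ; to-wt = λ _ _ → refl }

≅-sym : ∀ {X Y} → X ≅ Y → Y ≅ X
≅-sym {X} {Y} f = record
  { to = from f ; from = to f ; to-ok = from-ok f ; from-ok = to-ok f
  ; from-to = to-from f ; to-from = from-to f
  ; to-wt = λ y-ok c → trans (sym (to-wt f (from-ok f y-ok) c)) (cong (wt Y c) (to-from f y-ok)) }

≅-trans : ∀ {X Y Z} → X ≅ Y → Y ≅ Z → X ≅ Z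
≅-trans f g = record
  { to = to g ∘ to f ; from = from f ∘ from g
  ; to-ok = to-ok g ∘ to-ok f ; from-ok = from-ok f ∘ from-ok g
  ; from-to = λ x-ok → trans (cong (from f) (from-to g (to-ok f x-ok))) (from-to f x-ok)
  ; to-from = λ z-ok → trans (cong (to g) (to-from f (from-ok g z-ok))) (to-from g z-ok)
  ; to-wt = λ x-ok c → trans (to-wt g (to-ok f x-ok) c) (to-wt f x-ok c) }

infixr 5 _⊗_
_⊗_ : WSet → WSet → WSet
X ⊗ Y = record
  { Raw = Raw X × Raw Y
  ; Ok = λ (x , y) → Ok X x × Ok Y y
  ; wt = λ c (x , y) → wt X c x + wt Y c y }

⊗-cong : ∀ {X X′ Y Y′} → X ≅ X′ → Y ≅ Y′ → X ⊗ Y ≅ X′ ⊗ Y′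
⊗-cong f g = record
  { to = λ (x , y) → to f x , to g y
  ; from = λ (x , y) → from f x , from g y
  ; to-ok = λ (p , q) → to-ok f p , to-ok g q
  ; from-ok = λ (p , q) → from-ok f p , from-ok g q
  ; from-to = λ (p , q) → cong₂ _,_ (from-to f p) (from-to g q)
  ; to-from = λ (p , q) → cong₂ _,_ (to-from f p) (to-from g q)
  ; to-wt = λ (p , q) c → cong₂ _+_ (to-wt f p c) (to-wt g q c) }

⊗-comm : ∀ X Y → X ⊗ Y ≅ Y ⊗ X
⊗-comm X Y = record
  { to = λ (x , y) → y , x ; from = λ (y , x) → x , y
  ; to-ok = λ (p , q) → q , p ; from-ok = λ (p , q) → q , p
  ; from-to = λ _ → refl ; to-from = λ _ → refl
  ; to-wt = λ {(x , y)} _ c → +-comm (wt Y c y) (wt X c x) }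

⊗-assoc : ∀ X Y Z → (X ⊗ Y) ⊗ Z ≅ X ⊗ Y ⊗ Z
⊗-assoc X Y Z = record
  { to = λ ((x , y) , z) → x , y , z ; from = λ (x , y , z) → (x , y) , z
  ; to-ok = λ ((p , q) , r) → p , q , r ; from-ok = λ (p , q , r) → (p , q) , r
  ; from-to = λ _ → refl ; to-from = λ _ → refl
  ; to-wt = λ {((x , y) , z)} _ c → sym (+-assoc (wt X c x) (wt Y c y) (wt Z c z)) }

One : WSet
One = record { Raw = ⊤ ; Ok = λ _ → ⊤ ; wt = λ _ _ → 0 }

⊗-identityˡ : ∀ X → One ⊗ X ≅ X
⊗-identityˡ X = record
  { to = proj₂ ; from = tt ,_ ; to-ok = proj₂ ; from-ok = tt ,_
  ; from-to = λ _ → refl ; to-from = λ _ → refl ; to-wt = λ _ _ → refl }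

Subset : (A : Set) → (A → Set) → WSet
Subset A P = record { Raw = A ; Ok = P ; wt = λ _ _ → 0 }

Below : ℕ → WSet
Below n = Subset ℕ (_< n)

fiber : WSet → ℕ → ℕ → WSet
fiber X a b = Subset (Raw X) λ x → Ok X x × wt X true x ≡ a × wt X false x ≡ b

fiber-cong : ∀ {X Y} → X ≅ Y → ∀ a b → fiber X a b ≅ fiber Y a b
fiber-cong f a b = record
  { to = to f ; from = from f
  ; to-ok = λ (p , q , r) → to-ok f p , trans (to-wt f p true) q , trans (to-wt f p false) r
  ; from-ok = λ (p , q , r) → from-ok f p , trans (to-wt (≅-sym f) p true) q , trans (to-wt (≅-sym f) p false) r
  ; from-to = λ (p , _) → from-to f p
  ; to-from = λ (p , _) → to-from f p
  ; to-wt = λ _ _ → refl }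

infix 3 _hasSeries_
record _hasSeries_ (X : WSet) (f : Series) : Set where
  constructor counted
  field coefficient : ∀ a b → fiber X a b ≅ Below (f a b)

open _hasSeries_

hasSeries-≅ : ∀ {X Y f} → X ≅ Y → Y hasSeries f → X hasSeries f
hasSeries-≅ e h = counted λ a b → ≅-trans (fiber-cong e a b) (coefficient h a b)

∐ : (I : Set) → (I → Set) → (I → WSet) → WSet
∐ I P F = Subset (Σ I (Raw ∘ F)) λ (i , x) → P i × Ok (F i) x

∐-cong : ∀ {I P F G} → (∀ i → F i ≅ G i) → ∐ I P F ≅ ∐ I P G
∐-cong f = record
  { to = λ (i , x) → i , to (f i) x ; from = λ (i , x) → i , from (f i) x
  ; to-ok = λ {(i , _)} (p , q) → p , to-ok (f i) q
  ; from-ok = λ {(i , _)} (p , q) → p , from-ok (f i) q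
  ; from-to = λ {(i , _)} (_ , q) → cong (i ,_) (from-to (f i) q)
  ; to-from = λ {(i , _)} (_ , q) → cong (i ,_) (to-from (f i) q)
  ; to-wt = λ _ _ → refl }

sumTo-mono : ∀ f {m n} → m ≤ n → sumTo m f ≤ sumTo n f
sumTo-mono f {zero} z≤n = z≤n
sumTo-mono f {suc m} {suc n} m<n with m≤n⇒m<n∨m≡n m<n
... | inj₁ (s≤s m<n) = ≤-trans (sumTo-mono f m<n) (m≤m+n (sumTo n f) (f n))
... | inj₂ refl = ≤-refl

-- Inverse of `(i , k) ↦ sumTo i f + k`, which numbers consecutive blocks of sizes `f 0`, `f 1` and
-- so on. The value at `zero` is arbitrary, since no `m` lies below an empty sum.
locate : (ℕ → ℕ) → ℕ → ℕ → ℕ × ℕ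
locate f zero    m = 0 , m
locate f (suc n) m with m <? sumTo n f
... | yes _ = locate f n m
... | no  _ = n , m ∸ sumTo n f

locate-ok : ∀ f n {m} → m < sumTo n f →
            let (i , k) = locate f n m in (i < n × k < f i) × sumTo i f + k ≡ m
locate-ok f (suc n) {m} m<s with m <? sumTo n f
... | yes m<s′ = let ((i<n , k<f) , eq) = locate-ok f n m<s′ in (m<n⇒m<1+n i<n , k<f) , eq
... | no  m≮s′ = (≤-refl , +-cancelˡ-< (sumTo n f) _ _ (subst (_< sumTo n f + f n) (sym eq) m<s)) , eq
  where
  eq : sumTo n f + (m ∸ sumTo n f) ≡ m
  eq = m+[n∸m]≡n (≮⇒≥ m≮s′)

locate-sum : ∀ f n {i k} → i < n → k < f i → locate f n (sumTo i f + k) ≡ (i , k)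
locate-sum f (suc n) {i} {k} (s≤s i≤n) k<f with sumTo i f + k <? sumTo n f | m≤n⇒m<n∨m≡n i≤n
... | yes _    | inj₁ i<n  = locate-sum f n i<n k<f
... | yes lt   | inj₂ refl = contradiction (≤-trans lt (m≤m+n (sumTo i f) k)) (<-irrefl refl)
... | no  nlt  | inj₁ i<n  = contradiction (<-≤-trans (+-monoʳ-< (sumTo i f) k<f) (sumTo-mono f i<n)) nlt
... | no  _    | inj₂ refl = cong (i ,_) (m+n∸m≡n (sumTo i f) k)

∐-Below : ∀ n f → ∐ ℕ (_< n) (Below ∘ f) ≅ Below (sumTo n f)
∐-Below n f = record
  { to = λ (i , k) → sumTo i f + k ; from = locate f n
  ; to-ok = λ {(i , k)} (i<n , k<f) → <-≤-trans (+-monoʳ-< (sumTo i f) k<f) (sumTo-mono f i<n)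
  ; from-ok = λ m<s → proj₁ (locate-ok f n m<s)
  ; from-to = λ (i<n , k<f) → locate-sum f n i<n k<f
  ; to-from = λ m<s → proj₂ (locate-ok f n m<s)
  ; to-wt = λ _ _ → refl }

sumTo-const : ∀ m n → sumTo m (λ _ → n) ≡ m * n
sumTo-const zero n = refl
sumTo-const (suc m) n = trans (cong (_+ n) (sumTo-const m n)) (+-comm (m * n) n)

Below-⊗ : ∀ m n → Below m ⊗ Below n ≅ Below (m * n)
Below-⊗ m n = ≅-trans (record
  { to = id ; from = id ; to-ok = id ; from-ok = id
  ; from-to = λ _ → refl ; to-from = λ _ → refl ; to-wt = λ _ _ → refl })
  (subst (λ s → ∐ ℕ (_< m) (λ _ → Below n) ≅ Below s) (sumTo-const m n) (∐-Below m (λ _ → n)))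

-- Pairs of total weight `(a , b)` are sorted by the weight `(i , j)` of the first component, which
-- leaves `(a ∸ i , b ∸ j)` to the second: the Cauchy product.
⊗-hasSeries : ∀ {X Y f g} → X hasSeries f → Y hasSeries g → X ⊗ Y hasSeries (f ⊛ g)
⊗-hasSeries {X} {Y} {f} {g} p q = counted λ a b →
  ≅-trans (split a b)
    (≅-trans (∐-cong λ i → ≅-trans (∐-cong λ j →
        ≅-trans (⊗-cong (coefficient p i j) (coefficient q (a ∸ i) (b ∸ j))) (Below-⊗ (f i j) (g (a ∸ i) (b ∸ j))))
      (∐-Below (suc b) _))
    (∐-Below (suc a) _))
  where
  split : ∀ a b → fiber (X ⊗ Y) a b ≅
          ∐ ℕ (_< suc a) λ i → ∐ ℕ (_< suc b) λ j → fiber X i j ⊗ fiber Y (a ∸ i) (b ∸ j)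
  split a b = record
    { to = λ (x , y) → wt X true x , wt X false x , x , y
    ; from = λ (_ , _ , x , y) → x , y
    ; to-ok = λ { {x , y} ((x-ok , y-ok) , refl , refl) →
        s≤s (m≤m+n (wt X true x) _) , s≤s (m≤m+n (wt X false x) _) , (x-ok , refl , refl) ,
        y-ok , sym (m+n∸m≡n (wt X true x) _) , sym (m+n∸m≡n (wt X false x) _) }
    ; from-ok = λ { {_ , _ , x , y} (s≤s i≤a , s≤s j≤b , (x-ok , refl , refl) , y-ok , ya , yb) →
        (x-ok , y-ok) ,
        trans (cong (wt X true x +_) ya) (m+[n∸m]≡n i≤a) ,
        trans (cong (wt X false x +_) yb) (m+[n∸m]≡n j≤b) }
    ; from-to = λ _ → refl
    ; to-from = λ { (_ , _ , (_ , refl , refl) , _) → refl }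
    ; to-wt = λ _ _ → refl }

-- An element of `Σ A P` contains its proof, whereas `_≅_` compares raw elements; irrelevance of `P`
-- bridges the two.
≅-Below⇒↔Fin : ∀ {A P n} → (∀ {x} → Irrelevant (P x)) → Subset A P ≅ Below n → Σ A P ↔ Fin n
≅-Below⇒↔Fin {A} {P} {n} irr f = mk↔ₛ′ to′ from′ to-from′ from-to′
  where
  to′ : Σ A P → Fin n
  to′ (x , p) = fromℕ< (to-ok f p)
  from′ : Fin n → Σ A P
  from′ k = from f (toℕ k) , from-ok f (toℕ<n k)
  fromℕ<-cong′ : ∀ {i} {k : Fin n} (i<n : i < n) → i ≡ toℕ k → fromℕ< i<n ≡ k
  fromℕ<-cong′ {k = k} i<n refl = fromℕ<-toℕ k i<n
  to-from′ : ∀ k → to′ (from′ k) ≡ k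
  to-from′ k = fromℕ<-cong′ (to-ok f (from-ok f (toℕ<n k))) (to-from f (toℕ<n k))
  from-to′ : ∀ x → from′ (to′ x) ≡ x
  from-to′ (x , p) = Σ-≡,≡→≡ (trans (cong (from f) (toℕ-fromℕ< (to-ok f p))) (from-to f p) , irr _ _)

Below-injective : ∀ {m n} → Below m ≅ Below n → m ≡ n
Below-injective f = ↔⇒≡ (↔-trans (↔-sym (≅-Below⇒↔Fin <-irrelevant (≅-refl {Below _}))) (≅-Below⇒↔Fin <-irrelevant f))

-- Turns isomorphisms into equations between coefficients. The laws of `_⊛_` come from those of
-- `_⊗_` in this way, with no manipulation of double sums.
hasSeries-unique : ∀ {X Y f g} → X ≅ Y → X hasSeries f → Y hasSeries g → ∀ a b → f a b ≡ g a b
hasSeries-unique e p q a b =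
  Below-injective (≅-trans (≅-sym (coefficient p a b)) (≅-trans (fiber-cong e a b) (coefficient q a b)))

-- Every series is a generating function: each monomial is taken in as many numbered copies as its
-- coefficient says.
fromSeries : Series → WSet
fromSeries f = record
  { Raw = ℕ × ℕ × ℕ
  ; Ok = λ (i , j , k) → k < f i j
  ; wt = λ { true (i , _) → i ; false (_ , j , _) → j } }

fromSeries-hasSeries : ∀ f → fromSeries f hasSeries f
fromSeries-hasSeries f = counted λ a b → record
  { to = λ (_ , _ , k) → k ; from = λ k → a , b , k
  ; to-ok = λ { (k< , refl , refl) → k< }
  ; from-ok = λ k< → k< , refl , refl
  ; from-to = λ { (_ , refl , refl) → refl }
  ; to-from = λ _ → refl
  ; to-wt = λ _ _ → refl }

One-hasSeries : One hasSeries oneS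
coefficient One-hasSeries zero zero = record
  { to = λ _ → 0 ; from = λ _ → tt ; to-ok = λ _ → s≤s z≤n ; from-ok = λ _ → tt , refl , refl
  ; from-to = λ _ → refl ; to-from = λ { (s≤s z≤n) → refl } ; to-wt = λ _ _ → refl }
coefficient One-hasSeries zero (suc b) = record
  { to = λ _ → 0 ; from = λ _ → tt ; to-ok = λ { (_ , _ , ()) } ; from-ok = λ ()
  ; from-to = λ _ → refl ; to-from = λ () ; to-wt = λ _ _ → refl }
coefficient One-hasSeries (suc a) b = record
  { to = λ _ → 0 ; from = λ _ → tt ; to-ok = λ { (_ , () , _) } ; from-ok = λ ()
  ; from-to = λ _ → refl ; to-from = λ () ; to-wt = λ _ _ → refl }

⊛-comm : ∀ f g a b → (f ⊛ g) a b ≡ (g ⊛ f) a b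
⊛-comm f g = hasSeries-unique (⊗-comm (fromSeries f) (fromSeries g))
  (⊗-hasSeries (fromSeries-hasSeries f) (fromSeries-hasSeries g))
  (⊗-hasSeries (fromSeries-hasSeries g) (fromSeries-hasSeries f))

⊛-assoc : ∀ f g h a b → ((f ⊛ g) ⊛ h) a b ≡ (f ⊛ (g ⊛ h)) a b
⊛-assoc f g h = hasSeries-unique (⊗-assoc (fromSeries f) (fromSeries g) (fromSeries h))
  (⊗-hasSeries (⊗-hasSeries F G) H) (⊗-hasSeries F (⊗-hasSeries G H))
  where
  F = fromSeries-hasSeries f
  G = fromSeries-hasSeries g
  H = fromSeries-hasSeries h

⊛-identityˡ : ∀ f a b → (oneS ⊛ f) a b ≡ f a b
⊛-identityˡ f = hasSeries-unique (⊗-identityˡ _)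
  (⊗-hasSeries One-hasSeries (fromSeries-hasSeries f)) (fromSeries-hasSeries f)

sumTo-cong : ∀ n {f g} → (∀ i → i < n → f i ≡ g i) → sumTo n f ≡ sumTo n g
sumTo-cong zero    eq = refl
sumTo-cong (suc n) eq = cong₂ _+_ (sumTo-cong n λ i i<n → eq i (m<n⇒m<1+n i<n)) (eq n ≤-refl)

sumTo-zero : ∀ n {f} → (∀ i → i < n → f i ≡ 0) → sumTo n f ≡ 0
sumTo-zero n eq = trans (sumTo-cong n eq) (trans (sumTo-const n 0) (*-zeroʳ n))

sumTo-head : ∀ n f → sumTo (suc n) f ≡ f 0 + sumTo n (f ∘ suc)
sumTo-head zero    f = +-comm 0 (f 0)
sumTo-head (suc n) f = trans (cong (_+ f (suc n)) (sumTo-head n f)) (+-assoc (f 0) _ _)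

==×==⇒T : ∀ {a b m n} → m ≡ a → n ≡ b → T ((a == m) ∧ (b == n))
==×==⇒T {a} {b} refl refl = Equivalence.from T-∧ (≡⇒≡ᵇ a a refl , ≡⇒≡ᵇ b b refl)

T⇒==×== : ∀ {a b m n} → T ((a == m) ∧ (b == n)) → m ≡ a × n ≡ b
T⇒==×== {a} {b} t = let (p , q) = Equivalence.to T-∧ t in sym (≡ᵇ⇒≡ a _ p) , sym (≡ᵇ⇒≡ b _ q)

indicator≡0 : ∀ {p} → ¬ T p → [ p ] ≡ 0
indicator≡0 {true}  ¬t = contradiction tt ¬t
indicator≡0 {false} _  = refl

-- The monomial marking a cell occurs any number of times (true), giving 1/(1 − w), or at most
-- once (false), giving 1 + w.
Marks : Bool → ℕ → Set
Marks true  _ = ⊤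
Marks false k = k ≤ 1

Cell : Bool → (Bool → ℕ) → WSet
Cell r w = record { Raw = ℕ ; Ok = Marks r ; wt = λ c k → k * w c }

cellSeries : Bool → ℕ → ℕ → Series
cellSeries true  = geomInv
cellSeries false = onePlus

-- Congruence modulo the monomials of total degree above `N`. They span an ideal, so products
-- respect it, and a factor whose nonconstant terms all have such a degree becomes trivial.
module Truncated (N : ℕ) where

  infix 4 _≈_
  _≈_ : Series → Series → Set
  f ≈ g = ∀ a b → a + b ≤ N → f a b ≡ g a b

  ⊛-cong : ∀ {f f′ g g′} → f ≈ f′ → g ≈ g′ → f ⊛ g ≈ f′ ⊛ g′
  ⊛-cong p q a b a+b≤N = sumTo-cong (suc a) λ { i (s≤s i≤a) → sumTo-cong (suc b) λ { j (s≤s j≤b) →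
    cong₂ _*_ (p i j (≤-trans (+-mono-≤ i≤a j≤b) a+b≤N))
              (q (a ∸ i) (b ∸ j) (≤-trans (+-mono-≤ (m∸n≤m a i) (m∸n≤m b j)) a+b≤N)) } }

  ⊛-monoid : CommutativeMonoid _ _
  ⊛-monoid = record
    { Carrier = Series ; _≈_ = _≈_ ; _∙_ = _⊛_ ; ε = oneS
    ; isCommutativeMonoid = record
      { isMonoid = record
        { isSemigroup = record
          { isMagma = record
            { isEquivalence = record
              { refl = λ _ _ _ → refl
              ; sym = λ p a b ≤N → sym (p a b ≤N)
              ; trans = λ p q a b ≤N → trans (p a b ≤N) (q a b ≤N) }
            ; ∙-cong = ⊛-cong }
          ; assoc = λ f g h a b _ → ⊛-assoc f g h a b }
        ; identity = (λ f a b _ → ⊛-identityˡ f a b) ,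
                     (λ f a b _ → trans (⊛-comm f oneS a b) (⊛-identityˡ f a b)) }
      ; comm = λ f g a b _ → ⊛-comm f g a b } }

  onePlus≈one : ∀ c d → N < c + d → onePlus c d ≈ oneS
  onePlus≈one c d N<c+d a b a+b≤N =
    trans (cong (oneS a b +_) (indicator≡0 λ t → absurd (T⇒==×== {a} {b} t))) (+-identityʳ _)
    where
    absurd : ¬ (c ≡ a × d ≡ b)
    absurd (refl , refl) = <⇒≱ N<c+d a+b≤N

  geomInv≈one : ∀ c d → N < c + d → geomInv c d ≈ oneS
  geomInv≈one c d N<c+d a b a+b≤N =
    -- The term for exponent 0 is `oneS a b`; every later one has degree at least `c + d`.
    trans (sumTo-head (a + b) _) (trans (cong (oneS a b +_) (sumTo-zero (a + b) λ i _ → rest i)) (+-identityʳ _))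
    where
    rest : ∀ i → [ (a == suc i * c) ∧ (b == suc i * d) ] ≡ 0
    rest i = indicator≡0 λ t → absurd (T⇒==×== {a} {b} t)
      where
      absurd : ¬ (suc i * c ≡ a × suc i * d ≡ b)
      absurd (refl , refl) =
        <⇒≱ N<c+d (≤-trans (+-mono-≤ (m≤m+n c (i * c)) (m≤m+n d (i * d))) a+b≤N)

  cellSeries≈one : ∀ r c d → N < c + d → cellSeries r c d ≈ oneS
  cellSeries≈one true  = geomInv≈one
  cellSeries≈one false = onePlus≈one

Subset-⇔ : ∀ {A P Q} → (∀ {x} → P x → Q x) → (∀ {x} → Q x → P x) → Subset A P ≅ Subset A Q
Subset-⇔ p q = record
  { to = id ; from = id ; to-ok = p ; from-ok = q
  ; from-to = λ _ → refl ; to-from = λ _ → refl ; to-wt = λ _ _ → refl }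

indicator-count : ∀ n (P : ℕ → Bool) → Subset ℕ (λ i → i < n × T (P i)) ≅ Below (sumTo n λ i → [ P i ])
indicator-count n P = ≅-trans (record
  { to = _, 0 ; from = proj₁
  ; to-ok = λ (i<n , p) → i<n , indicator>0 p
  ; from-ok = λ (i<n , k<) → i<n , proj₁ (below-indicator k<)
  ; from-to = λ _ → refl
  ; to-from = λ {(i , _)} (_ , k<) → cong (i ,_) (sym (proj₂ (below-indicator k<)))
  ; to-wt = λ _ _ → refl }) (∐-Below n _)
  where
  indicator>0 : ∀ {b} → T b → 0 < [ b ]
  indicator>0 {true} _ = s≤s z≤n
  below-indicator : ∀ {b k} → k < [ b ] → T b × k ≡ 0
  below-indicator {true} (s≤s z≤n) = tt , refl

-- For `true`, a weight of positive degree bounds the number of marks by the total degree, so the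
-- cut-off in `geomInv` loses nothing. For `false`, the two admissible numbers of marks are the two
-- terms of `onePlus`.
cell-hasSeries : ∀ r w → 0 < w true + w false → Cell r w hasSeries cellSeries r (w true) (w false)
coefficient (cell-hasSeries true w w>0) a b = ≅-trans
  (Subset-⇔ (λ { {k} (_ , refl , refl) → s≤s (bound k) , ==×==⇒T {m = k * w true} {k * w false} refl refl })
            (λ (_ , t) → tt , T⇒==×== t))
  (indicator-count (suc (a + b)) λ k → (a == k * w true) ∧ (b == k * w false))
  where
  bound : ∀ k → k ≤ k * w true + k * w false
  bound k = begin
    k                             ≡⟨ *-identityʳ k ⟨
    k * 1                         ≤⟨ *-monoʳ-≤ k w>0 ⟩
    k * (w true + w false)        ≡⟨ *-distribˡ-+ k (w true) (w false) ⟩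
    k * w true + k * w false      ∎
    where open ≤-Reasoning
coefficient (cell-hasSeries false w w>0) a b = subst (λ s → fiber (Cell false w) a b ≅ Below s) onePlus≡
  (≅-trans
    (Subset-⇔ (λ { {k} (k≤1 , refl , refl) → s≤s k≤1 , ==×==⇒T {m = k * w true} {k * w false} refl refl })
              (λ { (s≤s k≤1 , t) → k≤1 , T⇒==×== t }))
    (indicator-count 2 λ k → (a == k * w true) ∧ (b == k * w false)))
  where
  onePlus≡ : sumTo 2 (λ k → [ (a == k * w true) ∧ (b == k * w false) ]) ≡ onePlus (w true) (w false) a b
  onePlus≡ rewrite +-identityʳ (w true) | +-identityʳ (w false) = refl

-- Factors of the product, arranged by antidiagonals

hue : Bool → ℕ → ℕ
hue true  t = [ isEven t ]
hue false t = [ not (isEven t) ]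

hue-pair : ∀ c t → hue c (suc t) + hue c t ≡ 1
hue-pair true  zero = refl
hue-pair false zero = refl
hue-pair true  (suc zero) = refl
hue-pair false (suc zero) = refl
hue-pair true  (suc (suc t)) = hue-pair true t
hue-pair false (suc (suc t)) = hue-pair false t

hue-total : ∀ t → hue true t + hue false t ≡ 1
hue-total zero = refl
hue-total (suc zero) = refl
hue-total (suc (suc t)) = hue-total t

-- Slice 0 is shared by the two sides; its bricks are charged to the right one.
stepWt : Bool → ℕ → Bool → ℕ
stepWt σ zero    c = if σ then hue c 0 else 0
stepWt σ (suc t) c = stepWt σ t c + hue c (suc t)

-- Two neighbouring slices contribute one of each colour, so moving out by two slices multiplies a
-- weight by `q₀q₁`. The inductions along antidiagonals rest on this period.
stepWt-2+ : ∀ σ t c → stepWt σ (2 + t) c ≡ suc (stepWt σ t c)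
stepWt-2+ σ t c = begin
  stepWt σ t c + hue c (suc t) + hue c (2 + t)   ≡⟨ +-assoc (stepWt σ t c) _ _ ⟩
  stepWt σ t c + (hue c (suc t) + hue c (2 + t)) ≡⟨ cong (stepWt σ t c +_) (trans (+-comm (hue c (suc t)) _) (hue-pair c (suc t))) ⟩
  stepWt σ t c + 1                               ≡⟨ +-comm _ 1 ⟩
  suc (stepWt σ t c)                             ∎
  where open ≡.≡-Reasoning

stepWt-total : ∀ σ t → stepWt σ t true + stepWt σ t false ≡ (if σ then 1 else 0) + t
stepWt-total true  zero = refl
stepWt-total false zero = refl
stepWt-total σ (suc t) = begin
  (stepWt σ t true + hue true (suc t)) + (stepWt σ t false + hue false (suc t)) ≡⟨ xy∙zw (stepWt σ t true) _ _ _ ⟩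
  (stepWt σ t true + stepWt σ t false) + (hue true (suc t) + hue false (suc t)) ≡⟨ cong₂ _+_ (stepWt-total σ t) (hue-total (suc t)) ⟩
  ((if σ then 1 else 0) + t) + 1                                                ≡⟨ trans (+-assoc (if σ then 1 else 0) t 1) (cong ((if σ then 1 else 0) +_) (+-comm t 1)) ⟩
  (if σ then 1 else 0) + suc t                                                  ∎
  where
  open ≡.≡-Reasoning
  xy∙zw = Algebra.Properties.CommutativeSemigroup.interchange +-commutativeSemigroup

-- The strip between slices t and t + 1 of a side is horizontal (true) or vertical (false).
stepType : Bool → ℕ → Bool
stepType true  t = isEven t
stepType false t = not (isEven t)

same : Bool → Bool → Bool
same true  b = b
same false b = not b

-- The number of slices of colour `c` among those from `- s` to `t`, which the two exchanged steps
-- enclose.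
gridWt : ℕ → ℕ → Bool → ℕ
gridWt t s c = stepWt true t c + stepWt false s c

gridKind : ℕ → ℕ → Bool
gridKind t s = same (stepType true t) (stepType false s)

gridSeries : ℕ → ℕ → Series
gridSeries t s = cellSeries (gridKind t s) (gridWt t s true) (gridWt t s false)

gridWt-total : ∀ t s → gridWt t s true + gridWt t s false ≡ suc (t + s)
gridWt-total t s = trans (interchange (stepWt true t true) _ _ _) (cong₂ _+_ (stepWt-total true t) (stepWt-total false s))
  where open Algebra.Properties.CommutativeSemigroup +-commutativeSemigroup

gridWt-2+ˡ : ∀ t s c → gridWt (2 + t) s c ≡ suc (gridWt t s c)
gridWt-2+ˡ t s c = cong (_+ stepWt false s c) (stepWt-2+ true t c)

gridWt-2+ʳ : ∀ t s c → gridWt t (2 + s) c ≡ suc (gridWt t s c)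
gridWt-2+ʳ t s c = trans (cong (stepWt true t c +_) (stepWt-2+ false s c)) (+-suc (stepWt true t c) _)

double : ℕ → ℕ
double zero    = 0
double (suc n) = suc (suc (double n))

n≤double : ∀ n → n ≤ double n
n≤double zero    = z≤n
n≤double (suc n) = m≤n⇒m≤1+n (s≤s (n≤double n))

double≡2* : ∀ n → double n ≡ 2 * n
double≡2* zero    = refl
double≡2* (suc n) = trans (cong (2 +_) (double≡2* n)) (cong suc (sym (+-suc n (n + 0))))

record GridIs (r : Bool) (x y t s : ℕ) : Set where
  constructor gridIs
  field
    kind  : gridKind t s ≡ r
    dark  : gridWt t s true ≡ x
    light : gridWt t s false ≡ y

gridIs-series : ∀ {r x y t s} → GridIs r x y t s → gridSeries t s ≡ cellSeries r x y
gridIs-series (gridIs refl refl refl) = refl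

gridIs-2+ˡ : ∀ {r x y t s} → GridIs r x y t s → GridIs r (suc x) (suc y) (2 + t) s
gridIs-2+ˡ {t = t} {s} (gridIs k d l) = gridIs k (trans (gridWt-2+ˡ t s true) (cong suc d)) (trans (gridWt-2+ˡ t s false) (cong suc l))

gridIs-2+ʳ : ∀ {r x y t s} → GridIs r x y t s → GridIs r (suc x) (suc y) t (2 + s)
gridIs-2+ʳ {t = t} {s} (gridIs k d l) = gridIs k (trans (gridWt-2+ʳ t s true) (cong suc d)) (trans (gridWt-2+ʳ t s false) (cong suc l))

2+-cancelʳ : ∀ t s {m} → t + (2 + s) ≡ 2 + m → t + s ≡ m
2+-cancelʳ t s eq = suc-injective (suc-injective (trans (sym (trans (+-suc t (suc s)) (cong suc (+-suc t s)))) eq))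

-- The enclosed slices number `2m + 2`, half of each colour, and opposite parities of `t` and `s`
-- mean strips of the same kind.
grid-odd : ∀ m t s → t + s ≡ suc (double m) → GridIs true (suc m) (suc m) t s
grid-odd zero    zero          (suc zero)    eq = gridIs refl refl refl
grid-odd zero    (suc zero)    zero          eq = gridIs refl refl refl
grid-odd (suc m) (suc (suc t)) s             eq = gridIs-2+ˡ (grid-odd m t s (suc-injective (suc-injective eq)))
grid-odd (suc m) zero          (suc (suc s)) eq = gridIs-2+ʳ (grid-odd m zero s (2+-cancelʳ 0 s eq))
grid-odd (suc m) (suc zero)    (suc (suc s)) eq = gridIs-2+ʳ (grid-odd m 1 s (2+-cancelʳ 1 s eq))

-- Of the `2m + 1` enclosed slices both outermost ones have the colour of slice `t`, which is
-- therefore ahead by one. Equal parities of `t` and `s` mean strips of different kinds.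
grid-even : ∀ m t s → t + s ≡ double m →
            if isEven t then GridIs false (suc m) m t s else GridIs false m (suc m) t s
grid-even zero          zero          zero          eq = gridIs refl refl refl
grid-even (suc m)       zero          (suc (suc s)) eq = gridIs-2+ʳ (grid-even m zero s (2+-cancelʳ 0 s eq))
grid-even (suc zero)    (suc zero)    (suc zero)    eq = gridIs refl refl refl
grid-even (suc (suc m)) (suc zero)    (suc (suc s)) eq = gridIs-2+ʳ (grid-even (suc m) 1 s (2+-cancelʳ 1 s eq))
grid-even (suc m)       (suc (suc t)) s             eq
  with isEven t | grid-even m t s (suc-injective (suc-injective eq))
... | true  | g = gridIs-2+ˡ g
... | false | g = gridIs-2+ˡ g

-- Products over triangles and antidiagonals

module Product {A : Set} (_∙_ : A → A → A) (ε : A) where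

  ∏ : ℕ → (ℕ → A) → A
  ∏ zero    f = ε
  ∏ (suc n) f = f 0 ∙ ∏ n (f ∘ suc)

  infixr 8 _⋆_
  _⋆_ : A → ℕ → A
  x ⋆ n = ∏ n λ _ → x

  triangle : (ℕ → ℕ → A) → ℕ → A
  triangle c L = ∏ L λ t → ∏ (L ∸ t) (c t)

module ProductProperties (M : CommutativeMonoid 0ℓ 0ℓ) where
  open CommutativeMonoid M renaming (refl to ≈-refl; sym to ≈-sym; trans to ≈-trans; reflexive to ≈-reflexive)
  open Product _∙_ ε
  open Algebra.Properties.CommutativeSemigroup commutativeSemigroup
  open import Algebra.Solver.CommutativeMonoid M using (solve; _⊕_; _⊜_)
  open import Relation.Binary.Reasoning.Setoid setoid

  ∏-cong : ∀ n {f g} → (∀ i → i < n → f i ≈ g i) → ∏ n f ≈ ∏ n g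
  ∏-cong zero    eq = ≈-refl
  ∏-cong (suc n) eq = ∙-cong (eq 0 z<s) (∏-cong n λ i i<n → eq (suc i) (s<s i<n))

  ∏-∙ : ∀ n f g → ∏ n (λ i → f i ∙ g i) ≈ ∏ n f ∙ ∏ n g
  ∏-∙ zero    f g = ≈-sym (identityˡ ε)
  ∏-∙ (suc n) f g = ≈-trans (∙-congˡ (∏-∙ n (f ∘ suc) (g ∘ suc))) (interchange (f 0) (g 0) _ _)

  ∏-last : ∀ n f → ∏ (suc n) f ≈ ∏ n f ∙ f n
  ∏-last zero    f = comm (f 0) ε
  ∏-last (suc n) f = ≈-trans (∙-congˡ (∏-last n (f ∘ suc))) (≈-sym (assoc (f 0) _ _))

  ∏-drop : ∀ m n {f} → m ≤ n → (∀ i → m ≤ i → f i ≈ ε) → ∏ n f ≈ ∏ m f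
  ∏-drop zero    zero    m≤n       eq = ≈-refl
  ∏-drop zero    (suc n) m≤n       eq =
    ≈-trans (∙-cong (eq 0 z≤n) (∏-drop zero n z≤n λ i _ → eq (suc i) z≤n)) (identityˡ ε)
  ∏-drop (suc m) (suc n) (s≤s m≤n) eq = ∙-congˡ (∏-drop m n m≤n λ i m≤i → eq (suc i) (s≤s m≤i))

  ∏-alternating : ∀ m x y → ∏ (suc (double m)) (λ t → if isEven t then x else y) ≈ x ⋆ suc m ∙ y ⋆ m
  ∏-alternating zero    x y = ≈-sym (identityʳ (x ∙ ε))
  ∏-alternating (suc m) x y = begin
    x ∙ (y ∙ ∏ (suc (double m)) (λ t → if isEven t then x else y)) ≈⟨ ∙-congˡ (∙-congˡ (∏-alternating m x y)) ⟩
    x ∙ (y ∙ (x ⋆ suc m ∙ y ⋆ m))                                ≈⟨ assoc x y _ ⟨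
    (x ∙ y) ∙ (x ⋆ suc m ∙ y ⋆ m)                                ≈⟨ interchange x y _ _ ⟩
    x ⋆ (2 + m) ∙ y ⋆ suc m                                      ∎

  antidiagonal : (ℕ → ℕ → Carrier) → ℕ → Carrier
  antidiagonal c L = ∏ (suc L) λ t → c t (L ∸ t)

  triangle-suc : ∀ c L → triangle c (suc L) ≈ triangle c L ∙ antidiagonal c L
  triangle-suc c L = begin
    ∏ (suc L) (λ t → ∏ (suc L ∸ t) (c t))
      ≈⟨ ∏-cong (suc L) (λ { t (s≤s t≤L) →
           ≈-trans (≈-reflexive (cong (λ k → ∏ k (c t)) (+-∸-assoc 1 t≤L))) (∏-last (L ∸ t) (c t)) }) ⟩
    ∏ (suc L) (λ t → ∏ (L ∸ t) (c t) ∙ c t (L ∸ t))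
      ≈⟨ ∏-∙ (suc L) (λ t → ∏ (L ∸ t) (c t)) (λ t → c t (L ∸ t)) ⟩
    ∏ (suc L) (λ t → ∏ (L ∸ t) (c t)) ∙ antidiagonal c L
      ≈⟨ ∙-congʳ (∏-last L _) ⟩
    (triangle c L ∙ ∏ (L ∸ L) (c L)) ∙ antidiagonal c L
      ≈⟨ ∙-congʳ (∙-congˡ (≈-reflexive (cong (λ k → ∏ k (c L)) (n∸n≡0 L)))) ⟩
    (triangle c L ∙ ε) ∙ antidiagonal c L
      ≈⟨ ∙-congʳ (identityʳ _) ⟩
    triangle c L ∙ antidiagonal c L ∎

  -- The triangle of side `2m` consists of the antidiagonals below `2m`. Of the cells used by the
  -- first `m` factors only the powers of `q m` lie outside it, on antidiagonal `2m`; they are the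
  -- correction `q m ⋆ m`, which the next step of the induction absorbs.
  triangle-double : ∀ c (g p q P : ℕ → Carrier) →
    (∀ m t s → t + s ≡ suc (double m) → c t s ≈ g m) →
    (∀ m t s → t + s ≡ double m → c t s ≈ (if isEven t then p m else q m)) →
    P 0 ≈ ε →
    (∀ m → P (suc m) ≈ P m ∙ (g m ⋆ double (suc m) ∙ (p m ⋆ suc m ∙ q (suc m) ⋆ suc m))) →
    ∀ m → P m ≈ triangle c (double m) ∙ q m ⋆ m
  triangle-double c g p q P odd even P₀ P₊ zero = ≈-trans P₀ (≈-sym (identityˡ ε))
  triangle-double c g p q P odd even P₀ P₊ (suc m) = begin
    P (suc m)                           ≈⟨ P₊ m ⟩
    P m ∙ (G ∙ (O ∙ O″))                ≈⟨ ∙-congʳ (triangle-double c g p q P odd even P₀ P₊ m) ⟩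
    (Δ ∙ O′) ∙ (G ∙ (O ∙ O″))           ≈⟨ solve 5 (λ Δ O′ G O O″ →
      (Δ ⊕ O′) ⊕ (G ⊕ (O ⊕ O″)) ⊜ ((Δ ⊕ (O ⊕ O′)) ⊕ G) ⊕ O″) ≈-refl Δ O′ G O O″ ⟩
    ((Δ ∙ (O ∙ O′)) ∙ G) ∙ O″           ≈⟨ ∙-congʳ (∙-cong (∙-congˡ even-line) odd-line) ⟨
    ((Δ ∙ antidiagonal c (double m)) ∙ antidiagonal c (suc (double m))) ∙ O″
      ≈⟨ ∙-congʳ (≈-trans (triangle-suc c (suc (double m))) (∙-congʳ (triangle-suc c (double m)))) ⟨
    triangle c (double (suc m)) ∙ O″    ∎
    where
    Δ  = triangle c (double m)
    G  = g m ⋆ double (suc m)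
    O  = p m ⋆ suc m
    O′ = q m ⋆ m
    O″ = q (suc m) ⋆ suc m
    odd-line : antidiagonal c (suc (double m)) ≈ G
    odd-line = ∏-cong (double (suc m)) λ { t (s≤s t≤) → odd m t _ (m+[n∸m]≡n t≤) }
    even-line : antidiagonal c (double m) ≈ O ∙ O′
    even-line = ≈-trans (∏-cong (suc (double m)) λ { t (s≤s t≤) → even m t _ (m+[n∸m]≡n t≤) })
                        (∏-alternating m (p m) (q m))

open Product _⊛_ oneS

powS≡⋆ : ∀ f n → powS f n ≡ f ⋆ n
powS≡⋆ f zero    = refl
powS≡⋆ f (suc n) = cong (f ⊛_) (powS≡⋆ f n)

factor≡ : ∀ m → factor (suc m) ≡
  (geomInv (suc m) (suc m) ⋆ double (suc m)) ⊛ ((onePlus (suc m) m ⋆ suc m) ⊛ (onePlus (suc m) (2 + m) ⋆ suc m))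
factor≡ m = cong₂ _⊛_ (trans (cong (powS (geomInv (suc m) (suc m))) (sym (double≡2* (suc m)))) (powS≡⋆ (geomInv (suc m) (suc m)) (double (suc m))))
                      (cong₂ _⊛_ (powS≡⋆ (onePlus (suc m) m) (suc m)) (powS≡⋆ (onePlus (suc m) (2 + m)) (suc m)))

-- The side is twice `a + b` because each further factor widens the triangle by two antidiagonals.
-- The cells of the square outside the triangle and the surplus power in `triangle-double` have
-- degree above `a + b`.
grid≡rhsCoeff : ∀ a b → let L = double (a + b) in ∏ L (λ t → ∏ L (gridSeries t)) a b ≡ rhsCoeff a b
grid≡rhsCoeff a b = ≈-trans square (≈-sym (≈-trans
    (triangle-double gridSeries (λ m → geomInv (suc m) (suc m)) (λ m → onePlus (suc m) m) (λ m → onePlus m (suc m)) prodTo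
      (λ m t s eq → ≈-reflexive (gridIs-series (grid-odd m t s eq)))
      (λ m t s eq → ≈-reflexive (even-cell m (isEven t) (grid-even m t s eq)))
      (≈-refl {oneS}) (λ m → ≈-reflexive (cong (prodTo m ⊛_) (factor≡ m))) N)
    (≈-trans (∙-congˡ {triangle gridSeries (double N)} last-factor) (identityʳ (triangle gridSeries (double N))))))
  a b ≤-refl
  where
  N = a + b
  open Truncated N
  open ProductProperties ⊛-monoid
  open CommutativeMonoid ⊛-monoid using (∙-congˡ; identityʳ)
    renaming (refl to ≈-refl; sym to ≈-sym; trans to ≈-trans; reflexive to ≈-reflexive)
  even-cell : ∀ m b {t s} → (if b then GridIs false (suc m) m t s else GridIs false m (suc m) t s) →
              gridSeries t s ≡ (if b then onePlus (suc m) m else onePlus m (suc m))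
  even-cell m true  = gridIs-series
  even-cell m false = gridIs-series
  last-factor : onePlus N (suc N) ⋆ N ≈ oneS
  last-factor = ∏-drop 0 N z≤n λ _ _ → onePlus≈one N (suc N) (m≤n+m (suc N) N)
  square : ∏ (double N) (λ t → ∏ (double N) (gridSeries t)) ≈ triangle gridSeries (double N)
  square = ∏-cong (double N) λ t t<L → ∏-drop (double N ∸ t) (double N) (m∸n≤m (double N) t) λ s L∸t≤s →
    cellSeries≈one (gridKind t s) (gridWt t s true) (gridWt t s false)
      (subst (N <_) (sym (gridWt-total t s))
        (s≤s (≤-trans (n≤double N) (≤-trans (m≤n+m∸n (double N) t) (+-monoʳ-≤ t L∸t≤s)))))

-- Integer partitions and strips

nth : {A : Set} → A → List A → ℕ → A
nth d []       i       = d
nth d (x ∷ xs) zero    = x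
nth d (x ∷ xs) (suc i) = nth d xs i

infixl 20 _‼_
_‼_ : List ℕ → ℕ → ℕ
_‼_ = nth 0

Decreasing : (ℕ → ℕ) → Set
Decreasing f = ∀ i → f (suc i) ≤ f i

record IsPartition (l : List ℕ) : Set where
  constructor isPartition
  field
    positive   : All (1 ≤_) l
    decreasing : Decreasing (l ‼_)

open IsPartition

‼-beyond : ∀ l {i} → length l ≤ i → l ‼ i ≡ 0
‼-beyond []      _               = refl
‼-beyond (a ∷ l) {suc i} (s≤s p) = ‼-beyond l p

‼-ext : ∀ {l m} → All (1 ≤_) l → All (1 ≤_) m → (∀ i → l ‼ i ≡ m ‼ i) → l ≡ m
‼-ext []       []       eq = refl
‼-ext []       (p ∷ _)  eq = contradiction p (subst (λ n → 1 ≰ n) (eq 0) λ ())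
‼-ext (p ∷ _)  []       eq = contradiction p (subst (λ n → 1 ≰ n) (sym (eq 0)) λ ())
‼-ext (_ ∷ ps) (_ ∷ qs) eq = cong₂ _∷_ (eq 0) (‼-ext ps qs (eq ∘ suc))

partition-ext : ∀ {l m} → IsPartition l → IsPartition m → (∀ i → l ‼ i ≡ m ‼ i) → l ≡ m
partition-ext p q = ‼-ext (positive p) (positive q)

-- Stopping at the first zero row keeps all entries positive, which makes the list of a partition
-- unique; `n` bounds the number of rows.
fromRows : ℕ → (ℕ → ℕ) → List ℕ
fromRows zero    f = []
fromRows (suc n) f with f 0
... | zero  = []
... | suc a = suc a ∷ fromRows n (f ∘ suc)

fromRows-positive : ∀ n f → All (1 ≤_) (fromRows n f)
fromRows-positive zero    f = []
fromRows-positive (suc n) f with f 0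
... | zero  = []
... | suc a = s≤s z≤n ∷ fromRows-positive n (f ∘ suc)

decreasing-≤ : ∀ {f} → Decreasing f → ∀ i → f i ≤ f 0
decreasing-≤ dec zero    = ≤-refl
decreasing-≤ dec (suc i) = ≤-trans (dec i) (decreasing-≤ dec i)

fromRows-‼ : ∀ n f → Decreasing f → (∀ i → n ≤ i → f i ≡ 0) → ∀ i → fromRows n f ‼ i ≡ f i
fromRows-‼ zero    f dec far i = sym (far i z≤n)
fromRows-‼ (suc n) f dec far i with f 0 in f₀
... | zero = sym (n≤0⇒n≡0 (subst (f i ≤_) f₀ (decreasing-≤ dec i)))
fromRows-‼ (suc n) f dec far zero    | suc a = sym f₀
fromRows-‼ (suc n) f dec far (suc i) | suc a =
  fromRows-‼ n (f ∘ suc) (dec ∘ suc) (λ j n≤j → far (suc j) (s≤s n≤j)) i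

fromRows-isPartition : ∀ n f → Decreasing f → (∀ i → n ≤ i → f i ≡ 0) → IsPartition (fromRows n f)
fromRows-isPartition n f dec far = isPartition (fromRows-positive n f)
  λ i → ≡.subst₂ _≤_ (sym (eq (suc i))) (sym (eq i)) (dec i)
  where eq = fromRows-‼ n f dec far

sum≡sumTo : ∀ l n → length l ≤ n → sum l ≡ sumTo n (l ‼_)
sum≡sumTo []      n       _       = sym (sumTo-zero n λ _ _ → refl)
sum≡sumTo (a ∷ l) (suc n) (s≤s p) = trans (cong (a +_) (sum≡sumTo l n p)) (sym (sumTo-head n ((a ∷ l) ‼_)))

sumTo-+ : ∀ n f g → sumTo n (λ i → f i + g i) ≡ sumTo n f + sumTo n g
sumTo-+ zero    f g = refl
sumTo-+ (suc n) f g = trans (cong (_+ (f n + g n)) (sumTo-+ n f g)) (interchange (sumTo n f) _ _ _)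
  where open Algebra.Properties.CommutativeSemigroup +-commutativeSemigroup

sumTo-mono-≤ : ∀ n {f g} → (∀ i → f i ≤ g i) → sumTo n f ≤ sumTo n g
sumTo-mono-≤ zero    le = z≤n
sumTo-mono-≤ (suc n) le = +-mono-≤ (sumTo-mono-≤ n le) (le n)

sum-mono : ∀ k l → (∀ i → k ‼ i ≤ l ‼ i) → sum k ≤ sum l
sum-mono k l le = ≡.subst₂ _≤_ (sym (sum≡sumTo k n (m≤m+n _ _))) (sym (sum≡sumTo l n (m≤n+m _ _)))
  (sumTo-mono-≤ n le)
  where n = length k + length l

-- Conditions on the skew shape `l / k`: interlacing for a horizontal strip (at most one box per
-- column), rows longer by at most one for a vertical strip.
Strip : Bool → List ℕ → List ℕ → Set
Strip true  k l = ∀ i → k ‼ i ≤ l ‼ i × l ‼ suc i ≤ k ‼ i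
Strip false k l = ∀ i → k ‼ i ≤ l ‼ i × l ‼ i ≤ suc (k ‼ i)

strip-≤ : ∀ τ {k l} → Strip τ k l → ∀ i → k ‼ i ≤ l ‼ i
strip-≤ true  s i = proj₁ (s i)
strip-≤ false s i = proj₁ (s i)

-- Local rules for exchanging two strips

record Peak (τ υ : Bool) (k m l : List ℕ) : Set where
  constructor peak
  field
    leftOk    : IsPartition k
    rightOk   : IsPartition m
    partition : IsPartition l
    left      : Strip τ k l
    right     : Strip υ m l

-- Compared with `Peak` the kinds have changed sides: in the square with corners `l`, `k`, `r`, `m`
-- opposite edges have equal kinds, because the two steps pass through each other.
record Valley (τ υ : Bool) (k m r : List ℕ) : Set where
  constructor valley
  field
    leftOk    : IsPartition k
    rightOk   : IsPartition m
    partition : IsPartition r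
    left      : Strip υ r k
    right     : Strip τ r m

-- For fixed `k` and `m`, peaks correspond to valleys together with an admissible number of marks.
-- By `up-size` each mark accounts for one box.
record LocalRule (τ υ : Bool) (k m : List ℕ) : Set where
  field
    up       : ℕ → List ℕ → List ℕ
    excess   : List ℕ → ℕ
    down     : List ℕ → List ℕ
    up-ok    : ∀ {c r} → Marks (same τ υ) c → Valley τ υ k m r → Peak τ υ k m (up c r)
    excess-ok : ∀ {l} → Peak τ υ k m l → Marks (same τ υ) (excess l)
    down-ok  : ∀ {l} → Peak τ υ k m l → Valley τ υ k m (down l)
    up-down  : ∀ {l} → Peak τ υ k m l → up (excess l) (down l) ≡ l
    down-up  : ∀ {c r} → Marks (same τ υ) c → Valley τ υ k m r → down (up c r) ≡ r
    excess-up : ∀ {c r} → Marks (same τ υ) c → Valley τ υ k m r → excess (up c r) ≡ c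
    up-size  : ∀ {c r} → Marks (same τ υ) c → Valley τ υ k m r → sum (up c r) + sum r ≡ sum k + sum m + c

-- Carries c relate the rows of a peak l and a valley r; summing them over all rows telescopes.
carry-size : ∀ {k m l r} (c : ℕ → ℕ) →
  (∀ i → l ‼ i + r ‼ i + c (suc i) ≡ k ‼ i + m ‼ i + c i) →
  (∀ i → length k + length m ≤ i → c (suc i) ≡ 0) →
  sum l + sum r ≡ sum k + sum m + c 0
carry-size {k} {m} {l} {r} c step far = begin
  sum l + sum r                                          ≡⟨ cong₂ _+_ (sum≡sumTo l n l≤n) (sum≡sumTo r n r≤n) ⟩
  sumTo n (l ‼_) + sumTo n (r ‼_)                        ≡⟨ sumTo-+ n _ _ ⟨
  sumTo n (λ i → l ‼ i + r ‼ i)                          ≡⟨ +-identityʳ _ ⟨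
  sumTo n (λ i → l ‼ i + r ‼ i) + 0                      ≡⟨ cong (sumTo n (λ i → l ‼ i + r ‼ i) +_) (far _ (m≤m+n _ _)) ⟨
  sumTo n (λ i → l ‼ i + r ‼ i) + c n                    ≡⟨ telescope n ⟩
  sumTo n (λ i → k ‼ i + m ‼ i) + c 0                    ≡⟨ cong (_+ c 0) (sumTo-+ n _ _) ⟩
  sumTo n (k ‼_) + sumTo n (m ‼_) + c 0                  ≡⟨ cong (_+ c 0) (cong₂ _+_ (sum≡sumTo k n k≤n) (sum≡sumTo m n m≤n)) ⟨
  sum k + sum m + c 0                                    ∎
  where
  open ≡-Reasoning
  n = suc (length k + length m + (length l + length r))
  k≤n : length k ≤ n
  k≤n = m≤n⇒m≤1+n (≤-trans (m≤m+n (length k) (length m)) (m≤m+n (length k + length m) _))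
  m≤n : length m ≤ n
  m≤n = m≤n⇒m≤1+n (≤-trans (m≤n+m (length m) (length k)) (m≤m+n (length k + length m) _))
  l≤n : length l ≤ n
  l≤n = m≤n⇒m≤1+n (≤-trans (m≤m+n (length l) (length r)) (m≤n+m _ (length k + length m)))
  r≤n : length r ≤ n
  r≤n = m≤n⇒m≤1+n (≤-trans (m≤n+m (length r) (length l)) (m≤n+m _ (length k + length m)))
  telescope : ∀ j → sumTo j (λ i → l ‼ i + r ‼ i) + c j ≡ sumTo j (λ i → k ‼ i + m ‼ i) + c 0
  telescope zero    = refl
  telescope (suc j) = begin
    (A + x) + c (suc j)  ≡⟨ +-assoc A x _ ⟩
    A + (x + c (suc j))  ≡⟨ cong (A +_) (step j) ⟩
    A + (y + c j)        ≡⟨ x∙yz≈y∙xz A y (c j) ⟩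
    y + (A + c j)        ≡⟨ cong (y +_) (telescope j) ⟩
    y + (B + c 0)        ≡⟨ x∙yz≈yx∙z y B (c 0) ⟩
    (B + y) + c 0        ∎
    where
    A = sumTo j (λ i → l ‼ i + r ‼ i)
    B = sumTo j (λ i → k ‼ i + m ‼ i)
    x = l ‼ j + r ‼ j
    y = k ‼ j + m ‼ j
    open Algebra.Properties.CommutativeSemigroup +-commutativeSemigroup

module _ (k : List ℕ) where

  above : (ℕ → ℕ) → List ℕ
  above = fromRows (suc (length k))

  below : (ℕ → ℕ) → List ℕ
  below = fromRows (length k)

  module _ {f : ℕ → ℕ} (int : ∀ i → k ‼ i ≤ f i × f (suc i) ≤ k ‼ i) where

    private
      dec : Decreasing f
      dec i = ≤-trans (proj₂ (int i)) (proj₁ (int i))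
      far : ∀ i → suc (length k) ≤ i → f i ≡ 0
      far (suc i) (s≤s le) = n≤0⇒n≡0 (≤-trans (proj₂ (int i)) (≤-reflexive (‼-beyond k le)))

    above-‼ : ∀ i → above f ‼ i ≡ f i
    above-‼ = fromRows-‼ _ f dec far

    above-isPartition : IsPartition (above f)
    above-isPartition = fromRows-isPartition _ f dec far

  module _ {f : ℕ → ℕ} (dec : Decreasing f) (le : ∀ i → f i ≤ k ‼ i) where

    private
      far : ∀ i → length k ≤ i → f i ≡ 0
      far i len = n≤0⇒n≡0 (≤-trans (le i) (≤-reflexive (‼-beyond k len)))

    below-‼ : ∀ i → below f ‼ i ≡ f i
    below-‼ = fromRows-‼ _ f dec far

    below-isPartition : IsPartition (below f)
    below-isPartition = fromRows-isPartition _ f dec far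

-- Two horizontal strips

module HorizontalHorizontal (k m : List ℕ) where

  hi lo : ℕ → ℕ
  hi i = k ‼ i ⊔ m ‼ i
  lo i = k ‼ i ⊓ m ‼ i

  lo≤hi : ∀ i → lo i ≤ hi i
  lo≤hi i = ≤-trans (m⊓n≤m (k ‼ i) (m ‼ i)) (m≤m⊔n (k ‼ i) (m ‼ i))

  -- In a valley, row `i` of `r` ranges over the interval from `hi (suc i)` to `lo i`; in a peak,
  -- row `suc i` of `l` ranges over the same interval. The rule reflects it: the distance from the
  -- upper end becomes the distance from the lower end. The top row of `l` has no upper bound, and
  -- its surplus over `hi 0` is the number of marks.
  carry : ℕ → List ℕ → ℕ → ℕ
  carry c r zero    = c
  carry c r (suc i) = lo i ∸ r ‼ i

  upRow : ℕ → List ℕ → ℕ → ℕ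
  upRow c r i = hi i + carry c r i

  downRow : List ℕ → ℕ → ℕ
  downRow l i = lo i ∸ (l ‼ suc i ∸ hi (suc i))

  up : ℕ → List ℕ → List ℕ
  up c r = above k (upRow c r)

  down : List ℕ → List ℕ
  down l = below k (downRow l)

  module _ {r : List ℕ} (v : Valley true true k m r) where

    r≤lo : ∀ i → r ‼ i ≤ lo i
    r≤lo i = ⊓-glb (proj₁ (Valley.left v i)) (proj₁ (Valley.right v i))

    hi≤r : ∀ i → hi (suc i) ≤ r ‼ i
    hi≤r i = ⊔-lub (proj₂ (Valley.left v i)) (proj₂ (Valley.right v i))

    upRow-≤ : ∀ c i → upRow c r (suc i) ≤ lo i
    upRow-≤ c i = ≤-trans (+-monoˡ-≤ _ (hi≤r i)) (≤-reflexive (m+[n∸m]≡n (r≤lo i)))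

    hi≤upRow : ∀ c i → hi i ≤ upRow c r i
    hi≤upRow c i = m≤m+n (hi i) _

    upRow-k : ∀ c i → k ‼ i ≤ upRow c r i × upRow c r (suc i) ≤ k ‼ i
    upRow-k c i = ≤-trans (m≤m⊔n _ _) (hi≤upRow c i) , ≤-trans (upRow-≤ c i) (m⊓n≤m _ _)

    up-‼ : ∀ c i → up c r ‼ i ≡ upRow c r i
    up-‼ c = above-‼ k (upRow-k c)

    up-ok : ∀ c → Peak true true k m (up c r)
    up-ok c = peak (Valley.leftOk v) (Valley.rightOk v) (above-isPartition k (upRow-k c))
      (λ i → ≡.subst₂ (λ x y → k ‼ i ≤ x × y ≤ k ‼ i) (sym (up-‼ c i)) (sym (up-‼ c (suc i))) (upRow-k c i))
      (λ i → ≡.subst₂ (λ x y → m ‼ i ≤ x × y ≤ m ‼ i) (sym (up-‼ c i)) (sym (up-‼ c (suc i)))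
        (≤-trans (m≤n⊔m _ _) (hi≤upRow c i) , ≤-trans (upRow-≤ c i) (m⊓n≤n _ _)))

    excess-up : ∀ c → up c r ‼ 0 ∸ hi 0 ≡ c
    excess-up c = trans (cong (_∸ hi 0) (up-‼ c 0)) (m+n∸m≡n (hi 0) c)

    downRow-up : ∀ c i → downRow (up c r) i ≡ r ‼ i
    downRow-up c i = begin
      lo i ∸ (up c r ‼ suc i ∸ hi (suc i))             ≡⟨ cong (λ x → lo i ∸ (x ∸ hi (suc i))) (up-‼ c (suc i)) ⟩
      lo i ∸ (hi (suc i) + (lo i ∸ r ‼ i) ∸ hi (suc i)) ≡⟨ cong (lo i ∸_) (m+n∸m≡n (hi (suc i)) _) ⟩
      lo i ∸ (lo i ∸ r ‼ i)                            ≡⟨ m∸[m∸n]≡n (r≤lo i) ⟩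
      r ‼ i                                            ∎
      where open ≡-Reasoning

    size : ∀ c → sum (up c r) + sum r ≡ sum k + sum m + c
    size c = carry-size {k} {m} {up c r} {r} (carry c r) step λ i len →
      trans (cong (_∸ r ‼ i) (n≤0⇒n≡0 (≤-trans (m⊓n≤m _ _) (≤-reflexive (‼-beyond k (≤-trans (m≤m+n _ _) len)))))) (0∸n≡0 (r ‼ i))
      where
      open ≡-Reasoning
      step : ∀ i → up c r ‼ i + r ‼ i + carry c r (suc i) ≡ k ‼ i + m ‼ i + carry c r i
      step i = begin
        up c r ‼ i + r ‼ i + (lo i ∸ r ‼ i)       ≡⟨ +-assoc (up c r ‼ i) _ _ ⟩
        up c r ‼ i + (r ‼ i + (lo i ∸ r ‼ i))     ≡⟨ cong₂ _+_ (up-‼ c i) (m+[n∸m]≡n (r≤lo i)) ⟩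
        hi i + carry c r i + lo i                 ≡⟨ xy∙z≈xz∙y (hi i) _ _ ⟩
        hi i + lo i + carry c r i                 ≡⟨ cong (_+ carry c r i) (⊔+⊓ (k ‼ i) (m ‼ i)) ⟩
        k ‼ i + m ‼ i + carry c r i               ∎
        where
        open Algebra.Properties.CommutativeSemigroup +-commutativeSemigroup
        ⊔+⊓ : ∀ x y → x ⊔ y + x ⊓ y ≡ x + y
        ⊔+⊓ x y with ≤-total x y
        ... | inj₁ x≤y = trans (cong₂ _+_ (m≤n⇒m⊔n≡n x≤y) (m≤n⇒m⊓n≡m x≤y)) (+-comm y x)
        ... | inj₂ y≤x = cong₂ _+_ (m≥n⇒m⊔n≡m y≤x) (m≥n⇒m⊓n≡n y≤x)

  module _ {l : List ℕ} (p : Peak true true k m l) where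

    hi≤l : ∀ i → hi i ≤ l ‼ i
    hi≤l i = ⊔-lub (proj₁ (Peak.left p i)) (proj₁ (Peak.right p i))

    l≤lo : ∀ i → l ‼ suc i ≤ lo i
    l≤lo i = ⊓-glb (proj₂ (Peak.left p i)) (proj₂ (Peak.right p i))

    downRow≤lo : ∀ i → downRow l i ≤ lo i
    downRow≤lo i = m∸n≤m (lo i) (l ‼ suc i ∸ hi (suc i))

    hi≤downRow : ∀ i → hi (suc i) ≤ downRow l i
    hi≤downRow i = m+n≤o⇒m≤o∸n (hi (suc i)) (≤-trans (≤-reflexive (m+[n∸m]≡n (hi≤l (suc i)))) (l≤lo i))

    dec : Decreasing (downRow l)
    dec i = ≤-trans (downRow≤lo (suc i)) (≤-trans (lo≤hi (suc i)) (hi≤downRow i))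

    downRow-k : ∀ i → downRow l i ≤ k ‼ i
    downRow-k i = ≤-trans (downRow≤lo i) (m⊓n≤m _ _)

    down-‼ : ∀ i → down l ‼ i ≡ downRow l i
    down-‼ = below-‼ k dec downRow-k

    down-ok : Valley true true k m (down l)
    down-ok = valley (Peak.leftOk p) (Peak.rightOk p) (below-isPartition k dec downRow-k)
      (λ i → subst (λ x → x ≤ k ‼ i × k ‼ suc i ≤ x) (sym (down-‼ i))
        (downRow-k i , ≤-trans (m≤m⊔n _ _) (hi≤downRow i)))
      (λ i → subst (λ x → x ≤ m ‼ i × m ‼ suc i ≤ x) (sym (down-‼ i))
        (≤-trans (downRow≤lo i) (m⊓n≤n _ _) , ≤-trans (m≤n⊔m _ _) (hi≤downRow i)))

    upRow-down : ∀ i → upRow (l ‼ 0 ∸ hi 0) (down l) i ≡ l ‼ i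
    upRow-down zero    = m+[n∸m]≡n (hi≤l 0)
    upRow-down (suc i) = begin
      hi (suc i) + (lo i ∸ down l ‼ i)       ≡⟨ cong (λ x → hi (suc i) + (lo i ∸ x)) (down-‼ i) ⟩
      hi (suc i) + (lo i ∸ downRow l i)      ≡⟨ cong (hi (suc i) +_) (m∸[m∸n]≡n (≤-trans (m∸n≤m (l ‼ suc i) (hi (suc i))) (l≤lo i))) ⟩
      hi (suc i) + (l ‼ suc i ∸ hi (suc i))  ≡⟨ m+[n∸m]≡n (hi≤l (suc i)) ⟩
      l ‼ suc i                              ∎
      where open ≡-Reasoning

  rule : LocalRule true true k m
  rule = record
    { up = up ; excess = λ l → l ‼ 0 ∸ hi 0 ; down = down
    ; up-ok = λ _ v → up-ok v _
    ; excess-ok = λ _ → tt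
    ; down-ok = down-ok
    ; up-down = λ p → partition-ext (Peak.partition (up-ok (down-ok p) _)) (Peak.partition p)
        λ i → trans (up-‼ (down-ok p) _ i) (upRow-down p i)
    ; down-up = λ {c} _ v → partition-ext (Valley.partition (down-ok (up-ok v c))) (Valley.partition v)
        λ i → trans (down-‼ (up-ok v c) i) (downRow-up v c i)
    ; excess-up = λ {c} _ v → excess-up v c
    ; up-size = λ {c} _ v → size v c }

-- A horizontal and a vertical strip

module HorizontalVertical (k m : List ℕ) where

  -- `out` and `next` compute the row of the peak and the outgoing carry from the valley and the
  -- incoming carry; `back` and `inn` go the other way, from the outgoing carry.
  out : ∀ {a b} → Dec (b < a) → ℕ → ℕ
  out {a} {b} (yes _) c = a
  out {a} {b} (no  _) c = b + c

  next : ∀ {a b} → Dec (b < a) → ℕ → ℕ → ℕ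
  next     (yes _) r c = c
  next {a} (no  _) r c = a ∸ r

  back : ∀ {a b} → Dec (b < a) → ℕ → ℕ → ℕ
  back     (yes _) l c′ = c′
  back {b = b} (no  _) l c′ = l ∸ b

  inn : ∀ {a b} → Dec (b < a) → ℕ → ℕ
  inn {a} {b} (yes _) c′ = b
  inn {a} {b} (no  _) c′ = a ∸ c′

  -- One row, with `a` from `k` and `b` from `m`. If `b < a`, the strip conditions force
  -- `a ≡ suc b`, `l ≡ a` and `r ≡ b`: the row holds no information and the carry passes by.
  -- Otherwise `l` exceeds `b`, and `r` falls short of `a`, by at most one: the incoming carry
  -- becomes the former bit and the latter becomes the outgoing carry.
  data Step (a b c c′ l r : ℕ) : Set where
    skip : b < a → l ≡ a → r ≡ b → c′ ≡ c → Step a b c c′ l r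
    move : a ≤ b → l ≡ b + c → r + c′ ≡ a → Step a b c c′ l r

  step-size : ∀ {a b c c′ l r} → Step a b c c′ l r → l + r + c′ ≡ a + b + c
  step-size (skip _ refl refl refl) = refl
  step-size {b = b} {c} {c′} {r = r} (move _ refl refl) =
    trans (+-assoc (b + c) r c′) (xy∙z≈zx∙y b c (r + c′))
    where open Algebra.Properties.CommutativeSemigroup +-commutativeSemigroup

  step-out : ∀ {a b c c′ l r} d → Step a b c c′ l r → out {a} {b} d c ≡ l
  step-out (yes _)   (skip _ l≡ _ _) = sym l≡
  step-out (yes b<a) (move a≤b _ _)  = contradiction b<a (≤⇒≯ a≤b)
  step-out (no b≮a)  (skip b<a _ _ _) = contradiction b<a b≮a
  step-out (no _)    (move _ l≡ _)   = sym l≡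

  step-next : ∀ {a b c c′ l r} d → Step a b c c′ l r → next {a} {b} d r c ≡ c′
  step-next (yes _)   (skip _ _ _ c≡) = sym c≡
  step-next (yes b<a) (move a≤b _ _)  = contradiction b<a (≤⇒≯ a≤b)
  step-next (no b≮a)  (skip b<a _ _ _) = contradiction b<a b≮a
  step-next {c′ = c′} {r = r} (no _) (move _ _ refl) = m+n∸m≡n r c′

  step-back : ∀ {a b c c′ l r} d → Step a b c c′ l r → back {a} {b} d l c′ ≡ c
  step-back (yes _)   (skip _ _ _ c≡) = c≡
  step-back (yes b<a) (move a≤b _ _)  = contradiction b<a (≤⇒≯ a≤b)
  step-back (no b≮a)  (skip b<a _ _ _) = contradiction b<a b≮a
  step-back {b = b} {c} (no _) (move _ refl _) = m+n∸m≡n b c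

  step-inn : ∀ {a b c c′ l r} d → Step a b c c′ l r → inn {a} {b} d c′ ≡ r
  step-inn (yes _)   (skip _ _ r≡ _) = sym r≡
  step-inn (yes b<a) (move a≤b _ _)  = contradiction b<a (≤⇒≯ a≤b)
  step-inn (no b≮a)  (skip b<a _ _ _) = contradiction b<a b≮a
  step-inn {c′ = c′} {r = r} (no _) (move _ _ refl) = m+n∸n≡m r c′

  forward : ∀ {a b c r} d → r ≤ a → r ≤ b → a ≤ suc r → Step a b c (next {a} {b} d r c) (out {a} {b} d c) r
  forward (yes b<a) _   r≤b a≤ = skip b<a refl (≤-antisym r≤b (s≤s⁻¹ (≤-trans b<a a≤))) refl
  forward (no  b≮a) r≤a _   _  = move (≮⇒≥ b≮a) refl (m+[n∸m]≡n r≤a)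

  backward : ∀ {a b l c′} d → a ≤ l → b ≤ l → l ≤ suc b → (a ≤ b → c′ ≤ a) →
             Step a b (back {a} {b} d l c′) c′ l (inn {a} {b} d c′)
  backward (yes b<a) a≤l _   l≤ _    = skip b<a (≤-antisym (≤-trans l≤ b<a) a≤l) refl refl
  backward (no  b≮a) _   b≤l _  c′≤a = move (≮⇒≥ b≮a) (sym (m+[n∸m]≡n b≤l)) (m∸n+n≡m (c′≤a (≮⇒≥ b≮a)))

  cmp : ∀ i → Dec (m ‼ i < k ‼ i)
  cmp i = m ‼ i <? k ‼ i

  carry : ℕ → List ℕ → ℕ → ℕ
  carry c r zero    = c
  carry c r (suc i) = next (cmp i) (r ‼ i) (carry c r i)

  upRow : ℕ → List ℕ → ℕ → ℕ
  upRow c r i = out (cmp i) (carry c r i)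

  up : ℕ → List ℕ → List ℕ
  up c r = above k (upRow c r)

  -- The carry is determined by the next row that is not skipped, hence the search;
  -- no row beyond the length of k is skipped.
  search : List ℕ → ℕ → ℕ → ℕ
  search l zero    i = l ‼ i ∸ m ‼ i
  search l (suc n) i = back (cmp i) (l ‼ i) (search l n (suc i))

  carryOf : List ℕ → ℕ → ℕ
  carryOf l = search l (length k)

  downRow : List ℕ → ℕ → ℕ
  downRow l i = inn (cmp i) (carryOf l (suc i))

  down : List ℕ → List ℕ
  down l = below k (downRow l)

  -- Row `i + n` lies beyond `k`, so it is not skipped and its carry is read off directly; further
  -- search changes nothing.
  search-stable : ∀ l n i → length k ≤ i + n → search l n i ≡ search l (suc n) i
  search-stable l zero    i len = sym (back-0 (cmp i) (‼-beyond k (subst (length k ≤_) (+-identityʳ i) len)))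
    where
    back-0 : ∀ {a b l c′} d → a ≡ 0 → back {a} {b} d l c′ ≡ l ∸ b
    back-0 (yes ()) refl
    back-0 (no _) _ = refl
  search-stable l (suc n) i len = cong (back (cmp i) (l ‼ i))
    (search-stable l n (suc i) (subst (length k ≤_) (+-suc i n) len))

  carryOf-step : ∀ l i → carryOf l i ≡ back (cmp i) (l ‼ i) (carryOf l (suc i))
  carryOf-step l i = search-stable l (length k) i (m≤n+m (length k) i)

  module _ {r : List ℕ} (v : Valley true false k m r) {c : ℕ} (c≤1 : c ≤ 1) where

    private
      c′ = carry c r
      kP = Valley.leftOk v
      mP = Valley.rightOk v
      st : ∀ i → Step (k ‼ i) (m ‼ i) (c′ i) (c′ (suc i)) (upRow c r i) (r ‼ i)
      st i = forward (cmp i) (proj₁ (Valley.left v i)) (proj₁ (Valley.right v i)) (proj₂ (Valley.left v i))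

      carry≤1 : ∀ i → c′ i ≤ 1
      carry≤1 zero    = c≤1
      carry≤1 (suc i) with st i
      ... | skip _ _ _ eq = subst (_≤ 1) (sym eq) (carry≤1 i)
      ... | move _ _ eq   = +-cancelˡ-≤ (r ‼ i) _ _ (≤-trans (≤-reflexive eq)
                              (≤-trans (proj₂ (Valley.left v i)) (≤-reflexive (+-comm 1 (r ‼ i)))))

      -- This makes `l` interlace with `k`. In a skipped row `m ‼ i < k ‼ i` leaves room for a carry
      -- of 1; in any other row the carry is exactly what `r ‼ i` lacks of `k ‼ i`.
      m+carry≤k : ∀ i → m ‼ suc i + c′ (suc i) ≤ k ‼ i
      m+carry≤k i with st i
      ... | skip m<k _ _ _ = ≤-trans (+-mono-≤ (decreasing mP i) (carry≤1 (suc i)))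
                               (≤-trans (≤-reflexive (+-comm (m ‼ i) 1)) m<k)
      ... | move _ _ eq    = ≤-trans (+-monoˡ-≤ (c′ (suc i)) (proj₂ (Valley.right v i))) (≤-reflexive eq)

      k≤l : ∀ i → k ‼ i ≤ upRow c r i
      k≤l i with st i
      ... | skip _ eq _ _   = ≤-reflexive (sym eq)
      ... | move k≤m eq _   = ≤-trans k≤m (≤-trans (m≤m+n _ _) (≤-reflexive (sym eq)))

      l≤k : ∀ i → upRow c r (suc i) ≤ k ‼ i
      l≤k i with st (suc i)
      ... | skip _ eq _ _ = ≤-trans (≤-reflexive eq) (decreasing kP i)
      ... | move _ eq _   = ≤-trans (≤-reflexive eq) (m+carry≤k i)

      m≤l : ∀ i → m ‼ i ≤ upRow c r i × upRow c r i ≤ suc (m ‼ i)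
      m≤l i with st i
      ... | skip m<k eq r≡m _ = ≤-trans (<⇒≤ m<k) (≤-reflexive (sym eq)) ,
            ≤-trans (≤-reflexive eq) (subst (λ x → k ‼ i ≤ suc x) r≡m (proj₂ (Valley.left v i)))
      ... | move _ eq _ = ≤-trans (m≤m+n _ _) (≤-reflexive (sym eq)) ,
            ≤-trans (≤-reflexive eq) (≤-trans (+-monoʳ-≤ (m ‼ i) (carry≤1 i)) (≤-reflexive (+-comm (m ‼ i) 1)))

      int : ∀ i → k ‼ i ≤ upRow c r i × upRow c r (suc i) ≤ k ‼ i
      int i = k≤l i , l≤k i

    up-‼ : ∀ i → up c r ‼ i ≡ upRow c r i
    up-‼ = above-‼ k int

    up-ok : Peak true false k m (up c r)
    up-ok = peak kP mP (above-isPartition k int)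
      (λ i → ≡.subst₂ (λ x y → k ‼ i ≤ x × y ≤ k ‼ i) (sym (up-‼ i)) (sym (up-‼ (suc i))) (int i))
      (λ i → subst (λ x → m ‼ i ≤ x × x ≤ suc (m ‼ i)) (sym (up-‼ i)) (m≤l i))

    private
      st′ : ∀ i → Step (k ‼ i) (m ‼ i) (c′ i) (c′ (suc i)) (up c r ‼ i) (r ‼ i)
      st′ i = subst (λ x → Step (k ‼ i) (m ‼ i) (c′ i) (c′ (suc i)) x (r ‼ i)) (sym (up-‼ i)) (st i)

      search-up : ∀ n i → length k ≤ i + n → search (up c r) n i ≡ c′ i
      search-up zero i len with st′ i
      -- Beyond the rows of `k`, a skipped row would need `m ‼ i < 0`.
      ... | skip m<k _ _ _ = contradiction (subst (m ‼ i <_) (‼-beyond k (subst (length k ≤_) (+-identityʳ i) len)) m<k) λ ()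
      ... | move _ eq _    = trans (cong (_∸ m ‼ i) eq) (m+n∸m≡n (m ‼ i) (c′ i))
      search-up (suc n) i len = trans
        (cong (back (cmp i) (up c r ‼ i)) (search-up n (suc i) (subst (length k ≤_) (+-suc i n) len)))
        (step-back (cmp i) (st′ i))

    carryOf-up : ∀ i → carryOf (up c r) i ≡ c′ i
    carryOf-up i = search-up (length k) i (m≤n+m (length k) i)

    downRow-up : ∀ i → downRow (up c r) i ≡ r ‼ i
    downRow-up i = trans (cong (inn (cmp i)) (carryOf-up (suc i))) (step-inn (cmp i) (st i))

    size : sum (up c r) + sum r ≡ sum k + sum m + c
    size = carry-size {k} {m} {up c r} {r} c′ (λ i → step-size (st′ i)) far
      where
      far : ∀ i → length k + length m ≤ i → c′ (suc i) ≡ 0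
      far i len with st i | ‼-beyond k (≤-trans (m≤m+n _ _) len)
      ... | skip m<k _ _ _ | k≡0 = contradiction (subst (m ‼ i <_) k≡0 m<k) λ ()
      ... | move _ _ eq    | k≡0 = m+n≡0⇒n≡0 (r ‼ i) (trans eq k≡0)

  module _ {l : List ℕ} (p : Peak true false k m l) where

    private
      c = carryOf l
      kP = Peak.leftOk p
      mP = Peak.rightOk p

    search≤1 : ∀ n i → search l n i ≤ 1
    search≤1 zero    i = ≤-trans (∸-monoˡ-≤ (m ‼ i) (proj₂ (Peak.right p i))) (≤-reflexive (m+n∸n≡m 1 (m ‼ i)))
    search≤1 (suc n) i with cmp i
    ... | yes _ = search≤1 n (suc i)
    ... | no  _ = search≤1 zero i

    private
      m+carry≤k : ∀ i → m ‼ suc i + c (suc i) ≤ k ‼ i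
      m+carry≤k i = subst (λ x → m ‼ suc i + x ≤ k ‼ i) (sym (carryOf-step l (suc i)))
        (bound (cmp (suc i)) (search≤1 (length k) (2 + i)))
        where
        bound : ∀ {c″} (d : Dec (m ‼ suc i < k ‼ suc i)) → c″ ≤ 1 → m ‼ suc i + back d (l ‼ suc i) c″ ≤ k ‼ i
        bound (yes m<k) c≤1 = ≤-trans (+-monoʳ-≤ (m ‼ suc i) c≤1) (≤-trans (≤-reflexive (+-comm (m ‼ suc i) 1))
                                (≤-trans m<k (decreasing kP i)))
        bound (no _)    _   = ≤-trans (≤-reflexive (m+[n∸m]≡n (proj₁ (Peak.right p (suc i))))) (proj₂ (Peak.left p i))

      st : ∀ i → Step (k ‼ i) (m ‼ i) (c i) (c (suc i)) (l ‼ i) (downRow l i)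
      st i = subst (λ x → Step (k ‼ i) (m ‼ i) x (c (suc i)) (l ‼ i) (downRow l i)) (sym (carryOf-step l i))
        (backward (cmp i) (proj₁ (Peak.left p i)) (proj₁ (Peak.right p i)) (proj₂ (Peak.right p i))
          λ _ → ≤-trans (m≤n+m (c (suc i)) (m ‼ suc i)) (m+carry≤k i))

      r-k : ∀ i → downRow l i ≤ k ‼ i × k ‼ i ≤ suc (downRow l i)
      r-k i with st i
      ... | skip m<k l≡k r≡m _ = ≤-trans (≤-reflexive r≡m) (<⇒≤ m<k) ,
            ≡.subst₂ (λ x y → x ≤ suc y) l≡k (sym r≡m) (proj₂ (Peak.right p i))
      ... | move _ _ eq = ≤-trans (m≤m+n _ _) (≤-reflexive eq) ,
            ≤-trans (≤-reflexive (sym eq)) (≤-trans (+-monoʳ-≤ (downRow l i) (search≤1 (length k) (suc i)))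
              (≤-reflexive (+-comm (downRow l i) 1)))

      r-m : ∀ i → downRow l i ≤ m ‼ i × m ‼ suc i ≤ downRow l i
      r-m i with st i
      ... | skip _ _ r≡m _ = ≤-reflexive r≡m , ≤-trans (decreasing mP i) (≤-reflexive (sym r≡m))
      ... | move k≤m _ eq  = ≤-trans (m≤m+n _ _) (≤-trans (≤-reflexive eq) k≤m) ,
            +-cancelʳ-≤ (c (suc i)) _ _ (≤-trans (m+carry≤k i) (≤-reflexive (sym eq)))

      dec : Decreasing (downRow l)
      dec i = ≤-trans (proj₁ (r-m (suc i))) (proj₂ (r-m i))

    down-‼ : ∀ i → down l ‼ i ≡ downRow l i
    down-‼ = below-‼ k dec (proj₁ ∘ r-k)

    down-ok : Valley true false k m (down l)
    down-ok = valley kP mP (below-isPartition k dec (proj₁ ∘ r-k))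
      (λ i → subst (λ x → x ≤ k ‼ i × k ‼ i ≤ suc x) (sym (down-‼ i)) (r-k i))
      (λ i → subst (λ x → x ≤ m ‼ i × m ‼ suc i ≤ x) (sym (down-‼ i)) (r-m i))

    carry-down : ∀ i → carry (c 0) (down l) i ≡ c i
    carry-down zero    = refl
    carry-down (suc i) = trans (cong₂ (next (cmp i)) (down-‼ i) (carry-down i)) (step-next (cmp i) (st i))

    upRow-down : ∀ i → upRow (c 0) (down l) i ≡ l ‼ i
    upRow-down i = trans (cong (out (cmp i)) (carry-down i)) (step-out (cmp i) (st i))

  rule : LocalRule true false k m
  rule = record
    { up = up ; excess = λ l → carryOf l 0 ; down = down
    ; up-ok = λ c≤1 v → up-ok v c≤1
    ; excess-ok = λ p → search≤1 p (length k) 0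
    ; down-ok = down-ok
    ; up-down = λ p → let c≤1 = search≤1 p (length k) 0 in
        partition-ext (Peak.partition (up-ok (down-ok p) c≤1)) (Peak.partition p)
          λ i → trans (up-‼ (down-ok p) c≤1 i) (upRow-down p i)
    ; down-up = λ c≤1 v →
        partition-ext (Valley.partition (down-ok (up-ok v c≤1))) (Valley.partition v)
          λ i → trans (down-‼ (up-ok v c≤1) i) (downRow-up v c≤1 i)
    ; excess-up = λ c≤1 v → carryOf-up v c≤1 0
    ; up-size = λ c≤1 v → size v c≤1 }

-- The mirror image of the square exchanges its side corners together with the kinds of its edges.
swap-rule : ∀ {τ υ k m} → LocalRule τ υ k m → LocalRule υ τ m k
swap-rule {τ} {υ} {k} {m} R = record
  { up = up ; excess = excess ; down = down
  ; up-ok = λ c v → swapPeak (up-ok (marks c) (swapValley v))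
  ; excess-ok = λ p → marks′ (excess-ok (swapPeak p))
  ; down-ok = λ p → swapValley (down-ok (swapPeak p))
  ; up-down = λ p → up-down (swapPeak p)
  ; down-up = λ c v → down-up (marks c) (swapValley v)
  ; excess-up = λ c v → excess-up (marks c) (swapValley v)
  ; up-size = λ {c} ok v → trans (up-size (marks ok) (swapValley v)) (cong (_+ c) (+-comm (sum k) (sum m))) }
  where
  open LocalRule R
  swapPeak : ∀ {τ υ k m l} → Peak τ υ k m l → Peak υ τ m k l
  swapPeak (peak kP mP p l r) = peak mP kP p r l
  swapValley : ∀ {τ υ k m l} → Valley τ υ k m l → Valley υ τ m k l
  swapValley (valley kP mP p l r) = valley mP kP p r l
  same-comm : ∀ τ υ → same τ υ ≡ same υ τ
  same-comm true  true  = refl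
  same-comm true  false = refl
  same-comm false true  = refl
  same-comm false false = refl
  marks : ∀ {c} → Marks (same υ τ) c → Marks (same τ υ) c
  marks {c} = subst (λ b → Marks b c) (same-comm υ τ)
  marks′ : ∀ {c} → Marks (same τ υ) c → Marks (same υ τ) c
  marks′ {c} = subst (λ b → Marks b c) (same-comm τ υ)

-- Conjugate partitions and two vertical strips

<⇒≤-ext : ∀ {x y} → (∀ {i} → i < x → i < y) → x ≤ y
<⇒≤-ext {zero}  _ = z≤n
<⇒≤-ext {suc x} h = h ≤-refl

-- Row lengths are compared through their boxes, since conjugation and membership in a pyramid
-- partition are both stated box by box.
<⇔⇒≡ : ∀ {x y} → (∀ {i} → i < x → i < y) → (∀ {i} → i < y → i < x) → x ≡ y
<⇔⇒≡ f g = ≤-antisym (<⇒≤-ext f) (<⇒≤-ext g)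

bit : ∀ {p} {P : Set p} → Dec P → ℕ
bit (yes _) = 1
bit (no  _) = 0

column : List ℕ → ℕ → ℕ
column []      j = 0
column (a ∷ l) j = bit (j <? a) + column l j

row⇒column : ∀ {l i j} → Decreasing (l ‼_) → j < l ‼ i → i < column l j
row⇒column {a ∷ l} {i} {j} dec j<l with j <? a
row⇒column {a ∷ l} {zero}  {j} dec j<l | yes _  = s≤s z≤n
row⇒column {a ∷ l} {suc i} {j} dec j<l | yes _  = s≤s (row⇒column {l} (dec ∘ suc) j<l)
row⇒column {a ∷ l} {i}     {j} dec j<l | no j≮a = contradiction (<-≤-trans j<l (decreasing-≤ dec i)) j≮a

column⇒row : ∀ {l i j} → Decreasing (l ‼_) → i < column l j → j < l ‼ i
column⇒row {a ∷ l} {i} {j} dec i<c with j <? a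
column⇒row {a ∷ l} {zero}  {j} dec i<c       | yes j<a = j<a
column⇒row {a ∷ l} {suc i} {j} dec (s≤s i<c) | yes _   = column⇒row {l} (dec ∘ suc) i<c
column⇒row {a ∷ l} {i}     {j} dec i<c       | no j≮a  =
  contradiction (<-≤-trans (column⇒row {l} {0} (dec ∘ suc) (≤-<-trans z≤n i<c)) (dec 0)) j≮a

conjugate : List ℕ → List ℕ
conjugate l = fromRows (l ‼ 0) (column l)

module _ {l : List ℕ} (lP : IsPartition l) where

  private
    dec : Decreasing (column l)
    dec j = <⇒≤-ext λ i< → row⇒column {l} (decreasing lP) (<-trans (n<1+n j) (column⇒row {l} (decreasing lP) i<))
    far : ∀ j → l ‼ 0 ≤ j → column l j ≡ 0
    far j le = n≤0⇒n≡0 (≮⇒≥ λ 0<c → <⇒≱ (column⇒row {l} (decreasing lP) 0<c) le)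

  conjugate-‼ : ∀ j → conjugate l ‼ j ≡ column l j
  conjugate-‼ = fromRows-‼ (l ‼ 0) (column l) dec far

  conjugate-isPartition : IsPartition (conjugate l)
  conjugate-isPartition = fromRows-isPartition (l ‼ 0) (column l) dec far

  transpose : ∀ {i j} → j < l ‼ i → i < conjugate l ‼ j
  transpose {i} {j} j<l = subst (i <_) (sym (conjugate-‼ j)) (row⇒column {l} (decreasing lP) j<l)

  transpose⁻¹ : ∀ {i j} → i < conjugate l ‼ j → j < l ‼ i
  transpose⁻¹ {i} {j} i<c = column⇒row {l} (decreasing lP) (subst (i <_) (conjugate-‼ j) i<c)

conjugate-involutive : ∀ {l} → IsPartition l → conjugate (conjugate l) ≡ l
conjugate-involutive lP = partition-ext (conjugate-isPartition lP′) lP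
  λ i → <⇔⇒≡ (transpose⁻¹ lP ∘ transpose⁻¹ lP′) (transpose lP′ ∘ transpose lP)
  where lP′ = conjugate-isPartition lP

-- Counts the boxes by columns: a row of length `a` meets exactly the columns `j < a`.
sumTo-column : ∀ l n → Decreasing (l ‼_) → l ‼ 0 ≤ n → sumTo n (column l) ≡ sum l
sumTo-column []      n dec le = sumTo-zero n λ _ _ → refl
sumTo-column (a ∷ l) n dec le = trans (sumTo-+ n _ _)
  (cong₂ _+_ (ones n le) (sumTo-column l n (dec ∘ suc) (≤-trans (dec 0) le)))
  where
  bit-yes : ∀ {p} {P : Set p} (d : Dec P) → P → bit d ≡ 1
  bit-yes (yes _) _ = refl
  bit-yes (no ¬p) p = contradiction p ¬p
  bit-no : ∀ {x y} (d : Dec (x < y)) → y ≤ x → bit d ≡ 0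
  bit-no (yes p) le = contradiction p (≤⇒≯ le)
  bit-no (no _) _ = refl
  ones : ∀ {a} n → a ≤ n → sumTo n (λ j → bit (j <? a)) ≡ a
  ones n le with m≤n⇒m<n∨m≡n le
  ones {a} (suc n) le | inj₁ (s≤s a≤n) =
    trans (cong₂ _+_ (ones n a≤n) (bit-no (n <? a) a≤n)) (+-identityʳ a)
  ones n le | inj₂ refl =
    trans (sumTo-cong n λ j j<n → bit-yes (j <? n) j<n) (trans (sumTo-const n 1) (*-identityʳ n))

sum-conjugate : ∀ {l} → IsPartition l → sum (conjugate l) ≡ sum l
sum-conjugate {l} lP = begin
  sum (conjugate l)            ≡⟨ sum≡sumTo (conjugate l) n (m≤n+m _ _) ⟩
  sumTo n (conjugate l ‼_)     ≡⟨ sumTo-cong n (λ j _ → conjugate-‼ lP j) ⟩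
  sumTo n (column l)           ≡⟨ sumTo-column l n (decreasing lP) (m≤m+n _ _) ⟩
  sum l                        ∎
  where
  open ≡-Reasoning
  n = l ‼ 0 + length (conjugate l)

-- If box `suc j` of a row lies in `l`, then box `j` of the same row lies in `k`; read by columns,
-- this is interlacing.
conjugate-strip : ∀ {k l} → IsPartition k → IsPartition l → Strip false k l → Strip true (conjugate k) (conjugate l)
conjugate-strip kP lP s j =
  <⇒≤-ext (λ i< → transpose lP (<-≤-trans (transpose⁻¹ kP i<) (proj₁ (s _)))) ,
  <⇒≤-ext (λ i< → transpose kP (s≤s⁻¹ (<-≤-trans (transpose⁻¹ lP i<) (proj₂ (s _)))))

conjugate-strip⁻¹ : ∀ {k l} → IsPartition k → IsPartition l → Strip true (conjugate k) (conjugate l) → Strip false k l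
conjugate-strip⁻¹ kP lP s i =
  <⇒≤-ext (λ j< → transpose⁻¹ lP (<-≤-trans (transpose kP j<) (proj₁ (s _)))) ,
  -- Box 0 costs nothing, because the bound is `suc (k ‼ i)`.
  <⇒≤-ext λ { {zero} _ → s≤s z≤n
            ; {suc j} j< → s≤s (transpose⁻¹ kP (<-≤-trans (transpose lP j<) (proj₂ (s _)))) }

-- Conjugation is an involution that preserves sizes and exchanges the kinds of strips, so the rule
-- for two horizontal strips carries over.
conjugate-rule : ∀ {k m} → LocalRule true true (conjugate k) (conjugate m) → LocalRule false false k m
conjugate-rule {k} {m} R = record
  { up = λ c r → conjugate (up c (conjugate r))
  ; excess = excess ∘ conjugate
  ; down = conjugate ∘ down ∘ conjugate
  ; up-ok = λ _ v → peak⁻¹ (Valley.leftOk v) (Valley.rightOk v) (up-ok tt (valley⁺ v))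
  ; excess-ok = λ _ → tt
  ; down-ok = λ p → valley⁻¹ (Peak.leftOk p) (Peak.rightOk p) (down-ok (peak⁺ p))
  ; up-down = λ p → let v = down-ok (peak⁺ p) in
      trans (cong (conjugate ∘ up _) (conjugate-involutive (Valley.partition v)))
        (trans (cong conjugate (up-down (peak⁺ p))) (conjugate-involutive (Peak.partition p)))
  ; down-up = λ _ v → let p = up-ok tt (valley⁺ v) in
      trans (cong (conjugate ∘ down) (conjugate-involutive (Peak.partition p)))
        (trans (cong conjugate (down-up tt (valley⁺ v))) (conjugate-involutive (Valley.partition v)))
  ; excess-up = λ _ v → let p = up-ok tt (valley⁺ v) in
      trans (cong excess (conjugate-involutive (Peak.partition p))) (excess-up tt (valley⁺ v))
  ; up-size = λ {c} _ v → let p = up-ok tt (valley⁺ v) in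
      trans (cong₂ _+_ (sum-conjugate (Peak.partition p)) (sym (sum-conjugate (Valley.partition v))))
        (trans (up-size tt (valley⁺ v))
          (cong (_+ c) (cong₂ _+_ (sum-conjugate (Valley.leftOk v)) (sum-conjugate (Valley.rightOk v))))) }
  where
  open LocalRule R
  peak⁺ : ∀ {l} → Peak false false k m l → Peak true true (conjugate k) (conjugate m) (conjugate l)
  peak⁺ (peak kP mP p l r) = peak (conjugate-isPartition kP) (conjugate-isPartition mP)
    (conjugate-isPartition p) (conjugate-strip kP p l) (conjugate-strip mP p r)
  valley⁺ : ∀ {r} → Valley false false k m r → Valley true true (conjugate k) (conjugate m) (conjugate r)
  valley⁺ (valley kP mP p l r) = valley (conjugate-isPartition kP) (conjugate-isPartition mP)
    (conjugate-isPartition p) (conjugate-strip p kP l) (conjugate-strip p mP r)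
  peak⁻¹ : ∀ {l} → IsPartition k → IsPartition m →
           Peak true true (conjugate k) (conjugate m) l → Peak false false k m (conjugate l)
  peak⁻¹ kP mP (peak _ _ p l r) = peak kP mP p′
    (conjugate-strip⁻¹ kP p′ (subst (Strip true (conjugate k)) (sym (conjugate-involutive p)) l))
    (conjugate-strip⁻¹ mP p′ (subst (Strip true (conjugate m)) (sym (conjugate-involutive p)) r))
    where p′ = conjugate-isPartition p
  valley⁻¹ : ∀ {r} → IsPartition k → IsPartition m →
             Valley true true (conjugate k) (conjugate m) r → Valley false false k m (conjugate r)
  valley⁻¹ kP mP (valley _ _ p l r) = valley kP mP p′
    (conjugate-strip⁻¹ p′ kP (subst (λ x → Strip true x (conjugate k)) (sym (conjugate-involutive p)) l))
    (conjugate-strip⁻¹ p′ mP (subst (λ x → Strip true x (conjugate m)) (sym (conjugate-involutive p)) r))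
    where p′ = conjugate-isPartition p

localRule : ∀ τ υ k m → LocalRule τ υ k m
localRule true  true  k m = HorizontalHorizontal.rule k m
localRule true  false k m = HorizontalVertical.rule k m
localRule false true  k m = swap-rule (HorizontalVertical.rule m k)
localRule false false k m = conjugate-rule (HorizontalHorizontal.rule (conjugate k) (conjugate m))

-- Chains of partitions

record Letter : Set where
  constructor letter
  field
    kind   : Bool
    weight : Bool → ℕ

open Letter

cellOf : Letter → Letter → WSet
cellOf d u = Cell (same (kind d) (kind u)) (λ c → weight d c + weight u c)

PeakSet ValleySet : Letter → Letter → List ℕ → List ℕ → WSet
PeakSet d u k m = record
  { Raw = List ℕ
  ; Ok = Peak (kind d) (kind u) k m
  ; wt = λ c l → (sum l ∸ sum k) * weight d c + (sum l ∸ sum m) * weight u c }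
ValleySet d u k m = cellOf d u ⊗ record
  { Raw = List ℕ
  ; Ok = Valley (kind d) (kind u) k m
  ; wt = λ c r → (sum k ∸ sum r) * weight u c + (sum m ∸ sum r) * weight d c }

-- The size law gives |l| - |k| = |m| - |r| + e and |l| - |m| = |k| - |r| + e. Each step thus keeps
-- its weight up to `e` boxes, and these weigh `e` times the sum of the two letters.
peak≅valley : ∀ d u k m → PeakSet d u k m ≅ ValleySet d u k m
peak≅valley d u k m = record
  { to = λ l → excess l , down l
  ; from = λ (e , r) → up e r
  ; to-ok = λ p → excess-ok p , down-ok p
  ; from-ok = λ (e , v) → up-ok e v
  ; from-to = up-down
  ; to-from = λ (e , v) → cong₂ _,_ (excess-up e v) (down-up e v)
  ; to-wt = λ {l} p c → weights (excess l) (sum l) (sum k) (sum m) (sum (down l)) (weight d c) (weight u c)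
      (sum-mono (down l) k (strip-≤ (kind u) (Valley.left (down-ok p))))
      (sum-mono (down l) m (strip-≤ (kind d) (Valley.right (down-ok p))))
      (trans (cong (λ x → sum x + sum (down l)) (sym (up-down p))) (up-size (excess-ok p) (down-ok p))) }
  where
  open LocalRule (localRule (kind d) (kind u) k m)
  weights : ∀ e L K M R x y → R ≤ K → R ≤ M → L + R ≡ K + M + e →
            e * (x + y) + ((K ∸ R) * y + (M ∸ R) * x) ≡ (L ∸ K) * x + (L ∸ M) * y
  weights e L K M R x y R≤K R≤M eq = begin
    e * (x + y) + (A * y + B * x)       ≡⟨ solve 5 (λ e x y A B → e :* (x :+ y) :+ (A :* y :+ B :* x) := (B :+ e) :* x :+ (A :+ e) :* y) refl e x y A B ⟩
    (B + e) * x + (A + e) * y           ≡⟨ cong₂ (λ p q → p * x + q * y) L∸K L∸M ⟨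
    (L ∸ K) * x + (L ∸ M) * y           ∎
    where
    open ≡-Reasoning
    open +-*-Solver
    A = K ∸ R
    B = M ∸ R
    K≡ : R + A ≡ K
    K≡ = m+[n∸m]≡n R≤K
    M≡ : R + B ≡ M
    M≡ = m+[n∸m]≡n R≤M
    L≡ : L ≡ R + A + (B + e)
    L≡ = +-cancelʳ-≡ R L _ (trans eq (trans (cong₂ (λ p q → p + q + e) (sym K≡) (sym M≡))
      (solve 4 (λ R A B e → (R :+ A) :+ (R :+ B) :+ e := R :+ A :+ (B :+ e) :+ R) refl R A B e)))
    L∸K : L ∸ K ≡ B + e
    L∸K = trans (cong₂ _∸_ L≡ (sym K≡)) (m+n∸m≡n (R + A) (B + e))
    L∸M : L ∸ M ≡ A + e
    L∸M = trans (cong₂ _∸_ (trans L≡ (solve 4 (λ R A B e → R :+ A :+ (B :+ e) := R :+ B :+ (A :+ e)) refl R A B e)) (sym M≡))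
                (m+n∸m≡n (R + B) (A + e))

-- The list holds the partitions that follow `l`, one per letter; the chain has to end in the empty
-- partition.
Chain : List Letter → List ℕ → List (List ℕ) → Set
Chain []       l []       = l ≡ []
Chain []       l (_ ∷ _)  = ⊥
Chain (u ∷ us) l []       = ⊥
Chain (u ∷ us) l (k ∷ ks) = IsPartition l × Strip (kind u) k l × Chain us k ks

chainWt : List Letter → List ℕ → Bool → List (List ℕ) → ℕ
chainWt []       l c ks       = 0
chainWt (u ∷ us) l c []       = 0
chainWt (u ∷ us) l c (k ∷ ks) = (sum l ∸ sum k) * weight u c + chainWt us k c ks

ChainSet : List Letter → List ℕ → WSet
ChainSet us l = record { Raw = List (List ℕ) ; Ok = Chain us l ; wt = chainWt us l }

[]-isPartition : IsPartition []
[]-isPartition = isPartition [] λ _ → z≤n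

chain-isPartition : ∀ us {l ks} → Chain us l ks → IsPartition l
chain-isPartition []       {ks = []}     refl    = []-isPartition
chain-isPartition (u ∷ us) {ks = k ∷ ks} (p , _) = p

strip-[] : ∀ τ {k} → IsPartition k → Strip τ k [] → k ≡ []
strip-[] τ {k} kP s = partition-ext kP []-isPartition λ i → n≤0⇒n≡0 (strip-≤ τ {k} {[]} s i)

[]-strip : ∀ τ → Strip τ [] []
[]-strip true  _ = z≤n , z≤n
[]-strip false _ = z≤n , z≤n

Cells : List Letter → Letter → WSet
Cells []       d = One
Cells (u ∷ us) d = cellOf d u ⊗ Cells us d

Extended : List Letter → Letter → List ℕ → WSet
Extended us d m = record
  { Raw = List ℕ × List (List ℕ)
  ; Ok = λ (l , ks) → Chain us l ks × IsPartition m × Strip (kind d) m l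
  ; wt = λ c (l , ks) → chainWt us l c ks + (sum l ∸ sum m) * weight d c }

-- The step `d` from `l` to `m` travels along the whole chain. At each letter the local rule
-- replaces the peak by a valley `r` and emits one cell, after which `d` is the step from `k` to `r`
-- and faces the next letter. At the end of the chain everything is empty and the step disappears.
push : ∀ us d m → Extended us d m ≅ Cells us d ⊗ ChainSet us m
push [] d m = record
  { to = λ _ → tt , []
  ; from = λ _ → [] , []
  ; to-ok = λ { {_ , []} (refl , mP , s) → tt , strip-[] (kind d) mP s }
  ; from-ok = λ { {_ , []} (_ , refl) → refl , []-isPartition , []-strip (kind d) }
  ; from-to = λ { {_ , []} (refl , _) → refl }
  ; to-from = λ { {_ , []} _ → refl }
  ; to-wt = λ { {_ , []} (refl , _) c → sym (cong (_* weight d c) (0∸n≡0 (sum m))) } }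
push (u ∷ us) d m = record
  { to = to′ ; from = from′ ; to-ok = λ {x} → to-ok′ x ; from-ok = λ {y} → from-ok′ y
  ; from-to = λ {x} → from-to′ x ; to-from = λ {y} → to-from′ y ; to-wt = λ {x} → to-wt′ x }
  where
  X = Extended (u ∷ us) d m
  Y = Cells (u ∷ us) d ⊗ ChainSet (u ∷ us) m
  module L k = _≅_ (peak≅valley d u m k)
  module I r = _≅_ (push us d r)

  to₁ : List ℕ → List (List ℕ) → ℕ × List ℕ → Raw Y
  to₁ k ks (e , r) = let (cs , ks′) = I.to r (k , ks) in (e , cs) , r ∷ ks′
  from₁ : ℕ → List ℕ → List ℕ × List (List ℕ) → Raw X
  from₁ e r (k , ks) = L.from k (e , r) , k ∷ ks

  to′ : Raw X → Raw Y
  -- No chain along `u ∷ us` has this shape, so the value is arbitrary.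
  to′ (l , [])     = (0 , proj₁ (I.to [] ([] , []))) , []
  to′ (l , k ∷ ks) = to₁ k ks (L.to k l)
  from′ : Raw Y → Raw X
  from′ ((e , cs) , [])     = [] , []
  from′ ((e , cs) , r ∷ ks) = from₁ e r (I.from r (cs , ks))

  peakOk : ∀ {l k ks} → Ok X (l , k ∷ ks) → Peak (kind d) (kind u) m k l
  peakOk ((lP , u-strip , ch) , mP , d-strip) = peak mP (chain-isPartition us ch) lP d-strip u-strip

  valleyOk : ∀ {l k ks} → Ok X (l , k ∷ ks) →
             let (e , r) = L.to k l in Marks (same (kind d) (kind u)) e × Valley (kind d) (kind u) m k r
  valleyOk {k = k} ok = L.to-ok k (peakOk ok)

  extOk : ∀ {l k ks} → Ok X (l , k ∷ ks) → Ok (Extended us d (proj₂ (L.to k l))) (k , ks)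
  extOk {l} {k} ok@((lP , u-strip , ch) , _) = let (_ , v) = valleyOk {l} {k} ok in ch , Valley.partition v , Valley.right v

  to-ok′ : ∀ x → Ok X x → Ok Y (to′ x)
  to-ok′ (l , k ∷ ks) ok@(_ , mP , _) =
    let (e-ok , v) = valleyOk {l} {k} {ks} ok
        (cs-ok , ch) = I.to-ok _ (extOk {l} {k} ok)
    in (e-ok , cs-ok) , mP , Valley.left v , ch

  ext⁻¹ : ∀ {e cs r ks} → Ok Y ((e , cs) , r ∷ ks) → Ok (Extended us d r) (I.from r (cs , ks))
  ext⁻¹ ((_ , cs-ok) , mP , u-strip , ch) = I.from-ok _ (cs-ok , ch)

  valley⁻¹ : ∀ {e cs r ks} → Ok Y ((e , cs) , r ∷ ks) →
             Ok (ValleySet d u m (proj₁ (I.from r (cs , ks)))) (e , r)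
  valley⁻¹ {e} {cs} {r} {ks} ok@((e-ok , _) , mP , u-strip , ch) =
    let (ch′ , rP , d-strip) = ext⁻¹ {e} {cs} ok
    in e-ok , valley mP (chain-isPartition us ch′) rP u-strip d-strip

  from-ok′ : ∀ y → Ok Y y → Ok X (from′ y)
  from-ok′ ((e , cs) , r ∷ ks) ok@(_ , mP , _) =
    let p = L.from-ok _ (valley⁻¹ {e} {cs} ok)
    in (Peak.partition p , Peak.right p , proj₁ (ext⁻¹ {e} {cs} ok)) , mP , Peak.left p

  from-to′ : ∀ x → Ok X x → from′ (to′ x) ≡ x
  from-to′ (l , k ∷ ks) ok =
    trans (cong (from₁ (proj₁ (L.to k l)) (proj₂ (L.to k l))) (I.from-to _ (extOk {l} {k} ok)))
          (cong (_, k ∷ ks) (L.from-to k (peakOk {l} {k} ok)))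

  to-from′ : ∀ y → Ok Y y → to′ (from′ y) ≡ y
  to-from′ ((e , cs) , r ∷ ks) ok =
    trans (cong (to₁ _ _) (L.to-from _ (valley⁻¹ {e} {cs} ok)))
          (cong (λ (cs , ks′) → (e , cs) , r ∷ ks′) (I.to-from r (proj₂ (proj₁ ok) , proj₂ (proj₂ (proj₂ ok)))))

  to-wt′ : ∀ x → Ok X x → ∀ c → wt Y c (to′ x) ≡ wt X c x
  to-wt′ (l , k ∷ ks) ok c = begin
    (E + A) + (B + C)          ≡⟨ solve 4 (λ E A B C → (E :+ A) :+ (B :+ C) := (E :+ B) :+ (A :+ C)) refl E A B C ⟩
    (E + B) + (A + C)          ≡⟨ cong ((E + B) +_) (I.to-wt r (extOk {l} {k} ok) c) ⟩
    (E + B) + (D + F)          ≡⟨ solve 4 (λ E B D F → (E :+ B) :+ (D :+ F) := D :+ (E :+ (B :+ F))) refl E B D F ⟩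
    D + (E + (B + F))          ≡⟨ cong (D +_) (L.to-wt k (peakOk {l} {k} ok) c) ⟩
    D + (G + H)                ≡⟨ solve 3 (λ D G H → D :+ (G :+ H) := (H :+ D) :+ G) refl D G H ⟩
    (H + D) + G                ∎
    where
    open ≡-Reasoning
    open +-*-Solver
    x = proj₁ (L.to k l)
    r = proj₂ (L.to k l)
    E = x * (weight d c + weight u c)
    A = wt (Cells us d) c (proj₁ (I.to r (k , ks)))
    B = (sum m ∸ sum r) * weight u c
    C = chainWt us r c (proj₂ (I.to r (k , ks)))
    D = chainWt us k c ks
    F = (sum k ∸ sum r) * weight d c
    G = (sum l ∸ sum m) * weight d c
    H = (sum l ∸ sum k) * weight u c

TwoChains : List Letter → List Letter → WSet
TwoChains us ds = record
  { Raw = List ℕ × List (List ℕ) × List (List ℕ)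
  ; Ok = λ (l , ks , ms) → Chain us l ks × Chain ds l ms
  ; wt = λ c (l , ks , ms) → chainWt us l c ks + chainWt ds l c ms }

Grid : List Letter → List Letter → WSet
Grid us []       = One
Grid us (d ∷ ds) = Cells us d ⊗ Grid us ds

emptyChain : List Letter → List (List ℕ)
emptyChain []       = []
emptyChain (u ∷ us) = [] ∷ emptyChain us

emptyChain-ok : ∀ us → Chain us [] (emptyChain us)
emptyChain-ok []       = refl
emptyChain-ok (u ∷ us) = []-isPartition , []-strip (kind u) , emptyChain-ok us

emptyChain-unique : ∀ us {ks} → Chain us [] ks → ks ≡ emptyChain us
emptyChain-unique []       {[]}     _ = refl
emptyChain-unique (u ∷ us) {k ∷ ks} (_ , s , ch) with strip-[] (kind u) (chain-isPartition us ch) s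
... | refl = cong ([] ∷_) (emptyChain-unique us ch)

emptyChain-wt : ∀ us c → chainWt us [] c (emptyChain us) ≡ 0
emptyChain-wt []       c = refl
emptyChain-wt (u ∷ us) c = emptyChain-wt us c

-- The right steps are pushed through the left chain in turn, each leaving one line of cells. When
-- none remains, the common partition is empty and therefore the whole left chain is.
twoChains≅grid : ∀ us ds → TwoChains us ds ≅ Grid us ds
twoChains≅grid us [] = record
  { to = λ _ → tt
  ; from = λ _ → [] , emptyChain us , []
  ; to-ok = λ _ → tt
  ; from-ok = λ _ → emptyChain-ok us , refl
  ; from-to = λ { {_ , _ , []} (ch , refl) → cong (λ ks → [] , ks , []) (sym (emptyChain-unique us ch)) }
  ; to-from = λ _ → refl
  ; to-wt = λ { {_ , ks , []} (ch , refl) c → sym (trans (+-identityʳ _)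
      (trans (cong (chainWt us [] c) (emptyChain-unique us ch)) (emptyChain-wt us c))) } }
twoChains≅grid us (d ∷ ds) = ≅-trans split (⊗-cong ≅-refl (twoChains≅grid us ds))
  where
  module I m = _≅_ (push us d m)
  ext : ∀ {l ks m ms} → Ok (TwoChains us (d ∷ ds)) (l , ks , m ∷ ms) → Ok (Extended us d m) (l , ks)
  ext (ch , lP , s , ch′) = ch , chain-isPartition ds ch′ , s
  split : TwoChains us (d ∷ ds) ≅ Cells us d ⊗ TwoChains us ds
  split = record
    { to = λ { (l , ks , []) → proj₁ (I.to [] ([] , [])) , [] , [] , []
             ; (l , ks , m ∷ ms) → let (cs , ks′) = I.to m (l , ks) in cs , m , ks′ , ms }
    ; from = λ { (cs , m , ks , ms) → let (l , ks′) = I.from m (cs , ks) in l , ks′ , m ∷ ms }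
    ; to-ok = λ { {l , ks , m ∷ ms} ok → let (cs-ok , ch) = I.to-ok m (ext ok) in cs-ok , ch , proj₂ (proj₂ (proj₂ ok)) }
    ; from-ok = λ { {cs , m , ks , ms} (cs-ok , ch , ch′) → let (ch″ , mP , s) = I.from-ok m (cs-ok , ch) in
        ch″ , chain-isPartition us ch″ , s , ch′ }
    ; from-to = λ { {l , ks , m ∷ ms} ok → cong (λ (l , ks′) → l , ks′ , m ∷ ms) (I.from-to m (ext ok)) }
    ; to-from = λ { {cs , m , ks , ms} (cs-ok , ch , ch′) → cong (λ (cs , ks′) → cs , m , ks′ , ms) (I.to-from m (cs-ok , ch)) }
    ; to-wt = λ { {l , ks , m ∷ ms} ok c → weights
        (wt (Cells us d) c (proj₁ (I.to m (l , ks)))) (chainWt us m c (proj₂ (I.to m (l , ks))))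
        (chainWt us l c ks) ((sum l ∸ sum m) * weight d c) (chainWt ds m c ms) (I.to-wt m (ext ok) c) } }
    where
    weights : ∀ A B C D E → A + B ≡ C + D → A + (B + E) ≡ C + (D + E)
    weights A B C D E eq = trans (sym (+-assoc A B E)) (trans (cong (_+ E) eq) (+-assoc C D E))

-- The two sides of the room: letters, series and weights

step : Bool → ℕ → Letter
step σ t = letter (stepType σ t) (stepWt σ t)

side : Bool → ℕ → List Letter
side σ L = applyUpTo (step σ) L

-- The reindexing `f` makes the statement general enough for an induction that removes the head of
-- `applyUpTo`.
cells-hasSeries : ∀ t n (f : ℕ → ℕ) → Cells (applyUpTo (step false ∘ f) n) (step true t) hasSeries ∏ n (gridSeries t ∘ f)
cells-hasSeries t zero    f = One-hasSeries
cells-hasSeries t (suc n) f = ⊗-hasSeries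
  (cell-hasSeries (gridKind t (f 0)) (gridWt t (f 0)) (subst (0 <_) (sym (gridWt-total t (f 0))) z<s))
  (cells-hasSeries t n (f ∘ suc))

grid-hasSeries : ∀ L n (f : ℕ → ℕ) →
  Grid (side false L) (applyUpTo (step true ∘ f) n) hasSeries ∏ n (λ t → ∏ L (gridSeries (f t)))
grid-hasSeries L zero    f = One-hasSeries
grid-hasSeries L (suc n) f = ⊗-hasSeries (cells-hasSeries (f 0) L id) (grid-hasSeries L n (f ∘ suc))

twoChains-hasSeries : ∀ L → TwoChains (side false L) (side true L) hasSeries ∏ L (λ t → ∏ L (gridSeries t))
twoChains-hasSeries L = hasSeries-≅ (twoChains≅grid (side false L) (side true L)) (grid-hasSeries L L id)

slicesWt : (ℕ → ℕ) → List (List ℕ) → ℕ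
slicesWt h []       = 0
slicesWt h (k ∷ ks) = sum k * h 0 + slicesWt (h ∘ suc) ks

-- Summation by parts.
chainWt-slices : ∀ f h c n → (∀ t → weight (f (suc t)) c ≡ weight (f t) c + h t) →
  ∀ {l ks} → Chain (applyUpTo f n) l ks → chainWt (applyUpTo f n) l c ks ≡ sum l * weight (f 0) c + slicesWt h ks
chainWt-slices f h c zero    rec {ks = []} refl = refl
chainWt-slices f h c (suc n) rec {l} {k ∷ ks} (_ , s , ch) = begin
  (sum l ∸ sum k) * x + chainWt (applyUpTo (f ∘ suc) n) k c ks
    ≡⟨ cong ((sum l ∸ sum k) * x +_) (chainWt-slices (f ∘ suc) (h ∘ suc) c n (rec ∘ suc) ch) ⟩
  (sum l ∸ sum k) * x + (sum k * weight (f 1) c + S)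
    ≡⟨ cong (λ w → (sum l ∸ sum k) * x + (sum k * w + S)) (rec 0) ⟩
  (sum l ∸ sum k) * x + (sum k * (x + h 0) + S)
    ≡⟨ solve 5 (λ A B x h S → A :* x :+ (B :* (x :+ h) :+ S) := (A :+ B) :* x :+ (B :* h :+ S)) refl (sum l ∸ sum k) (sum k) x (h 0) S ⟩
  (sum l ∸ sum k + sum k) * x + (sum k * h 0 + S)
    ≡⟨ cong (λ y → y * x + (sum k * h 0 + S)) (m∸n+n≡m (sum-mono k l (strip-≤ (kind (f 0)) s))) ⟩
  sum l * x + (sum k * h 0 + S) ∎
  where
  open ≡-Reasoning
  open +-*-Solver
  x = weight (f 0) c
  S = slicesWt (h ∘ suc) ks

-- Summation by parts leaves |l| times the first weight of each side: 0 on the left and the colour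
-- of slice 0 on the right, so the shared slice is counted once.
twoChains-wt : ∀ L c {x} → Ok (TwoChains (side false L) (side true L)) x → let (l , ks , ms) = x in
  wt (TwoChains (side false L) (side true L)) c x ≡ slicesWt (hue c ∘ suc) ks + slicesWt (hue c) (l ∷ ms)
twoChains-wt L c {l , ks , ms} (chˡ , chʳ) = cong₂ _+_
  (trans (chainWt-slices (step false) (hue c ∘ suc) c L (λ _ → refl) chˡ) (cong (_+ slicesWt (hue c ∘ suc) ks) (*-zeroʳ (sum l))))
  (chainWt-slices (step true) (hue c ∘ suc) c L (λ _ → refl) chʳ)

-- Finite sets of bricks as sorted lists

T-does⁻ : ∀ {A : Set} (d : Dec A) → T (does d) → A
T-does⁻ (yes a) _ = a

T-does⁺ : ∀ {A : Set} (d : Dec A) → A → T (does d)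
T-does⁺ (yes _) _ = tt
T-does⁺ (no ¬a) a = contradiction a ¬a

T-not⁺ : ∀ {b} → ¬ T b → T (not b)
T-not⁺ {true}  ¬t = contradiction tt ¬t
T-not⁺ {false} _  = tt

T-not⁻ : ∀ {b} → T (not b) → ¬ T b
T-not⁻ {false} _ ()

∧⁻ : ∀ {x y} → T (x ∧ y) → T x × T y
∧⁻ = Equivalence.to T-∧

∧⁺ : ∀ {x y} → T x → T y → T (x ∧ y)
∧⁺ p q = Equivalence.from T-∧ (p , q)

∨⁻ : ∀ {x y} → T (x ∨ y) → T x ⊎ T y
∨⁻ = Equivalence.to T-∨

∨⁺ : ∀ {x y} → T x ⊎ T y → T (x ∨ y)
∨⁺ = Equivalence.from T-∨

-- The order of `_<ᵇ_`, assembled from library orders so that the library's sorting applies to it.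
brickOrder : StrictTotalOrder 0ℓ 0ℓ 0ℓ
brickOrder = ×-strictTotalOrder <-strictTotalOrder (×-strictTotalOrder ℤ.<-strictTotalOrder ℤ.<-strictTotalOrder)

open StrictTotalOrder brickOrder using () renaming (_<_ to _≺_; irrefl to ≺-irrefl; trans to ≺-trans; asym to ≺-asym)

≈⇒≡ : ∀ {b c} → StrictTotalOrder._≈_ brickOrder b c → b ≡ c
≈⇒≡ (refl , refl , refl) = refl

≡⇒≈ : ∀ {b c} → b ≡ c → StrictTotalOrder._≈_ brickOrder b c
≡⇒≈ refl = refl , refl , refl

<ℤ⁻ : ∀ {x y} → T (x <ℤ y) → x ℤ.< y
<ℤ⁻ {x} {y} t = let (le , ne) = ∧⁻ {x ℤ.≤ᵇ y} t in
  ℤ.≤∧≢⇒< (ℤ.≤ᵇ⇒≤ le) (T-not⁻ ne ∘ T-does⁺ (x ℤ.≟ y))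

<ℤ⁺ : ∀ {x y} → x ℤ.< y → T (x <ℤ y)
<ℤ⁺ {x} {y} lt = ∧⁺ (ℤ.≤⇒≤ᵇ (ℤ.<⇒≤ lt)) (T-not⁺ (ℤ.<⇒≢ lt ∘ T-does⁻ (x ℤ.≟ y)))

<ᵇ⇒≺ : ∀ {b c} → T (b <ᵇ c) → b ≺ c
<ᵇ⇒≺ {k , x , y} {l , u , v} t with ∨⁻ {k ℕ.<ᵇ l} t
... | inj₁ k<l = inj₁ (<ᵇ⇒< k l k<l)
... | inj₂ t′ with ∧⁻ {does (k ℕ.≟ l)} t′
...   | k≡l , t″ with ∨⁻ {x <ℤ u} t″
...     | inj₁ x<u = inj₂ (T-does⁻ (k ℕ.≟ l) k≡l , inj₁ (<ℤ⁻ x<u))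
...     | inj₂ t‴ = let (x≡u , y<v) = ∧⁻ {does (x ℤ.≟ u)} t‴ in
          inj₂ (T-does⁻ (k ℕ.≟ l) k≡l , inj₂ (T-does⁻ (x ℤ.≟ u) x≡u , <ℤ⁻ y<v))

≺⇒<ᵇ : ∀ {b c} → b ≺ c → T (b <ᵇ c)
≺⇒<ᵇ {k , x , y} {l , u , v} (inj₁ k<l) = ∨⁺ (inj₁ (<⇒<ᵇ k<l))
≺⇒<ᵇ {k , x , y} {l , u , v} (inj₂ (k≡l , inj₁ x<u)) =
  ∨⁺ {k ℕ.<ᵇ l} (inj₂ (∧⁺ (T-does⁺ (k ℕ.≟ l) k≡l) (∨⁺ (inj₁ (<ℤ⁺ x<u)))))
≺⇒<ᵇ {k , x , y} {l , u , v} (inj₂ (k≡l , inj₂ (x≡u , y<v))) =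
  ∨⁺ {k ℕ.<ᵇ l} (inj₂ (∧⁺ (T-does⁺ (k ℕ.≟ l) k≡l) (∨⁺ {x <ℤ u} (inj₂ (∧⁺ (T-does⁺ (x ℤ.≟ u) x≡u) (<ℤ⁺ y<v))))))

strictlySorted⁻ : ∀ π → T (strictlySorted π) → AllPairs _≺_ π
strictlySorted⁻ π = Linked⇒AllPairs ≺-trans ∘ linked π
  where
  linked : ∀ π → T (strictlySorted π) → Linked _≺_ π
  linked []          _ = []
  linked (b ∷ [])    _ = [-]
  linked (b ∷ c ∷ π) t = let (b<c , t′) = ∧⁻ {b <ᵇ c} t in <ᵇ⇒≺ b<c ∷ linked (c ∷ π) t′

linked⇒strictlySorted : ∀ {π} → Linked _≺_ π → T (strictlySorted π)
linked⇒strictlySorted []                     = tt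
linked⇒strictlySorted [-]                    = tt
linked⇒strictlySorted (_∷_ {x} {y} b≺c rest) = ∧⁺ (≺⇒<ᵇ {x} {y} b≺c) (linked⇒strictlySorted rest)

-- Both heads are least elements of the same set; if they differed, each would precede the other.
sorted-ext : ∀ {π ρ} → AllPairs _≺_ π → AllPairs _≺_ ρ →
             (∀ {b} → b ∈ π → b ∈ ρ) → (∀ {b} → b ∈ ρ → b ∈ π) → π ≡ ρ
sorted-ext {[]} {[]} _ _ f g = refl
sorted-ext {[]} {c ∷ ρ} _ _ f g with g (here refl)
... | ()
sorted-ext {b ∷ π} {[]} _ _ f g with f (here refl)
... | ()
sorted-ext {b ∷ π} {c ∷ ρ} (b≺ ∷ ps) (c≺ ∷ qs) f g = cong₂ _∷_ b≡c (sorted-ext ps qs f′ g′)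
  where
  b≡c : b ≡ c
  b≡c with f (here refl) | g (here refl)
  ... | here eq  | _         = eq
  ... | there _  | here eq   = sym eq
  ... | there b∈ | there c∈  = contradiction (All.lookup c≺ b∈) (≺-asym (All.lookup b≺ c∈))
  f′ : ∀ {x} → x ∈ π → x ∈ ρ
  f′ x∈ with f (there x∈)
  ... | there x∈ρ = x∈ρ
  ... | here x≡c  = contradiction (All.lookup b≺ x∈) (≺-irrefl (≡⇒≈ (trans b≡c (sym x≡c))))
  g′ : ∀ {x} → x ∈ ρ → x ∈ π
  g′ x∈ with g (there x∈)
  ... | there x∈π = x∈π
  ... | here x≡b  = contradiction (All.lookup c≺ x∈) (≺-irrefl (≡⇒≈ (trans (sym b≡c) (sym x≡b))))

open Data.List.Sort (Relation.Binary.Properties.StrictTotalOrder.decTotalOrder brickOrder) using (sort; sort-↭; sort-↗)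

sort-strict : ∀ π → Unique π → Linked _≺_ (sort π)
sort-strict π u = strict (sort-↗ π) (SetoidPermutation.Unique-resp-↭ (≡.setoid Brick) (↭⇒↭ₛ (↭-sym (sort-↭ π))) u)
  where
  strict : ∀ {ρ} → Linked (λ b c → b ≺ c ⊎ StrictTotalOrder._≈_ brickOrder b c) ρ → Unique ρ → Linked _≺_ ρ
  strict []                  _ = []
  strict [-]                 _ = [-]
  strict (inj₁ b≺c ∷ rest)   (_ ∷ u) = b≺c ∷ strict rest u
  strict (inj₂ b≈c ∷ rest)   ((b≢c ∷ _) ∷ _) = contradiction (≈⇒≡ b≈c) b≢c

∈ᵇ⁺ : ∀ {b π} → b ∈ π → T (b ∈ᵇ π)
∈ᵇ⁺ {b} b∈ = any⁺ (b ==ᵇ_) (Any.map (λ { refl → refl-==ᵇ b }) b∈)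
  where
  refl-==ᵇ : ∀ b → T (b ==ᵇ b)
  refl-==ᵇ (k , x , y) = ∧⁺ {does (k ℕ.≟ k)} (T-does⁺ (k ℕ.≟ k) refl)
    (∧⁺ {does (x ℤ.≟ x)} (T-does⁺ (x ℤ.≟ x) refl) (T-does⁺ (y ℤ.≟ y) refl))

∈ᵇ⁻ : ∀ {b π} → T (b ∈ᵇ π) → b ∈ π
∈ᵇ⁻ {b} {π} t = Any.map (λ {c} → ==ᵇ⇒≡ b c) (any⁻ (b ==ᵇ_) π t)
  where
  ==ᵇ⇒≡ : ∀ b c → T (b ==ᵇ c) → b ≡ c
  ==ᵇ⇒≡ (k , x , y) (l , u , v) t =
    let (p , t′) = ∧⁻ {does (k ℕ.≟ l)} t
        (q , r) = ∧⁻ {does (x ℤ.≟ u)} t′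
    in cong₂ _,_ (T-does⁻ (k ℕ.≟ l) p) (cong₂ _,_ (T-does⁻ (x ℤ.≟ u) q) (T-does⁻ (y ℤ.≟ v) r))

tint : Bool → Brick → Bool
tint true  b = isEven (proj₁ b)
tint false b = not (isEven (proj₁ b))

module _ {A : Set} where

  count : (A → Bool) → List A → ℕ
  count p xs = length (filterᵇ p xs)

  count-∷ : ∀ p x xs → count p (x ∷ xs) ≡ [ p x ] + count p xs
  count-∷ p x xs with p x
  ... | true  = refl
  ... | false = refl

  count-++ : ∀ p xs ys → count p (xs ++ ys) ≡ count p xs + count p ys
  count-++ p []       ys = refl
  count-++ p (x ∷ xs) ys with p x
  ... | true  = cong suc (count-++ p xs ys)
  ... | false = count-++ p xs ys

  count-↭ : ∀ p {xs ys} → xs ↭ ys → count p xs ≡ count p ys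
  count-↭ p ↭.refl = refl
  count-↭ p (↭.prep {xs} {ys} x q) =
    trans (count-∷ p x xs) (trans (cong ([ p x ] +_) (count-↭ p q)) (sym (count-∷ p x ys)))
  count-↭ p (↭.swap {xs} {ys} x y q) = begin
    count p (x ∷ y ∷ xs)               ≡⟨ count-∷₂ x y xs ⟩
    [ p x ] + ([ p y ] + count p xs)   ≡⟨ cong (λ n → [ p x ] + ([ p y ] + n)) (count-↭ p q) ⟩
    [ p x ] + ([ p y ] + count p ys)   ≡⟨ x∙yz≈y∙xz [ p x ] [ p y ] (count p ys) ⟩
    [ p y ] + ([ p x ] + count p ys)   ≡⟨ count-∷₂ y x ys ⟨
    count p (y ∷ x ∷ ys)               ∎
    where
    open ≡.≡-Reasoning
    open Algebra.Properties.CommutativeSemigroup +-commutativeSemigroup using (x∙yz≈y∙xz)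
    count-∷₂ : ∀ x y zs → count p (x ∷ y ∷ zs) ≡ [ p x ] + ([ p y ] + count p zs)
    count-∷₂ x y zs = trans (count-∷ p x (y ∷ zs)) (cong ([ p x ] +_) (count-∷ p y zs))
  count-↭ p (↭.trans q r) = trans (count-↭ p q) (count-↭ p r)

  count-applyUpTo : ∀ p f n h → (∀ j → [ p (f j) ] ≡ h) → count p (applyUpTo f n) ≡ n * h
  count-applyUpTo p f zero    h eq = refl
  count-applyUpTo p f (suc n) h eq = trans (count-∷ p (f 0) _) (cong₂ _+_ (eq 0) (count-applyUpTo p (f ∘ suc) n h (eq ∘ suc)))

dark+light≡length : ∀ π → darkCount π + lightCount π ≡ length π
dark+light≡length [] = refl
dark+light≡length (b ∷ π) with isEven (proj₁ b)
... | true  = cong suc (dark+light≡length π)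
... | false = trans (+-suc (darkCount π) (lightCount π)) (cong suc (dark+light≡length π))

module _ {A B : Set} where

  flatten : (ℕ → A → List B) → List A → List B
  flatten F []       = []
  flatten F (x ∷ xs) = F 0 x ++ flatten (F ∘ suc) xs

  ∈-flatten⁻ : ∀ F d xs {b} → b ∈ flatten F xs → ∃ λ t → b ∈ F t (nth d xs t)
  ∈-flatten⁻ F d (x ∷ xs) b∈ with ∈-++⁻ (F 0 x) b∈
  ... | inj₁ b∈₀ = 0 , b∈₀
  ... | inj₂ b∈₊ = let (t , p) = ∈-flatten⁻ (F ∘ suc) d xs b∈₊ in suc t , p

  ∈-flatten⁺ : ∀ F d xs {b} t → (∀ t → F t d ≡ []) → b ∈ F t (nth d xs t) → b ∈ flatten F xs
  ∈-flatten⁺ F d []       {b} t eq b∈ with subst (b ∈_) (eq t) b∈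
  ... | ()
  ∈-flatten⁺ F d (x ∷ xs) zero    eq b∈ = ∈-++⁺ˡ b∈
  ∈-flatten⁺ F d (x ∷ xs) (suc t) eq b∈ = ∈-++⁺ʳ (F 0 x) (∈-flatten⁺ (F ∘ suc) d xs t (eq ∘ suc) b∈)

  flatten-unique : ∀ F → A → (∀ t x → Unique (F t x)) → (∀ {b s t x y} → b ∈ F s x → b ∈ F t y → s ≡ t) →
                   ∀ xs → Unique (flatten F xs)
  flatten-unique F d u inj []       = []
  flatten-unique F d u inj (x ∷ xs) = ++⁺ (u 0 x)
    (flatten-unique (F ∘ suc) d (u ∘ suc) (λ p q → suc-injective (inj p q)) xs)
    λ (p , q) → contradiction (inj p (proj₂ (∈-flatten⁻ (F ∘ suc) d xs q))) λ ()

rows : (ℕ → ℕ → Brick) → List ℕ → List Brick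
rows g = flatten λ i a → applyUpTo (g i) a

slices : (ℕ → ℕ → ℕ → Brick) → List (List ℕ) → List Brick
slices G = flatten λ t l → rows (G t) l

∈-rows⁻ : ∀ g l {b} → b ∈ rows g l → ∃ λ i → ∃ λ j → j < l ‼ i × b ≡ g i j
∈-rows⁻ g l b∈ = let (i , p) = ∈-flatten⁻ _ 0 l b∈ in i , ∈-applyUpTo⁻ (g i) p

∈-rows⁺ : ∀ g l i j → j < l ‼ i → g i j ∈ rows g l
∈-rows⁺ g l i j j< = ∈-flatten⁺ _ 0 l i (λ _ → refl) (∈-applyUpTo⁺ (g i) j<)

∈-slices⁻ : ∀ G ks {b} → b ∈ slices G ks → ∃ λ t → ∃ λ i → ∃ λ j → j < nth [] ks t ‼ i × b ≡ G t i j
∈-slices⁻ G ks b∈ = let (t , p) = ∈-flatten⁻ _ [] ks b∈ in t , ∈-rows⁻ (G t) (nth [] ks t) p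

∈-slices⁺ : ∀ G ks t i j → j < nth [] ks t ‼ i → G t i j ∈ slices G ks
∈-slices⁺ G ks t i j j< = ∈-flatten⁺ _ [] ks t (λ _ → refl) (∈-rows⁺ (G t) (nth [] ks t) i j j<)

slices-unique : ∀ G → (∀ {t i j t′ i′ j′} → G t i j ≡ G t′ i′ j′ → t ≡ t′ × i ≡ i′ × j ≡ j′) →
                ∀ ks → Unique (slices G ks)
slices-unique G inj = flatten-unique _ [] rows-unique λ {_} {s} {t} {k} {l} → disjoint {s = s} {t} {k} {l}
  where
  rows-unique : ∀ t l → Unique (rows (G t) l)
  rows-unique t = flatten-unique _ 0
    (λ i a → applyUpTo⁺₁ (G t i) a λ j<j′ _ eq → <⇒≢ j<j′ (proj₂ (proj₂ (inj eq))))
    λ {_} {i} {i′} p q → let (_ , _ , eq) = ∈-applyUpTo⁻ (G t i) p ; (_ , _ , eq′) = ∈-applyUpTo⁻ (G t i′) q in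
      proj₁ (proj₂ (inj (trans (sym eq) eq′)))
  disjoint : ∀ {b s t k l} → b ∈ rows (G s) k → b ∈ rows (G t) l → s ≡ t
  disjoint {s = s} {t} {k} {l} p q =
    let (_ , _ , _ , eq) = ∈-rows⁻ (G s) k p ; (_ , _ , _ , eq′) = ∈-rows⁻ (G t) l q in
    proj₁ (inj (trans (sym eq) eq′))

count-rows : ∀ p g l h → (∀ i j → [ p (g i j) ] ≡ h) → count p (rows g l) ≡ sum l * h
count-rows p g []      h eq = refl
count-rows p g (a ∷ l) h eq = trans (count-++ p (applyUpTo (g 0) a) _)
  (trans (cong₂ _+_ (count-applyUpTo p (g 0) a h (eq 0)) (count-rows p (g ∘ suc) l h (eq ∘ suc)))
         (sym (*-distribʳ-+ h a (sum l))))

-- Pigeonhole by induction: discarding the bricks of layer `n` shortens the list and keeps a brick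
-- in every lower-numbered layer.
layers≤length : ∀ n (π : List Brick) → (∀ r → r < n → ∃ λ b → b ∈ π × proj₁ b ≡ r) → n ≤ length π
layers≤length zero    π h = z≤n
layers≤length (suc n) π h = ≤-trans (s≤s (layers≤length n (filter keep? π) h′)) (filter-notAll keep? π drop)
  where
  keep? : ∀ (b : Brick) → Dec (proj₁ b ≢ n)
  keep? b = ¬? (proj₁ b ℕ.≟ n)
  h′ : ∀ r → r < n → ∃ λ b → b ∈ filter keep? π × proj₁ b ≡ r
  h′ r r<n = let (b , b∈ , eq) = h r (m<n⇒m<1+n r<n) in
    b , ∈-filter⁺ keep? b∈ (λ b≡n → <⇒≢ r<n (trans (sym eq) b≡n)) , eq
  drop : Any (λ b → ¬ (proj₁ b ≢ n)) π
  drop = let (b , b∈ , eq) = h n ≤-refl in Any.map (λ { refl b≢n → b≢n eq }) b∈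

-- The room in slice coordinates

open import Data.Integer using (ℤ; +_; -_)

shift : Bool → Pt → Pt → Pt
shift true  p v = p +ᵖ v
shift false p v = p -ᵖ v

unshift : ∀ d p v → shift (not d) (shift d p v) v ≡ p
unshift true  (x , y) (u , v) = cong₂ _,_ (eq x u) (eq y v)
  where
  eq : ∀ x u → x ℤ.+ u ℤ.- u ≡ x
  eq = solve-∀
unshift false (x , y) (u , v) = cong₂ _,_ (eq x u) (eq y v)
  where
  eq : ∀ x u → x ℤ.- u ℤ.+ u ≡ x
  eq = solve-∀

-- A brick rests on its two children; x + y rises by one towards `child true` and drops by one
-- towards `child false`.
child : Bool → Brick → Brick
child d (k , p) = suc k , shift d p (e k)

-- The least layer of slice x + y = ± t has a single brick, at position ± base t.
base : Bool → ℕ → Pt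
base σ zero    = + 0 , + 0
base σ (suc t) = shift σ (base σ t) (e t)

-- Brick (i , j) of the Young diagram of slice x + y = + t (σ = true) or - t (σ = false).
brick : Bool → ℕ → ℕ → ℕ → Brick
brick σ t i j = double (i + j) + t , base σ t +ᵖ (+ i ℤ.- + j , + j ℤ.- + i)

bumped : Bool → Bool → ℕ → ℕ → ℕ → Brick
bumped τ σ t i j = if τ then brick σ t (suc i) j else brick σ t i (suc j)

-- The brick of slice t below brick (i , j) of slice t + 1.
inner : Bool → ℕ → ℕ → ℕ → Brick
inner σ t = bumped (stepType σ t) σ t

isEven-double+ : ∀ n t → isEven (double n + t) ≡ isEven t
isEven-double+ zero    t = refl
isEven-double+ (suc n) t = isEven-double+ n t

isEven-suc : ∀ t → isEven (suc t) ≡ not (isEven t)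
isEven-suc zero          = refl
isEven-suc (suc zero)    = refl
isEven-suc (suc (suc t)) = isEven-suc t

e-double+ : ∀ n t → e (double n + t) ≡ e t
e-double+ n t = cong (λ b → if b then (+ 1 , + 0) else (+ 0 , + 1)) (isEven-double+ n t)

outward : ∀ σ t i j → brick σ (suc t) i j ≡ child σ (brick σ t i j)
outward σ t i j = cong₂ _,_ (+-suc (double (i + j)) t)
  (trans (move σ (base σ t) (e t) _) (cong (shift σ _) (sym (e-double+ (i + j) t))))
  where
  move : ∀ σ p v w → shift σ p v +ᵖ w ≡ shift σ (p +ᵖ w) v
  move true  (x , y) (u , v) (w , z) = cong₂ _,_ (eq x u w) (eq y v z)
    where
    eq : ∀ x u w → x ℤ.+ u ℤ.+ w ≡ x ℤ.+ w ℤ.+ u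
    eq = solve-∀
  move false (x , y) (u , v) (w , z) = cong₂ _,_ (eq x u w) (eq y v z)
    where
    eq : ∀ x u w → x ℤ.- u ℤ.+ w ≡ x ℤ.+ w ℤ.- u
    eq = solve-∀

-- One step out and one step back along the other axis change the position by (1, -1) or (-1, 1),
-- hence raise `i` or `j`. Which one depends on the side and the parity of `t`, and this is where
-- `stepType` comes from.
inward : ∀ σ t i j → inner σ t i j ≡ child (not σ) (brick σ (suc t) i j)
inward σ t i j = trans (inner-eq σ t) (cong (_ ,_) (trans (position σ t)
  (cong (shift (not σ) _) (sym (e-double+ (i + j) (suc t))))))
  where
  bump : Bool → Pt
  bump true  = + suc i ℤ.- + j , + j ℤ.- + suc i
  bump false = + i ℤ.- + suc j , + suc j ℤ.- + i
  inner-eq : ∀ σ t → inner σ t i j ≡ (suc (double (i + j) + suc t) , base σ t +ᵖ bump (stepType σ t))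
  inner-eq σ t with stepType σ t
  ... | true  = cong (_, base σ t +ᵖ bump true) (cong suc (sym (+-suc (double (i + j)) t)))
  ... | false = cong (_, base σ t +ᵖ bump false) (trans (cong (λ n → double n + t) (+-suc i j)) (cong suc (sym (+-suc (double (i + j)) t))))
  up : ∀ x i j → x ℤ.+ (+ 1 ℤ.+ i ℤ.- j) ≡ x ℤ.+ + 1 ℤ.+ (i ℤ.- j) ℤ.- + 0
  up = solve-∀
  up′ : ∀ x i j → x ℤ.+ (j ℤ.- (+ 1 ℤ.+ i)) ≡ x ℤ.+ + 0 ℤ.+ (j ℤ.- i) ℤ.- + 1
  up′ = solve-∀
  down : ∀ x i j → x ℤ.+ (i ℤ.- (+ 1 ℤ.+ j)) ≡ x ℤ.- + 1 ℤ.+ (i ℤ.- j) ℤ.+ + 0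
  down = solve-∀
  down′ : ∀ x i j → x ℤ.+ (+ 1 ℤ.+ j ℤ.- i) ≡ x ℤ.- + 0 ℤ.+ (j ℤ.- i) ℤ.+ + 1
  down′ = solve-∀
  position : ∀ σ t → base σ t +ᵖ bump (stepType σ t) ≡
             shift (not σ) (shift σ (base σ t) (e t) +ᵖ (+ i ℤ.- + j , + j ℤ.- + i)) (e (suc t))
  position true  t rewrite isEven-suc t with base true t | isEven t
  ... | (x , y) | true  = cong₂ _,_ (up x (+ i) (+ j)) (up′ y (+ i) (+ j))
  ... | (x , y) | false = cong₂ _,_ (up′ x (+ j) (+ i)) (up y (+ j) (+ i))
  position false t rewrite isEven-suc t with base false t | isEven t
  ... | (x , y) | true  = cong₂ _,_ (down x (+ i) (+ j)) (down′ y (+ i) (+ j))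
  ... | (x , y) | false = cong₂ _,_ (down′ x (+ j) (+ i)) (down y (+ j) (+ i))

InRoom : Brick → Set
InRoom b = T (inRoom 1 b)

child-inRoom : ∀ d b → InRoom b → InRoom (child d b)
child-inRoom true  (k , p) r = ∨⁺ {inB 1 k ((p +ᵖ e k) -ᵖ e k)} (inj₁ (subst (T ∘ inB 1 k) (sym (unshift true p (e k))) r))
child-inRoom false (k , p) r = ∨⁺ {inB 1 k ((p -ᵖ e k) -ᵖ e k)} (inj₂ (subst (T ∘ inB 1 k) (sym (unshift false p (e k))) r))

-- Outward steps reach slice `suc t` from slice `t`. Within slice 0, a row index is raised by a
-- detour through slice 1 and a column index by one through slice -1, as the two central strips have
-- different kinds.
brick-inRoom : ∀ σ t i j → InRoom (brick σ t i j)
brick-inRoom σ (suc t) i j = subst InRoom (sym (outward σ t i j)) (child-inRoom σ (brick σ t i j) (brick-inRoom σ t i j))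
brick-inRoom σ zero zero zero = tt
brick-inRoom σ zero (suc i) j = subst InRoom (sym (inward true 0 i j)) (child-inRoom false (brick true 1 i j) (brick-inRoom true 1 i j))
brick-inRoom σ zero zero (suc j) = subst InRoom (sym (inward false 0 0 j)) (child-inRoom true (brick false 1 0 j) (brick-inRoom false 1 0 j))

-- Bricks of slice 0 have coordinates on both sides: `brick true 0 i j` and `brick false 0 i j`
-- coincide.
data IsBrick : Brick → Set where
  isBrick : ∀ σ t i j → IsBrick (brick σ t i j)

inner-isBrick : ∀ σ t i j → IsBrick (inner σ t i j)
inner-isBrick σ t i j with stepType σ t
... | true  = isBrick σ t (suc i) j
... | false = isBrick σ t i (suc j)

-- Tells whether direction `d` leads away from the centre or back towards it. From slice 0 both
-- directions lead away.
data Child (d : Bool) : Brick → Set where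
  out : ∀ t i j → Child d (brick d t i j)
  inn : ∀ t i j → Child d (brick (not d) (suc t) i j)

child-view : ∀ d {b} → IsBrick b → Child d b
child-view true  (isBrick true  t i j)       = out t i j
child-view true  (isBrick false zero i j)    = out 0 i j
child-view true  (isBrick false (suc t) i j) = inn t i j
child-view false (isBrick false t i j)       = out t i j
child-view false (isBrick true zero i j)     = out 0 i j
child-view false (isBrick true (suc t) i j)  = inn t i j

inward′ : ∀ d t i j → inner (not d) t i j ≡ child d (brick (not d) (suc t) i j)
inward′ true  = inward false
inward′ false = inward true

child-isBrick : ∀ d {b} → IsBrick b → IsBrick (child d b)
child-isBrick d b-ok with child-view d b-ok
... | out t i j = subst IsBrick (outward d t i j) (isBrick d (suc t) i j)
... | inn t i j = subst IsBrick (inward′ d t i j) (inner-isBrick (not d) t i j)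

inRoom⇒isBrick : ∀ k p → InRoom (k , p) → IsBrick (k , p)
inRoom⇒isBrick zero (x , y) r with ∧⁻ {does (x ℤ.≟ + 0)} r
... | p , q with T-does⁻ (x ℤ.≟ + 0) p | ∨⁻ {does (y ℤ.≟ + 0)} q
...   | refl | inj₁ q′ with T-does⁻ (y ℤ.≟ + 0) q′
...     | refl = isBrick true 0 0 0
inRoom⇒isBrick (suc k) p r with ∨⁻ {inB 1 k (p -ᵖ e k)} r
... | inj₁ r′ = subst (λ q → IsBrick (suc k , q)) (unshift false p (e k)) (child-isBrick true (inRoom⇒isBrick k (p -ᵖ e k) r′))
... | inj₂ r′ = subst (λ q → IsBrick (suc k , q)) (unshift true p (e k)) (child-isBrick false (inRoom⇒isBrick k (p +ᵖ e k) r′))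

record Closed (π : List Brick) : Set where
  field
    outC : ∀ σ t i j → brick σ (suc t) i j ∈ π → brick σ t i j ∈ π
    innC : ∀ σ t i j → inner σ t i j ∈ π → brick σ (suc t) i j ∈ π

resting⁻ : ∀ π d k p → T (restingOnIn 1 π (child d (k , p))) → InRoom (k , p) → (k , p) ∈ π
resting⁻ π true  k p t r with ∨⁻ {not (inB 1 k ((p +ᵖ e k) -ᵖ e k))} (proj₁ (∧⁻ {not (inB 1 k ((p +ᵖ e k) -ᵖ e k)) ∨ ((k , (p +ᵖ e k) -ᵖ e k) ∈ᵇ π)} t))
... | inj₁ no-room = contradiction (subst (T ∘ inB 1 k) (sym (unshift true p (e k))) r) (T-not⁻ no-room)
... | inj₂ b∈      = ∈ᵇ⁻ (subst (λ q → T ((k , q) ∈ᵇ π)) (unshift true p (e k)) b∈)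
resting⁻ π false k p t r with ∨⁻ {not (inB 1 k ((p -ᵖ e k) +ᵖ e k))} (proj₂ (∧⁻ {not (inB 1 k ((p -ᵖ e k) -ᵖ e k)) ∨ ((k , (p -ᵖ e k) -ᵖ e k) ∈ᵇ π)} t))
... | inj₁ no-room = contradiction (subst (T ∘ inB 1 k) (sym (unshift false p (e k))) r) (T-not⁻ no-room)
... | inj₂ b∈      = ∈ᵇ⁻ (subst (λ q → T ((k , q) ∈ᵇ π)) (unshift false p (e k)) b∈)

pyramid⁻ : ∀ {π} → T (isPyramidPartition 1 π) → (∀ {b} → b ∈ π → IsBrick b) × Closed π
pyramid⁻ {π} t = (λ {b} b∈ → inRoom⇒isBrick (proj₁ b) (proj₂ b) (All.lookup room b∈)) , record
  { outC = λ σ t i j b∈ → parent σ (brick σ t i j) (brick-inRoom σ t i j) (subst (_∈ π) (outward σ t i j) b∈)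
  ; innC = λ σ t i j b∈ → parent (not σ) (brick σ (suc t) i j) (brick-inRoom σ (suc t) i j) (subst (_∈ π) (inward σ t i j) b∈) }
  where
  room = all⁺ (inRoom 1) π (proj₁ (∧⁻ {Data.Bool.ListAction.all (inRoom 1) π} t))
  rests = all⁺ (restingOnIn 1 π) π (proj₂ (∧⁻ {Data.Bool.ListAction.all (inRoom 1) π} t))
  parent : ∀ d b → InRoom b → child d b ∈ π → b ∈ π
  parent d (k , p) r b∈ = resting⁻ π d k p (All.lookup rests b∈) r

pyramid⁺ : ∀ {π} → (∀ {b} → b ∈ π → IsBrick b) → Closed π → T (isPyramidPartition 1 π)
pyramid⁺ {π} bricks closed = ∧⁺ (all⁻ (inRoom 1) (All.tabulate (room ∘ bricks))) (all⁻ (restingOnIn 1 π) (All.tabulate rests))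
  where
  open Closed closed
  room : ∀ {b} → IsBrick b → InRoom b
  room (isBrick σ t i j) = brick-inRoom σ t i j
  parent : ∀ d {b} → IsBrick b → child d b ∈ π → b ∈ π
  parent d b-ok b∈ with child-view d b-ok
  ... | out t i j = outC d t i j (subst (_∈ π) (sym (outward d t i j)) b∈)
  ... | inn t i j = innC (not d) t i j (subst (_∈ π) (sym (inward′ d t i j)) b∈)
  implies : ∀ {x y} → (T x → T y) → T (not x ∨ y)
  implies {true}  f = f tt
  implies {false} _ = tt
  rests : ∀ {b} → b ∈ π → T (restingOnIn 1 π b)
  rests {zero , p}  _  = tt
  rests {suc k , p} b∈ = ∧⁺ {not (inB 1 k (p -ᵖ e k)) ∨ ((k , p -ᵖ e k) ∈ᵇ π)}
    (implies {inB 1 k (p -ᵖ e k)} λ r → ∈ᵇ⁺ (parent true (inRoom⇒isBrick k (p -ᵖ e k) r) (subst (λ q → (suc k , q) ∈ π) (sym (unshift false p (e k))) b∈)))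
    (implies {inB 1 k (p +ᵖ e k)} λ r → ∈ᵇ⁺ (parent false (inRoom⇒isBrick k (p +ᵖ e k) r) (subst (λ q → (suc k , q) ∈ π) (sym (unshift true p (e k))) b∈)))

-- Uniqueness of slice coordinates

signed : Bool → ℕ → ℤ
signed true  t = + t
signed false t = - (+ t)

signed-injective : ∀ {σ t σ′ t′} → signed σ t ≡ signed σ′ t′ → t ≡ t′ × (t ≡ 0 ⊎ σ ≡ σ′)
signed-injective {true}  {t} {true}  {t′} eq = ℤ.+-injective eq , inj₂ refl
signed-injective {false} {t} {false} {t′} eq = ℤ.+-injective (ℤ.neg-injective eq) , inj₂ refl
signed-injective {true}  {zero}  {false} {zero}  eq = refl , inj₁ refl
signed-injective {false} {zero}  {true}  {zero}  eq = refl , inj₁ refl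
signed-injective {true}  {zero}  {false} {suc _} ()
signed-injective {true}  {suc _} {false} {zero}  ()
signed-injective {true}  {suc _} {false} {suc _} ()
signed-injective {false} {zero}  {true}  {suc _} ()
signed-injective {false} {suc _} {true}  {zero}  ()
signed-injective {false} {suc _} {true}  {suc _} ()

height : Pt → ℤ
height (x , y) = x ℤ.+ y

height-+ : ∀ p q → height (p +ᵖ q) ≡ height p ℤ.+ height q
height-+ (x , y) (u , v) = eq x y u v
  where
  eq : ∀ x y u v → (x ℤ.+ u) ℤ.+ (y ℤ.+ v) ≡ (x ℤ.+ y) ℤ.+ (u ℤ.+ v)
  eq = solve-∀

height-− : ∀ p q → height (p -ᵖ q) ≡ height p ℤ.- height q
height-− (x , y) (u , v) = eq x y u v
  where
  eq : ∀ x y u v → (x ℤ.- u) ℤ.+ (y ℤ.- v) ≡ (x ℤ.+ y) ℤ.- (u ℤ.+ v)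
  eq = solve-∀

height-e : ∀ t → height (e t) ≡ + 1
height-e t with isEven t
... | true  = refl
... | false = refl

height-base : ∀ σ t → height (base σ t) ≡ signed σ t
height-base true  zero = refl
height-base false zero = refl
height-base true  (suc t) = trans (height-+ (base true t) (e t))
  (trans (cong₂ ℤ._+_ (height-base true t) (height-e t)) (cong +_ (+-comm t 1)))
height-base false (suc t) = trans (height-− (base false t) (e t))
  (trans (cong₂ ℤ._-_ (height-base false t) (height-e t)) (eq (+ t)))
  where
  eq : ∀ x → - x ℤ.- + 1 ≡ - (+ 1 ℤ.+ x)
  eq = solve-∀

height-brick : ∀ σ t i j → height (proj₂ (brick σ t i j)) ≡ signed σ t
height-brick σ t i j = trans (height-+ (base σ t) _) (trans (cong₂ ℤ._+_ (height-base σ t) (eq (+ i) (+ j))) (ℤ.+-identityʳ _))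
  where
  eq : ∀ i j → (i ℤ.- j) ℤ.+ (j ℤ.- i) ≡ + 0
  eq = solve-∀

double-injective : ∀ {m n} → double m ≡ double n → m ≡ n
double-injective {zero}  {zero}  _  = refl
double-injective {suc m} {suc n} eq = cong suc (double-injective (suc-injective (suc-injective eq)))

sum-difference-injective : ∀ i j i′ j′ → i + j ≡ i′ + j′ → + i ℤ.- + j ≡ + i′ ℤ.- + j′ → i ≡ i′ × j ≡ j′
sum-difference-injective i j i′ j′ s d = i≡i′ , +-cancelˡ-≡ i j j′ (trans s (cong (_+ j′) (sym i≡i′)))
  where
  2* : ∀ x y → x ℤ.- y ℤ.+ (x ℤ.+ y) ≡ x ℤ.+ x
  2* = solve-∀
  double-i : i + i ≡ i′ + i′
  double-i = ℤ.+-injective (trans (sym (2* (+ i) (+ j))) (trans (cong₂ ℤ._+_ d (cong +_ s)) (2* (+ i′) (+ j′))))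
  i≡i′ : i ≡ i′
  i≡i′ = *-cancelˡ-≡ i i′ 2 (≡.subst₂ _≡_ (cong (λ n → i + n) (sym (+-identityʳ i))) (cong (λ n → i′ + n) (sym (+-identityʳ i′))) double-i)

-- The height x + y gives the slice, then the layer gives `i + j` and the first coordinate gives
-- `i - j`. The side is determined except in slice 0.
brick-injective : ∀ {σ t i j σ′ t′ i′ j′} → brick σ t i j ≡ brick σ′ t′ i′ j′ →
                  (t ≡ t′ × i ≡ i′ × j ≡ j′) × (t ≡ 0 ⊎ σ ≡ σ′)
brick-injective {σ} {t} {i} {j} {σ′} {t′} {i′} {j′} eq = (t≡t′ , ij) , sides
  where
  slice-eq = signed-injective (trans (sym (height-brick σ t i j)) (trans (cong (height ∘ proj₂) eq) (height-brick σ′ t′ i′ j′)))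
  t≡t′ = proj₁ slice-eq
  sides = proj₂ slice-eq
  base-eq : ∀ {σ t σ′ t′} → t ≡ t′ → t ≡ 0 ⊎ σ ≡ σ′ → base σ t ≡ base σ′ t′
  base-eq refl (inj₁ refl) = refl
  base-eq refl (inj₂ refl) = refl
  ij = sum-difference-injective i j i′ j′
    (double-injective (+-cancelʳ-≡ t _ _ (trans (cong proj₁ eq) (cong (λ n → double (i′ + j′) + n) (sym t≡t′)))))
    (Algebra.Properties.Group.∙-cancelˡ (AbelianGroup.group ℤ.+-0-abelianGroup) (proj₁ (base σ t)) _ _ (trans (cong (proj₁ ∘ proj₂) eq)
      (cong (λ p → proj₁ p ℤ.+ (+ i′ ℤ.- + j′)) (sym (base-eq {σ} {t} {σ′} {t′} t≡t′ sides)))))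

-- The slices of a pyramid partition

firstGap : ℕ → (ℕ → Bool) → ℕ
firstGap zero    f = 0
firstGap (suc n) f = if f 0 then suc (firstGap n (f ∘ suc)) else 0

firstGap⁻ : ∀ n f {j} → j < firstGap n f → T (f j)
firstGap⁻ (suc n) f j< with f 0 in eq
firstGap⁻ (suc n) f {zero}  j<       | true = subst T (sym eq) tt
firstGap⁻ (suc n) f {suc j} (s≤s j<) | true = firstGap⁻ n (f ∘ suc) j<

-- A downward closed set of numbers is an initial segment, so its first gap describes it completely
-- once `n` exceeds all its members.
firstGap⁺ : ∀ n f → (∀ j → T (f (suc j)) → T (f j)) → (∀ j → T (f j) → j < n) → ∀ j → T (f j) → j < firstGap n f
firstGap⁺ zero    f closed bound j t = bound j t
firstGap⁺ (suc n) f closed bound j t with f 0 in eq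
... | false = contradiction (subst T eq (first j t)) λ ()
  where
  first : ∀ j → T (f j) → T (f 0)
  first zero    t = t
  first (suc j) t = first j (closed j t)
firstGap⁺ (suc n) f closed bound zero    t | true = s≤s z≤n
firstGap⁺ (suc n) f closed bound (suc j) t | true =
  s≤s (firstGap⁺ n (f ∘ suc) (closed ∘ suc) (λ j t → s≤s⁻¹ (bound (suc j) t)) j t)

-- A crude common bound: it exceeds every layer of `π`, and hence every row and column index that
-- occurs in a slice.
depth : List Brick → ℕ
depth []      = 0
depth (b ∷ π) = suc (proj₁ b) + depth π

∈⇒<depth : ∀ {b π} → b ∈ π → proj₁ b < depth π
∈⇒<depth {b} (here refl)         = s≤s (m≤m+n (proj₁ b) _)
∈⇒<depth {π = c ∷ π} (there b∈) = ≤-trans (∈⇒<depth b∈) (m≤n+m (depth π) (suc (proj₁ c)))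

i+j≤layer : ∀ t i j → i + j ≤ double (i + j) + t
i+j≤layer t i j = ≤-trans (n≤double (i + j)) (m≤m+n _ t)

row : List Brick → Bool → ℕ → ℕ → ℕ
row π σ t i = firstGap (depth π) λ j → brick σ t i j ∈ᵇ π

slice : List Brick → Bool → ℕ → List ℕ
slice π σ t = fromRows (depth π) (row π σ t)

stepType-suc : ∀ σ t → stepType σ (suc t) ≡ not (stepType σ t)
stepType-suc true  t = isEven-suc t
stepType-suc false t = cong not (isEven-suc t)

module _ {π : List Brick} (closed : Closed π) where
  open Closed closed

  -- Slices are Young diagrams because a neighbouring slice links boxes `(i , j)` and `(suc i , j)`
  -- or `(i , suc j)`. If the strip towards slice `suc t` has kind `τ`, the link is a brick there;
  -- otherwise the strip on the inner side has kind `τ`, and the link is a brick of the preceding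
  -- slice.
  bumped-closed : ∀ τ σ t i j → bumped τ σ t i j ∈ π → brick σ t i j ∈ π
  bumped-closed τ σ t i j b∈ with stepType σ t Bool.≟ τ
  ... | yes eq = outC σ t i j (innC σ t i j (subst (λ τ → bumped τ σ t i j ∈ π) (sym eq) b∈))
  -- The slice preceding slice 0 is slice 1 of the opposite side, whose first strip has the other
  -- kind.
  bumped-closed τ σ zero i j b∈ | no ne =
    outC (not σ) 0 i j (innC (not σ) 0 i j (subst (λ τ → bumped τ σ 0 i j ∈ π) (other σ ne) b∈))
    where
    other : ∀ σ → stepType σ 0 ≢ τ → τ ≡ stepType (not σ) 0
    other true  ne = ¬-not (ne ∘ sym)
    other false ne = ¬-not (ne ∘ sym)
  bumped-closed τ σ (suc t) i j b∈ | no ne =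
    innC σ t i j (subst (λ τ → bumped τ σ t i j ∈ π) τ≡ (outer τ b∈))
    where
    τ≡ : τ ≡ stepType σ t
    τ≡ = trans (¬-not (ne ∘ sym)) (trans (cong not (stepType-suc σ t)) (not-involutive (stepType σ t)))
    outer : ∀ τ → bumped τ σ (suc t) i j ∈ π → bumped τ σ t i j ∈ π
    outer true  = outC σ t (suc i) j
    outer false = outC σ t i (suc j)

  row⁻ : ∀ σ t i {j} → j < row π σ t i → brick σ t i j ∈ π
  row⁻ σ t i {j} j< = ∈ᵇ⁻ {brick σ t i j} (firstGap⁻ (depth π) _ j<)

  row⁺ : ∀ σ t i j → brick σ t i j ∈ π → j < row π σ t i
  row⁺ σ t i j b∈ = firstGap⁺ (depth π) _
    (λ j t′ → ∈ᵇ⁺ (bumped-closed false σ t i j (∈ᵇ⁻ {brick σ t i (suc j)} t′)))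
    (λ j t′ → ≤-<-trans (≤-trans (m≤n+m j i) (i+j≤layer t i j)) (∈⇒<depth (∈ᵇ⁻ {brick σ t i j} {π} t′)))
    j (∈ᵇ⁺ b∈)

  private
    dec : ∀ σ t → Decreasing (row π σ t)
    dec σ t i = <⇒≤-ext λ {j} j< → row⁺ σ t i j (bumped-closed true σ t i j (row⁻ σ t (suc i) j<))
    far : ∀ σ t i → depth π ≤ i → row π σ t i ≡ 0
    far σ t i le = n≤0⇒n≡0 (≮⇒≥ λ 0< → <⇒≱
      (≤-<-trans (≤-trans (m≤m+n i 0) (i+j≤layer t i 0)) (∈⇒<depth (row⁻ σ t i 0<))) le)

  slice-‼ : ∀ σ t i → slice π σ t ‼ i ≡ row π σ t i
  slice-‼ σ t = fromRows-‼ (depth π) (row π σ t) (dec σ t) (far σ t)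

  slice-isPartition : ∀ σ t → IsPartition (slice π σ t)
  slice-isPartition σ t = fromRows-isPartition (depth π) (row π σ t) (dec σ t) (far σ t)

  slice⁻ : ∀ σ t i j → j < slice π σ t ‼ i → brick σ t i j ∈ π
  slice⁻ σ t i j j< = row⁻ σ t i (subst (j <_) (slice-‼ σ t i) j<)

  slice⁺ : ∀ σ t i j → brick σ t i j ∈ π → j < slice π σ t ‼ i
  slice⁺ σ t i j b∈ = subst (j <_) (sym (slice-‼ σ t i)) (row⁺ σ t i j b∈)

  slice-strip : ∀ σ t → Strip (stepType σ t) (slice π σ (suc t)) (slice π σ t)
  slice-strip σ t = strip (stepType σ t) (innC σ t)
    where
    smaller : ∀ i → slice π σ (suc t) ‼ i ≤ slice π σ t ‼ i
    smaller i = <⇒≤-ext λ {j} j< → slice⁺ σ t i j (outC σ t i j (slice⁻ σ (suc t) i j j<))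
    strip : ∀ τ → (∀ i j → bumped τ σ t i j ∈ π → brick σ (suc t) i j ∈ π) → Strip τ (slice π σ (suc t)) (slice π σ t)
    strip true  c i = smaller i , <⇒≤-ext λ {j} j< → slice⁺ σ (suc t) i j (c i j (slice⁻ σ t (suc i) j j<))
    strip false c i = smaller i , <⇒≤-ext λ
      { {zero}  _  → s≤s z≤n
      ; {suc j} j< → s≤s (slice⁺ σ (suc t) i j (c i j (slice⁻ σ t i (suc j) j<))) }

  -- A nonempty slice `t` contains its corner brick, and with it the corner bricks of slices 0 to
  -- `t`. They lie in `suc t` different layers, more than `π` has bricks.
  slice-empty : ∀ σ t → length π ≤ t → slice π σ t ≡ []
  slice-empty σ t le = partition-ext (slice-isPartition σ t) []-isPartition λ i → n≤0⇒n≡0 (≮⇒≥ (none i))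
    where
    apex : ∀ i → brick σ t i 0 ∈ π → brick σ t 0 0 ∈ π
    apex zero    b∈ = b∈
    apex (suc i) b∈ = apex i (bumped-closed true σ t i 0 b∈)
    descend : ∀ t r → brick σ t 0 0 ∈ π → r < suc t → brick σ r 0 0 ∈ π
    descend t r b∈ (s≤s r≤t) with m≤n⇒m<n∨m≡n r≤t
    ... | inj₂ refl = b∈
    descend (suc t) r b∈ (s≤s r≤t) | inj₁ r<t = descend t r (outC σ t 0 0 b∈) r<t
    none : ∀ i → 0 < slice π σ t ‼ i → _
    none i 0< = <⇒≱ (layers≤length (suc t) π λ r r<t → brick σ r 0 0 , descend t r (apex i (slice⁻ σ t i 0 0<)) r<t , refl) le

chain-intro : ∀ f n (s : ℕ → List ℕ) → (∀ t → IsPartition (s t) × Strip (Letter.kind (f t)) (s (suc t)) (s t)) → s n ≡ [] →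
              Chain (applyUpTo f n) (s 0) (applyUpTo (s ∘ suc) n)
chain-intro f zero    s ok end = end
chain-intro f (suc n) s ok end =
  proj₁ (ok 0) , proj₂ (ok 0) , chain-intro (f ∘ suc) n (s ∘ suc) (ok ∘ suc) end

-- Padding with empty partitions lets the strip conditions hold for all `t`, with no bound to carry
-- along.
chain-elim : ∀ f n {l ks} → Chain (applyUpTo f n) l ks → let s = nth [] (l ∷ ks) in
             (∀ t → IsPartition (s t) × Strip (Letter.kind (f t)) (s (suc t)) (s t)) × ks ≡ applyUpTo (s ∘ suc) n
chain-elim f zero {l} {[]} refl = (λ { zero → ok 0 ; (suc t) → ok (suc t) }) , refl
  where
  ok : ∀ t → IsPartition [] × Strip (Letter.kind (f t)) [] []
  ok t = []-isPartition , []-strip (Letter.kind (f t))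
chain-elim f (suc n) {l} {k ∷ ks} (lP , s , ch) = let (ok , eq) = chain-elim (f ∘ suc) n ch in
  (λ { zero → lP , s ; (suc t) → ok t }) , cong (k ∷_) eq

nth-applyUpTo : ∀ (s : ℕ → List ℕ) n → (∀ t → n < t → s t ≡ []) → ∀ t → nth [] (s 0 ∷ applyUpTo (s ∘ suc) n) t ≡ s t
nth-applyUpTo s n       far zero    = refl
nth-applyUpTo s zero    far (suc t) = sym (far (suc t) (s≤s z≤n))
nth-applyUpTo s (suc n) far (suc t) = nth-applyUpTo (s ∘ suc) n (λ t n<t → far (suc t) (s≤s n<t)) t

-- Pyramid partitions as pairs of chains

Slices : Set
Slices = List ℕ × List (List ℕ) × List (List ℕ)

sliceOf : Slices → Bool → ℕ → List ℕ
sliceOf (l , ks , ms) true  = nth [] (l ∷ ms)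
sliceOf (l , ks , ms) false = nth [] (l ∷ ks)

toSlices : ℕ → List Brick → Slices
toSlices L π = slice π true 0 , applyUpTo (slice π false ∘ suc) L , applyUpTo (slice π true ∘ suc) L

-- Slice 0 is listed with the right side alone, so no brick occurs twice and sorting yields a
-- strictly increasing list.
unsorted fromSlices : Slices → List Brick
unsorted (l , ks , ms) = slices (brick true) (l ∷ ms) ++ slices (brick false ∘ suc) ks
fromSlices x = sort (unsorted x)

unsorted⁻ : ∀ x {b} → b ∈ unsorted x → ∃ λ σ → ∃ λ t → ∃ λ i → ∃ λ j → j < sliceOf x σ t ‼ i × b ≡ brick σ t i j
unsorted⁻ (l , ks , ms) b∈ with ∈-++⁻ (slices (brick true) (l ∷ ms)) b∈
... | inj₁ b∈ʳ = true , ∈-slices⁻ (brick true) (l ∷ ms) b∈ʳ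
... | inj₂ b∈ˡ = let (t , p) = ∈-slices⁻ (brick false ∘ suc) ks b∈ˡ in false , suc t , p

unsorted⁺ : ∀ x σ t i j → j < sliceOf x σ t ‼ i → brick σ t i j ∈ unsorted x
unsorted⁺ (l , ks , ms) true  t       i j j< = ∈-++⁺ˡ (∈-slices⁺ (brick true) (l ∷ ms) t i j j<)
unsorted⁺ (l , ks , ms) false zero    i j j< = ∈-++⁺ˡ (∈-slices⁺ (brick true) (l ∷ ms) 0 i j j<)
unsorted⁺ (l , ks , ms) false (suc t) i j j< =
  ∈-++⁺ʳ (slices (brick true) (l ∷ ms)) (∈-slices⁺ (brick false ∘ suc) ks t i j j<)

unsorted-unique : ∀ x → Unique (unsorted x)
unsorted-unique (l , ks , ms) = ++⁺
  (slices-unique (brick true) (λ {t} {i} {j} {t′} {i′} {j′} eq → proj₁ (brick-injective {true} {t} {i} {j} {true} {t′} {i′} {j′} eq)) (l ∷ ms))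
  (slices-unique (brick false ∘ suc) (λ {t} {i} {j} {t′} {i′} {j′} eq →
    let ((t≡ , ij) , _) = brick-injective {false} {suc t} {i} {j} {false} {suc t′} {i′} {j′} eq in suc-injective t≡ , ij) ks)
  λ (p , q) → let (t , i , j , _ , eq) = ∈-slices⁻ (brick true) (l ∷ ms) p
                  (t′ , i′ , j′ , _ , eq′) = ∈-slices⁻ (brick false ∘ suc) ks q
              in disjoint (brick-injective {true} {t} {i} {j} {false} {suc t′} {i′} {j′} (trans (sym eq) eq′))
  where
  disjoint : ∀ {t t′ i i′ j j′} → ¬ ((t ≡ suc t′ × i ≡ i′ × j ≡ j′) × (t ≡ 0 ⊎ true ≡ false))
  disjoint ((refl , _) , inj₁ ())
  disjoint ((refl , _) , inj₂ ())

fromSlices⁻ : ∀ x {b} → b ∈ fromSlices x → ∃ λ σ → ∃ λ t → ∃ λ i → ∃ λ j → j < sliceOf x σ t ‼ i × b ≡ brick σ t i j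
fromSlices⁻ x b∈ = unsorted⁻ x (∈-resp-↭ (sort-↭ (unsorted x)) b∈)

fromSlices⁺ : ∀ x σ t i j → j < sliceOf x σ t ‼ i → brick σ t i j ∈ fromSlices x
fromSlices⁺ x σ t i j j< = ∈-resp-↭ (↭-sym (sort-↭ (unsorted x))) (unsorted⁺ x σ t i j j<)

-- Coordinates are unique except for the side in slice 0, where `sliceOf` returns the same partition
-- for both.
fromSlices-brick : ∀ x σ t i j → brick σ t i j ∈ fromSlices x → j < sliceOf x σ t ‼ i
fromSlices-brick x σ t i j b∈ = let (σ′ , t′ , i′ , j′ , j< , eq) = fromSlices⁻ x b∈ in
  transport {σ} {t} {i} {j} {σ′} j< (brick-injective {σ} {t} {i} {j} {σ′} {t′} {i′} {j′} eq)
  where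
  transport : ∀ {σ t i j σ′ t′ i′ j′} → j′ < sliceOf x σ′ t′ ‼ i′ →
              (t ≡ t′ × i ≡ i′ × j ≡ j′) × (t ≡ 0 ⊎ σ ≡ σ′) → j < sliceOf x σ t ‼ i
  transport j< ((refl , refl , refl) , inj₂ refl) = j<
  transport {true}  {σ′ = true}  j< ((refl , refl , refl) , inj₁ refl) = j<
  transport {true}  {σ′ = false} j< ((refl , refl , refl) , inj₁ refl) = j<
  transport {false} {σ′ = true}  j< ((refl , refl , refl) , inj₁ refl) = j<
  transport {false} {σ′ = false} j< ((refl , refl , refl) , inj₁ refl) = j<

count-slices : ∀ p G h ks → (∀ t i j → [ p (G t i j) ] ≡ h t) → count p (slices G ks) ≡ slicesWt h ks
count-slices p G h []       eq = refl
count-slices p G h (k ∷ ks) eq = trans (count-++ p (rows (G 0) k) _)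
  (cong₂ _+_ (count-rows p (G 0) k (h 0) (eq 0)) (count-slices p (G ∘ suc) (h ∘ suc) ks (eq ∘ suc)))

brick-tint : ∀ c σ t i j → [ tint c (brick σ t i j) ] ≡ hue c t
brick-tint true  σ t i j = cong [_] (isEven-double+ (i + j) t)
brick-tint false σ t i j = cong ([_] ∘ not) (isEven-double+ (i + j) t)

Sides : ℕ → WSet
Sides L = TwoChains (side false L) (side true L)

fromSlices-count : ∀ L c {x} → Ok (Sides L) x → count (tint c) (fromSlices x) ≡ wt (Sides L) c x
fromSlices-count L c {x@(l , ks , ms)} ok = begin
  count (tint c) (fromSlices x)
    ≡⟨ count-↭ (tint c) (sort-↭ (unsorted x)) ⟩
  count (tint c) (unsorted x)
    ≡⟨ count-++ (tint c) (slices (brick true) (l ∷ ms)) _ ⟩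
  count (tint c) (slices (brick true) (l ∷ ms)) + count (tint c) (slices (brick false ∘ suc) ks)
    ≡⟨ cong₂ _+_ (count-slices (tint c) (brick true) (hue c) (l ∷ ms) (brick-tint c true))
                 (count-slices (tint c) (brick false ∘ suc) (hue c ∘ suc) ks (brick-tint c false ∘ suc)) ⟩
  slicesWt (hue c) (l ∷ ms) + slicesWt (hue c ∘ suc) ks
    ≡⟨ +-comm (slicesWt (hue c) (l ∷ ms)) _ ⟩
  slicesWt (hue c ∘ suc) ks + slicesWt (hue c) (l ∷ ms)
    ≡⟨ twoChains-wt L c ok ⟨
  wt (Sides L) c x ∎
  where open ≡.≡-Reasoning

sides-strips : ∀ L {x} → Ok (Sides L) x → ∀ σ t →
               IsPartition (sliceOf x σ t) × Strip (stepType σ t) (sliceOf x σ (suc t)) (sliceOf x σ t)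
sides-strips L (chˡ , chʳ) true  = proj₁ (chain-elim (step true) L chʳ)
sides-strips L (chˡ , chʳ) false = proj₁ (chain-elim (step false) L chˡ)

fromSlices-closed : ∀ L {x} → Ok (Sides L) x → Closed (fromSlices x)
fromSlices-closed L {x} ok = record
  { outC = λ σ t i j b∈ → fromSlices⁺ x σ t i j
      (<-≤-trans (fromSlices-brick x σ (suc t) i j b∈) (strip-≤ (stepType σ t) (proj₂ (sides-strips L ok σ t)) i))
  ; innC = λ σ t i j b∈ → fromSlices⁺ x σ (suc t) i j (innStrip (stepType σ t) {σ} {t} {i} {j} (proj₂ (sides-strips L ok σ t)) b∈) }
  where
  innStrip : ∀ τ {σ t i j} → Strip τ (sliceOf x σ (suc t)) (sliceOf x σ t) → bumped τ σ t i j ∈ fromSlices x → j < sliceOf x σ (suc t) ‼ i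
  innStrip true  {σ} {t} {i} {j} s b∈ = <-≤-trans (fromSlices-brick x σ t (suc i) j b∈) (proj₂ (s i))
  innStrip false {σ} {t} {i} {j} s b∈ = s≤s⁻¹ (<-≤-trans (fromSlices-brick x σ t i (suc j) b∈) (proj₂ (s i)))

slice-fromSlices : ∀ L {x} → Ok (Sides L) x → ∀ σ t → slice (fromSlices x) σ t ≡ sliceOf x σ t
slice-fromSlices L {x} ok σ t = partition-ext (slice-isPartition closed σ t) (proj₁ (sides-strips L ok σ t))
  λ i → <⇔⇒≡ (λ {j} j< → fromSlices-brick x σ t i j (slice⁻ closed σ t i j j<))
             (λ {j} j< → slice⁺ closed σ t i j (fromSlices⁺ x σ t i j j<))
  where closed = fromSlices-closed L ok

applyUpTo-cong : ∀ {A : Set} {f g : ℕ → A} n → (∀ t → f t ≡ g t) → applyUpTo f n ≡ applyUpTo g n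
applyUpTo-cong zero    eq = refl
applyUpTo-cong (suc n) eq = cong₂ _∷_ (eq 0) (applyUpTo-cong n (eq ∘ suc))

toSlices-fromSlices : ∀ L {x} → Ok (Sides L) x → toSlices L (fromSlices x) ≡ x
toSlices-fromSlices L {x} ok@(chˡ , chʳ) = cong₂ _,_ (slice-fromSlices L ok true 0) (cong₂ _,_
  (trans (applyUpTo-cong L (slice-fromSlices L ok false ∘ suc)) (sym (proj₂ (chain-elim (step false) L chˡ))))
  (trans (applyUpTo-cong L (slice-fromSlices L ok true ∘ suc)) (sym (proj₂ (chain-elim (step true) L chʳ)))))

module _ {π : List Brick} (closed : Closed π) {L : ℕ} (len : length π ≤ L) where

  toSlices-ok : Ok (Sides L) (toSlices L π)
  toSlices-ok = chain false , chain true
    where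
    chain : ∀ σ → Chain (side σ L) (slice π σ 0) (applyUpTo (slice π σ ∘ suc) L)
    chain σ = chain-intro (step σ) L (slice π σ) (λ t → slice-isPartition closed σ t , slice-strip closed σ t)
      (slice-empty closed σ L len)

  sliceOf-toSlices : ∀ σ t → sliceOf (toSlices L π) σ t ≡ slice π σ t
  sliceOf-toSlices true  = nth-applyUpTo (slice π true) L λ t L<t → slice-empty closed true t (≤-trans len (<⇒≤ L<t))
  sliceOf-toSlices false = nth-applyUpTo (slice π false) L λ t L<t → slice-empty closed false t (≤-trans len (<⇒≤ L<t))

  fromSlices-toSlices : T (strictlySorted π) → (∀ {b} → b ∈ π → IsBrick b) → fromSlices (toSlices L π) ≡ π
  fromSlices-toSlices sorted bricks = sorted-ext
    (Linked⇒AllPairs (λ {b} {c} {d} → ≺-trans {b} {c} {d}) (sort-strict (unsorted (toSlices L π)) (unsorted-unique (toSlices L π))))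
    (strictlySorted⁻ π sorted) f (λ b∈ → g (bricks b∈) b∈)
    where
    f : ∀ {b} → b ∈ fromSlices (toSlices L π) → b ∈ π
    f b∈ = let (σ , t , i , j , j< , eq) = fromSlices⁻ (toSlices L π) b∈ in
      subst (_∈ π) (sym eq) (slice⁻ closed σ t i j (subst (λ l → j < l ‼ i) (sliceOf-toSlices σ t) j<))
    g : ∀ {b} → IsBrick b → b ∈ π → b ∈ fromSlices (toSlices L π)
    g (isBrick σ t i j) b∈ = fromSlices⁺ (toSlices L π) σ t i j
      (subst (λ l → j < l ‼ i) (sym (sliceOf-toSlices σ t)) (slice⁺ closed σ t i j b∈))

PPTest : ℕ → ℕ → List Brick → Bool
PPTest a b π = strictlySorted π ∧ isPyramidPartition 1 π ∧ does (darkCount π ℕ.≟ a) ∧ does (lightCount π ℕ.≟ b)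

record IsPP (a b : ℕ) (π : List Brick) : Set where
  field
    sorted : T (strictlySorted π)
    bricks : ∀ {b} → b ∈ π → IsBrick b
    closed : Closed π
    dark   : darkCount π ≡ a
    light  : lightCount π ≡ b

isPP⁻ : ∀ a b π → T (PPTest a b π) → IsPP a b π
isPP⁻ a b π t =
  let (s , t₁) = ∧⁻ {strictlySorted π} t
      (p , t₂) = ∧⁻ {isPyramidPartition 1 π} t₁
      (d , l) = ∧⁻ {does (darkCount π ℕ.≟ a)} t₂
      (bs , cl) = pyramid⁻ p
  in record { sorted = s ; bricks = bs ; closed = cl ; dark = T-does⁻ (darkCount π ℕ.≟ a) d ; light = T-does⁻ (lightCount π ℕ.≟ b) l }

isPP⁺ : ∀ a b π → IsPP a b π → T (PPTest a b π)
isPP⁺ a b π p = ∧⁺ {strictlySorted π} sorted (∧⁺ {isPyramidPartition 1 π} (pyramid⁺ bricks closed)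
  (∧⁺ {does (darkCount π ℕ.≟ a)} (T-does⁺ (darkCount π ℕ.≟ a) dark) (T-does⁺ (lightCount π ℕ.≟ b) light)))
  where open IsPP p

-- With `a + b` bricks all slices from number `a + b` on are empty, so the bound `L`, taken from
-- `grid≡rhsCoeff`, is large enough.
pyramids≅slices : ∀ a b → Subset (List Brick) (T ∘ PPTest a b) ≅ fiber (Sides (double (a + b))) a b
pyramids≅slices a b = record
  { to = toSlices L ; from = fromSlices
  ; to-ok = λ {π} t → let p = isPP⁻ a b π t in to-ok′ p
  ; from-ok = λ {x} ok → isPP⁺ a b (fromSlices x) (from-ok′ ok)
  ; from-to = λ {π} t → let p = isPP⁻ a b π t in fromSlices-toSlices (IsPP.closed p) (short p) (IsPP.sorted p) (IsPP.bricks p)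
  ; to-from = λ (ok , _) → toSlices-fromSlices L ok
  ; to-wt = λ _ _ → refl }
  where
  L = double (a + b)
  short : ∀ {π} → IsPP a b π → length π ≤ L
  short {π} p = ≤-trans (≤-reflexive (trans (sym (dark+light≡length π)) (cong₂ _+_ (IsPP.dark p) (IsPP.light p)))) (n≤double (a + b))
  to-ok′ : ∀ {π} → IsPP a b π → Ok (fiber (Sides L) a b) (toSlices L π)
  to-ok′ {π} p = ok , weigh true (IsPP.dark p) , weigh false (IsPP.light p)
    where
    ok = toSlices-ok (IsPP.closed p) (short p)
    weigh : ∀ c {n} → count (tint c) π ≡ n → wt (Sides L) c (toSlices L π) ≡ n
    -- The weight is computed from the rebuilt list, which is `π` again.
    weigh c eq = trans (sym (fromSlices-count L c ok))
      (trans (cong (count (tint c)) (fromSlices-toSlices (IsPP.closed p) (short p) (IsPP.sorted p) (IsPP.bricks p))) eq)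
  from-ok′ : ∀ {x} → Ok (fiber (Sides L) a b) x → IsPP a b (fromSlices x)
  from-ok′ {x} (ok , d , l) = record
    { sorted = linked⇒strictlySorted (sort-strict (unsorted x) (unsorted-unique x))
    ; bricks = λ b∈ → let (σ , t , i , j , _ , eq) = fromSlices⁻ x b∈ in subst IsBrick (sym eq) (isBrick σ t i j)
    ; closed = fromSlices-closed L ok
    ; dark = trans (fromSlices-count L true ok) d
    ; light = trans (fromSlices-count L false ok) l }

theorem1 : (a b : ℕ) → PP 1 a b ↔ Fin (rhsCoeff a b)
theorem1 a b = ≅-Below⇒↔Fin T-irrelevant (≅-trans (pyramids≅slices a b)
  (subst (λ n → fiber (Sides (double (a + b))) a b ≅ Below n) (grid≡rhsCoeff a b)
    (coefficient (twoChains-hasSeries (double (a + b))) a b)))
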